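{- In $\mathbb{Z}[t][[u]]$, \[ \sum_{n=2}^\infty Z_{W_n}(t) u^{n}=-\frac{2 u (1-(t+1) u) (t (u+1)+1)}{1-(t+1) u-2 t u^2+\sqrt{(1-(t+1) u)^2-4 t u^2}}+\frac{1}{\sqrt{(1-(t+1) u)^2-4 t u^2}}-1, \] where the square root is the power series in $u$ with constant term $1$.
   Context: For a matroid $M$ let $L(M)$ be its lattice of flats, $\mathrm{rk}\, M$ its rank, $\chi_M(t)$ its characteristic polynomial; for a flat $F$, $M_F$ is the localization (restriction to $F$) and $M^F$ the contraction at $F$. The Kazhdan–Lusztig polynomial is the unique assignment of $P_M(t)\in\mathbb{Z}[t]$ to each loopless matroid $M$ with: $P_M=1$ if $\mathrm{rk}\, M=0$; $\deg P_M<\frac12\mathrm{rk}\, M$ if $\mathrm{rk}\, M>0$; $t^{\mathrm{rk}\, M}P_M(t^{ -1})=\sum_{F\in L(M)}\chi_{M_F}(t)P_{M^F}(t)$. The $Z$-polynomial is $Z_M(t)=\sum_{F\in L(M)}t^{\mathrm{rk}\, M_F}P_{M^F}(t)$; for a graph $G$, $Z_G=Z_{M(G)}$. For $n\ge3$ the wheel $W_n$ has vertices $0,\dots,n$, the edges of the cycle $1,2,\dots,n,1$ and edges $\{0,i\}$ ($1\le i\le n$); $W_2$ denotes the simple cycle (triangle) on three vertices. -}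

module Defs where

open import Data.Bool using (Bool; true; false; _∧_; _∨_; not; if_then_else_)
open import Data.Nat as ℕ using (ℕ; zero; suc; _∸_; _≡ᵇ_; _<ᵇ_)
open import Data.Fin using (Fin; zero; suc; splitAt; toℕ)
open import Data.Sum using (inj₁; inj₂)
open import Data.Integer as ℤ using (ℤ; +_; -_)
open import Data.List using (List; []; _∷_; _++_; map; foldr; concatMap; allFin; filterᵇ; replicate; upTo; length)
open import Data.Bool.ListAction using (all; any)
open import Data.Product using (_×_; _,_; Σ; proj₁; proj₂)
open import Relation.Binary.PropositionalEquality using (_≡_)

-- Polynomials in ℤ[t]: coefficient lists, lowest degree first.

Poly : Set
Poly = List ℤ

addP : Poly → Poly → Poly
addP [] q = q
addP p [] = p
addP (a ∷ p) (b ∷ q) = (a ℤ.+ b) ∷ addP p q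

scaleP : ℤ → Poly → Poly
scaleP c p = map (c ℤ.*_) p

mulP : Poly → Poly → Poly
mulP [] q = []
mulP (a ∷ p) q = addP (scaleP a q) (+ 0 ∷ mulP p q)

monoP : ℕ → ℤ → Poly
monoP k c = replicate k (+ 0) ++ (c ∷ [])

sumP : List Poly → Poly
sumP = foldr addP []

coeff : Poly → ℕ → ℤ
coeff [] i = + 0
coeff (a ∷ p) zero = a
coeff (a ∷ p) (suc i) = coeff p i

Subset : ℕ → Set
Subset m = Fin m → Bool

ext : {m : ℕ} → Bool → Subset m → Subset (suc m)
ext b A zero = b
ext b A (suc i) = A i

allSubsets : (m : ℕ) → List (Subset m)
allSubsets zero = (λ ()) ∷ []
allSubsets (suc m) = concatMap (λ A → ext false A ∷ ext true A ∷ []) (allSubsets m)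

_⊆ᵇ_ : {m : ℕ} → Subset m → Subset m → Bool
_⊆ᵇ_ {m} A B = all (λ i → not (A i) ∨ B i) (allFin m)

_∪_ : {m : ℕ} → Subset m → Subset m → Subset m
(A ∪ B) i = A i ∨ B i

_∖_ : {m : ℕ} → Subset m → Subset m → Subset m
(A ∖ B) i = A i ∧ not (B i)

single : {m : ℕ} → Fin m → Subset m
single e i = toℕ e ≡ᵇ toℕ i

card : {m : ℕ} → Subset m → ℕ
card {m} A = length (filterᵇ A (allFin m))

nonempty : {m : ℕ} → Subset m → Bool
nonempty {m} A = any A (allFin m)

-- Matroids given by a rank function; the ground set is a subset `gr`
-- of Fin m (so that restrictions and contractions keep the same m).

record Mat : Set where
  field
    m  : ℕ
    gr : Subset m
    rk : Subset m → ℕ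
open Mat public

subsetsOf : (M : Mat) → List (Subset (m M))
subsetsOf M = filterᵇ (λ A → A ⊆ᵇ gr M) (allSubsets (m M))

rankM : Mat → ℕ
rankM M = rk M (gr M)

isFlat : (M : Mat) → Subset (m M) → Bool
isFlat M F = (F ⊆ᵇ gr M) ∧
  all (λ e → not ((gr M ∖ F) e) ∨ not (rk M (F ∪ single e) ≡ᵇ rk M F)) (allFin (m M))

flats : (M : Mat) → List (Subset (m M))
flats M = filterᵇ (isFlat M) (allSubsets (m M))

restrict : (M : Mat) → Subset (m M) → Mat
restrict M F = record { m = m M ; gr = F ; rk = rk M }

contract : (M : Mat) → Subset (m M) → Mat
contract M F = record { m = m M ; gr = gr M ∖ F ; rk = λ A → rk M (A ∪ F) ∸ rk M F }

sign : ℕ → ℤ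
sign zero = + 1
sign (suc n) = - sign n

charPoly : Mat → Poly
charPoly M = sumP (map (λ A → monoP (rankM M ∸ rk M A) (sign (card A))) (subsetsOf M))

-- Kazhdan–Lusztig polynomial, computed by the defining recursion with fuel.
-- For loopless M of rank r > 0, the defining identity
--   t^r P_M(t^{-1}) - P_M(t) = Σ_{F ∈ L(M), F ≠ ∅} χ_{M_F}(t) P_{M^F}(t) =: Q(t)
-- together with deg P_M < r/2 forces  P_M(t) = Σ_{2i<r} [t^{r-i}]Q · t^i.
KLfuel : ℕ → Mat → Poly
KLfuel zero M = + 1 ∷ []
KLfuel (suc k) M with rankM M
... | zero = + 1 ∷ []
... | suc r' =
  let r = suc r'
      Q = sumP (map (λ F → mulP (charPoly (restrict M F)) (KLfuel k (contract M F)))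
                    (filterᵇ nonempty (flats M)))
  in sumP (map (λ i → monoP i (coeff Q (r ∸ i)))
               (filterᵇ (λ i → (i ℕ.+ i) <ᵇ r) (upTo r)))

-- fuel m+1 suffices: each contraction by a nonempty flat shrinks the ground set
KL : Mat → Poly
KL M = KLfuel (suc (m M)) M

Zpoly : Mat → Poly
Zpoly M = sumP (map (λ F → mulP (monoP (rk M F) (+ 1)) (KL (contract M F))) (flats M))

-- Graphs (vertices 0,…,V-1 as naturals, edges indexed by Fin E)
-- and their graphic (cycle) matroids.

record Graph : Set where
  field
    V    : ℕ
    E    : ℕ
    ends : Fin E → ℕ × ℕ
open Graph public

reach : (G : Graph) → Subset (E G) → ℕ → ℕ → ℕ → Bool
reach G A zero x y = x ≡ᵇ y
reach G A (suc k) x y = reach G A k x y ∨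
  any (λ e → A e ∧ ((reach G A k x (proj₁ (ends G e)) ∧ (proj₂ (ends G e) ≡ᵇ y)) ∨
                    (reach G A k x (proj₂ (ends G e)) ∧ (proj₁ (ends G e) ≡ᵇ y))))
      (allFin (E G))

-- number of connected components of the spanning subgraph (V, A):
-- count vertices that are the least vertex of their component
components : (G : Graph) → Subset (E G) → ℕ
components G A = length (filterᵇ (λ x → not (any (λ y → (y <ᵇ x) ∧ reach G A (V G) x y) (upTo (V G))))
                                  (upTo (V G)))

graphicMat : Graph → Mat
graphicMat G = record { m = E G ; gr = λ _ → true ; rk = λ A → V G ∸ components G A }

Zgraph : Graph → Poly
Zgraph G = Zpoly (graphicMat G)

-- Wheels. For n ≥ 3: vertices 0..n, edges 0..n-1 are the spokes {0,i+1},
-- edges n..2n-1 are the rim edges {i+1, i+2} (i < n-1) and {n, 1}.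
-- W_2 is the triangle on vertices 0,1,2.
rimNext : ℕ → ℕ → ℕ
rimNext n j = if suc j ≡ᵇ n then 1 else suc (suc j)

wheelGen : ℕ → Graph
wheelGen n = record
  { V = suc n
  ; E = n ℕ.+ n
  ; ends = λ e → spokeOrRim e
  }
  where
  spokeOrRim : Fin (n ℕ.+ n) → ℕ × ℕ
  spokeOrRim e with splitAt n e
  ... | inj₁ i = 0 , suc (toℕ i)
  ... | inj₂ i = suc (toℕ i) , rimNext n (toℕ i)

triangle : Graph
triangle = record { V = 3 ; E = 3 ; ends = tri }
  where
  tri : Fin 3 → ℕ × ℕ
  tri zero = 0 , 1
  tri (suc zero) = 1 , 2
  tri (suc (suc zero)) = 2 , 0

wheel : ℕ → Graph
wheel (suc (suc zero)) = triangle
wheel n = wheelGen n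

-- Power series in ℤ[t][[u]]: s n i = coefficient of t^i u^n.

Ser : Set
Ser = ℕ → ℕ → ℤ

IsPolySer : Ser → Set
IsPolySer s = ∀ n → Σ ℕ λ d → ∀ i → d ℕ.< i → s n i ≡ + 0

_≈ˢ_ : Ser → Ser → Set
f ≈ˢ g = ∀ n i → f n i ≡ g n i

infix 4 _≈ˢ_

sumTo : ℕ → (ℕ → ℤ) → ℤ
sumTo zero f = f 0
sumTo (suc n) f = sumTo n f ℤ.+ f (suc n)

_⊕_ : Ser → Ser → Ser
(f ⊕ g) n i = f n i ℤ.+ g n i

_⊖_ : Ser → Ser → Ser
(f ⊖ g) n i = f n i ℤ.- g n i

_⊗_ : Ser → Ser → Ser
(f ⊗ g) n i = sumTo n (λ a → sumTo i (λ j → f a j ℤ.* g (n ∸ a) (i ∸ j)))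

infixl 6 _⊕_ _⊖_
infixl 7 _⊗_

monoS : ℤ → ℕ → ℕ → Ser
monoS c a b n i = if (n ≡ᵇ b) ∧ (i ≡ᵇ a) then c else + 0

oneS tS uS : Ser
oneS = monoS (+ 1) 0 0
tS = monoS (+ 1) 1 0
uS = monoS (+ 1) 0 1

constS : ℤ → Ser
constS c = monoS c 0 0

Aser : Ser
Aser = oneS ⊖ (tS ⊕ oneS) ⊗ uS

Δser : Ser
Δser = Aser ⊗ Aser ⊖ constS (+ 4) ⊗ tS ⊗ uS ⊗ uS

NumSer : Ser
NumSer = constS (- (+ 2)) ⊗ uS ⊗ Aser ⊗ (tS ⊗ (uS ⊕ oneS) ⊕ oneS)

DenSer : Ser → Ser
DenSer S = Aser ⊖ constS (+ 2) ⊗ tS ⊗ uS ⊗ uS ⊕ S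

ZWheelSer : Ser
ZWheelSer zero i = + 0
ZWheelSer (suc zero) i = + 0
ZWheelSer (suc (suc k)) i = coeff (Zgraph (wheel (suc (suc k)))) i

{-# OPTIONS --safe #-}

-- If polynomials P_F, for F a flat of M, satisfy P_F = 1 in corank 0, 2 deg P_F < corank otherwise, and
-- Σ_{F ⊇ A} t^{rk F - rk A} P_F is palindromic of degree rk M - rk A for every A, then P_F is the
-- Kazhdan–Lusztig polynomial of M^F: write χ as Whitney's alternating sum over sets A, exchange the sums
-- over A and F, use palindromicity, exchange back; Σ_{A ⊆ F} (-1)^|A| leaves only F = ∅.
-- A flat of the wheel is a cyclic word over {hub, block end, inside of a block}, and P_F is a product of
-- fan polynomials over the arcs between hubs, or a wheel polynomial if there is no hub. The fan series is
-- 1 + x with x = v (1 + x + t x²) (Motzkin); after v = u / (1 - t u) it satisfies the Narayana equation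
-- x = u (1 + x) (1 + t x), which exchanges x and t x under u ↦ t u, t ↦ 1/t, whence palindromicity.
-- Summing over words gives (1 + x) (1 + t x) for fans, and for wheels an expression in 1/S and x, where
-- S = 1 - (t+1) u - 2 t u x is the square root; the wheel polynomials have the series
-- x (x + t x² + t² x⁴) / ((1 + x) (1 - t x²)) in v.
module Submission where

-- The substitution `v = u / (1 - t u)` records how flats merge blocks: `u` marks the blocks of the
-- lower flat, `v` those of the upper one, and `m` lower blocks fused into one cost `t^(m-1)`,
-- whence `v = u + t u² + t² u³ + ...`. A sum over cyclic words has to open the cycle somewhere. If
-- the upper word has a hub at the opening, the sum is that of a fan. Otherwise an arc with `m`
-- blocks may run across the opening, in `m` positions, and the Euler operator applied to the
-- equation of `x` is what brings in `1 / S`. The wheel series enters as a candidate; its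
-- justification is that it passes the criterion. Two sets of rim edges disturb the description of
-- flats by triangles. The full rim is a block without an end, of corank 1, and has to be counted
-- apart. The rim with one edge missing meets no triangle through the centre in exactly two edges
-- and yet is not closed; there the candidate vanishes because `wheelP 1` is 0.

open import Defs
open import Algebra.Bundles using (CommutativeRing; RawRing)
import Algebra.Properties.Ring as RingProperties
import Algebra.Solver.Ring as RingSolver
open import Algebra.Solver.Ring.AlmostCommutativeRing using (fromCommutativeRing; _-Raw-AlmostCommutative⟶_; -raw-almostCommutative⟶)
open import Data.Bool using (Bool; true; false; _∧_; _∨_; not; if_then_else_)
open import Data.Bool.ListAction using (all; any)
import Data.Bool.Properties as BP
open import Data.Empty using (⊥-elim; ⊥)
open import Data.Fin using (Fin; zero; suc; toℕ; _↑ˡ_; _↑ʳ_; splitAt; fromℕ<)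
import Data.Fin.Properties as FP
open import Data.Integer as ℤ using (ℤ; +_)
import Data.Integer.Properties as ℤP
open import Data.List using (List; []; _∷_; _++_; map; concatMap; allFin; filterᵇ; replicate; upTo; length; tabulate; applyUpTo)
import Data.List.Properties as LP
open import Data.Maybe using (Maybe; just; nothing)
open import Data.Nat as ℕ using (ℕ; zero; suc; _∸_; _≡ᵇ_; _<ᵇ_; _≤_; _<_; z≤n; s≤s)
import Data.Nat.Properties as ℕP
open import Data.Product using (_×_; _,_; Σ; proj₁; proj₂)
open import Data.Sum using (_⊎_; inj₁; inj₂)
open import Data.Unit using (⊤; tt)
open import Function using (_∘_)
open import Level using (0ℓ)
open import Relation.Binary.Definitions using (tri<; tri≈; tri>)
open import Relation.Binary.PropositionalEquality as ≡ using (_≡_; refl; _≢_; _≗_)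
import Relation.Binary.Reasoning.Setoid as SetoidReasoning
open import Relation.Nullary using (yes; no; ¬_; Dec)

-- Power series over a commutative ring

Ring₀ : Set₁
Ring₀ = CommutativeRing 0ℓ 0ℓ

ℤ-rawRing : RawRing 0ℓ 0ℓ
ℤ-rawRing = CommutativeRing.rawRing ℤP.+-*-commutativeRing

ℤ⟶ : Ring₀ → Set
ℤ⟶ K = ℤ-rawRing -Raw-AlmostCommutative⟶ fromCommutativeRing K

module Solver (K : Ring₀) (φ : ℤ⟶ K) where
  open CommutativeRing K using (_≈_; reflexive)
  open _-Raw-AlmostCommutative⟶_ φ using (⟦_⟧)

  ≟-weak : ∀ a b → Maybe (⟦ a ⟧ ≈ ⟦ b ⟧)
  ≟-weak a b with a ℤ.≟ b
  ... | yes a≡b = just (reflexive (≡.cong ⟦_⟧ a≡b))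
  ... | no _ = nothing

  open RingSolver ℤ-rawRing (fromCommutativeRing K) φ ≟-weak public
    using (solve; _:=_; _:+_; _:*_; _:-_; :-_; con; Polynomial)

module PowerSeries (K : Ring₀) (φ : ℤ⟶ K) where
  open CommutativeRing K renaming (refl to ≈-refl; sym to ≈-sym; trans to ≈-trans)
  open RingProperties ring using (-0#≈0#; -‿distribˡ-*; -‿distribʳ-*)
  module φ = _-Raw-AlmostCommutative⟶_ φ
  open Solver K φ
  open SetoidReasoning setoid

  Series : Set
  Series = ℕ → Carrier

  infix 4 _≋_
  -- A record rather than a bare function type, so that `f` and `g` can be recovered from the type
  -- of a proof.
  record _≋_ (f g : Series) : Set where
    constructor eqv
    field at : ∀ n → f n ≈ g n
  open _≋_ public

  const : Carrier → Series
  const c zero = c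
  const c (suc n) = 0#

  mul : Series → Series → Series
  mul f g zero = f 0 * g 0
  mul f g (suc n) = f 0 * g (suc n) + mul (λ i → f (suc i)) g n

  mul-cong : ∀ {f f′ g g′} → (∀ n → f n ≈ f′ n) → (∀ n → g n ≈ g′ n) → ∀ n → mul f g n ≈ mul f′ g′ n
  mul-cong p q zero = *-cong (p 0) (q 0)
  mul-cong p q (suc n) = +-cong (*-cong (p 0) (q (suc n))) (mul-cong (λ i → p (suc i)) q n)

  mul-distribʳ : ∀ h f g n → mul (λ i → f i + g i) h n ≈ mul f h n + mul g h n
  mul-distribʳ h f g zero = distribʳ (h 0) (f 0) (g 0)
  mul-distribʳ h f g (suc n) =
    ≈-trans (+-congˡ (mul-distribʳ h (λ i → f (suc i)) (λ i → g (suc i)) n))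
      (solve 5 (λ a b c d e → (a :+ b) :* c :+ (d :+ e) := (a :* c :+ d) :+ (b :* c :+ e)) ≈-refl
        (f 0) (g 0) (h (suc n)) (mul (λ i → f (suc i)) h n) (mul (λ i → g (suc i)) h n))

  mul-scale : ∀ c f g n → mul (λ i → c * f i) g n ≈ c * mul f g n
  mul-scale c f g zero = *-assoc c (f 0) (g 0)
  mul-scale c f g (suc n) =
    ≈-trans (+-congˡ (mul-scale c (λ i → f (suc i)) g n))
      (solve 4 (λ c a b d → c :* a :* b :+ c :* d := c :* (a :* b :+ d)) ≈-refl
        c (f 0) (g (suc n)) (mul (λ i → f (suc i)) g n))

  mul-last : ∀ f g n → mul f g (suc n) ≈ f (suc n) * g 0 + mul f (λ i → g (suc i)) n
  mul-last f g zero = +-comm _ _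
  mul-last f g (suc n) =
    ≈-trans (+-congˡ (mul-last (λ i → f (suc i)) g n))
      (solve 3 (λ a b c → a :+ (b :+ c) := b :+ (a :+ c)) ≈-refl
        (f 0 * g (suc (suc n))) (f (suc (suc n)) * g 0) (mul (λ i → f (suc i)) (λ i → g (suc i)) n))

  mul-comm : ∀ f g n → mul f g n ≈ mul g f n
  mul-comm f g zero = *-comm _ _
  mul-comm f g (suc n) =
    ≈-trans (+-cong (*-comm _ _) (mul-comm (λ i → f (suc i)) g n)) (≈-sym (mul-last g f n))

  mul-assoc : ∀ f g h n → mul (mul f g) h n ≈ mul f (mul g h) n
  mul-assoc f g h zero = *-assoc _ _ _
  mul-assoc f g h (suc n) = begin
    f 0 * g 0 * h (suc n) + mul (λ i → f 0 * g (suc i) + mul f′ g i) h n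
      ≈⟨ +-congˡ (mul-distribʳ h _ _ n) ⟩
    f 0 * g 0 * h (suc n) + (mul (λ i → f 0 * g (suc i)) h n + mul (mul f′ g) h n)
      ≈⟨ +-congˡ (+-cong (mul-scale (f 0) g′ h n) (mul-assoc f′ g h n)) ⟩
    f 0 * g 0 * h (suc n) + (f 0 * mul g′ h n + mul f′ (mul g h) n)
      ≈⟨ solve 5 (λ a b c d e → a :* b :* c :+ (a :* d :+ e) := a :* (b :* c :+ d) :+ e) ≈-refl
           (f 0) (g 0) (h (suc n)) (mul g′ h n) (mul f′ (mul g h) n) ⟩
    f 0 * (g 0 * h (suc n) + mul g′ h n) + mul f′ (mul g h) n ∎
    where
    f′ g′ : Series
    f′ i = f (suc i)
    g′ i = g (suc i)

  mul-zero : ∀ g n → mul (λ _ → 0#) g n ≈ 0#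
  mul-zero g zero = zeroˡ _
  mul-zero g (suc n) = ≈-trans (+-cong (zeroˡ _) (mul-zero g n)) (+-identityˡ _)

  mul-const : ∀ c g n → mul (const c) g n ≈ c * g n
  mul-const c g zero = ≈-refl
  mul-const c g (suc n) = ≈-trans (+-congˡ (mul-zero g n)) (+-identityʳ _)

  mul-identityˡ : ∀ g n → mul (const 1#) g n ≈ g n
  mul-identityˡ g n = ≈-trans (mul-const 1# g n) (*-identityˡ _)

  series : Ring₀
  series = record
    { Carrier = Series
    ; _≈_ = _≋_
    ; _+_ = λ f g n → f n + g n
    ; _*_ = mul
    ; -_ = λ f n → - f n
    ; 0# = λ _ → 0#
    ; 1# = const 1#
    ; isCommutativeRing = record
      { isRing = record
        { +-isAbelianGroup = record
          { isGroup = record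
            { isMonoid = record
              { isSemigroup = record
                { isMagma = record
                  { isEquivalence = record
                    { refl = eqv λ _ → ≈-refl
                    ; sym = λ p → eqv λ n → ≈-sym (at p n)
                    ; trans = λ p q → eqv λ n → ≈-trans (at p n) (at q n) }
                  ; ∙-cong = λ p q → eqv λ n → +-cong (at p n) (at q n) }
                ; assoc = λ f g h → eqv λ n → +-assoc _ _ _ }
              ; identity = (λ f → eqv λ n → +-identityˡ _) , (λ f → eqv λ n → +-identityʳ _) }
            ; inverse = (λ f → eqv λ n → -‿inverseˡ _) , (λ f → eqv λ n → -‿inverseʳ _)
            ; ⁻¹-cong = λ p → eqv λ n → -‿cong (at p n) }
          ; comm = λ f g → eqv λ n → +-comm _ _ }
        ; *-cong = λ p q → eqv (mul-cong (at p) (at q))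
        ; *-assoc = λ f g h → eqv (mul-assoc f g h)
        ; *-identity = (λ f → eqv (mul-identityˡ f)) , (λ f → eqv λ n → ≈-trans (mul-comm f _ n) (mul-identityˡ f n))
        ; distrib = (λ h f g → eqv λ n → ≈-trans (mul-comm h _ n) (≈-trans (mul-distribʳ h f g n) (+-cong (mul-comm f h n) (mul-comm g h n))))
                  , (λ h f g → eqv (mul-distribʳ h f g))
        }
      ; *-comm = λ f g → eqv (mul-comm f g)
      }
    }

  const-hom : ℤ⟶ series
  const-hom = record
    { ⟦_⟧ = λ c → const φ.⟦ c ⟧
    ; +-homo = λ a b → eqv λ { zero → φ.+-homo a b ; (suc n) → ≈-sym (+-identityˡ _) }
    ; *-homo = λ a b → eqv λ { zero → φ.*-homo a b ; (suc n) → ≈-sym (≈-trans (mul-const _ _ (suc n)) (zeroʳ _)) }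
    ; -‿homo = λ a → eqv λ { zero → φ.-‿homo a ; (suc n) → ≈-sym -0#≈0# }
    ; 0-homo = eqv λ { zero → φ.0-homo ; (suc n) → ≈-refl }
    ; 1-homo = eqv λ { zero → φ.1-homo ; (suc n) → ≈-refl }
    }

  shift : Series → Series
  shift f zero = 0#
  shift f (suc n) = f n

  tail : Series → Series
  tail f n = f (suc n)

  var : Series
  var = shift (const 1#)

  mul-shift : ∀ f g n → mul (shift f) g n ≈ shift (mul f g) n
  mul-shift f g zero = zeroˡ _
  mul-shift f g (suc n) = ≈-trans (+-congʳ (zeroˡ _)) (+-identityˡ _)

  mul-var : ∀ f n → mul var f n ≈ shift f n
  mul-var f zero = mul-shift (const 1#) f 0
  mul-var f (suc n) = ≈-trans (mul-shift (const 1#) f (suc n)) (mul-identityˡ f n)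

  Agree : ℕ → Series → Series → Set
  Agree n f g = ∀ m → m < n → f m ≈ g m

  agree-mul : ∀ {n f f′ g g′} → Agree n f f′ → Agree n g g′ → Agree n (mul f g) (mul f′ g′)
  agree-mul p q zero m<n = *-cong (p 0 m<n) (q 0 m<n)
  agree-mul {suc n} p q (suc m) (s≤s m<n) =
    +-cong (*-cong (p 0 (s≤s z≤n)) (q (suc m) (s≤s m<n)))
           (agree-mul (λ i i<n → p (suc i) (s≤s i<n)) (λ i i<n → q i (ℕP.m<n⇒m<1+n i<n)) m m<n)

  agree-shift : ∀ {n f g} → Agree n f g → Agree (suc n) (shift f) (shift g)
  agree-shift p zero _ = ≈-refl
  agree-shift p (suc m) (s≤s m<n) = p m m<n

  -- Each application fixes one more coefficient, so iteration from any start converges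
  -- coefficientwise; `fix` reads coefficient `n` off the iterate `n + 1`. Recursively defined
  -- series are obtained this way instead of by well-founded recursion.
  Contractive : (Series → Series) → Set
  Contractive Φ = ∀ n f g → Agree n f g → Agree (suc n) (Φ f) (Φ g)

  iterate : (Series → Series) → ℕ → Series
  iterate Φ zero = λ _ → 0#
  iterate Φ (suc k) = Φ (iterate Φ k)

  fix : (Series → Series) → Series
  fix Φ n = iterate Φ (suc n) n

  iterate-stable : ∀ {Φ} → Contractive Φ → ∀ k → Agree k (iterate Φ k) (iterate Φ (suc k))
  iterate-stable c zero m ()
  iterate-stable c (suc k) = c k _ _ (iterate-stable c k)

  fix-iterate : ∀ {Φ} → Contractive Φ → ∀ d m → fix Φ m ≈ iterate Φ (d ℕ.+ suc m) m
  fix-iterate c zero m = ≈-refl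
  fix-iterate c (suc d) m = ≈-trans (fix-iterate c d m) (iterate-stable c (d ℕ.+ suc m) m (ℕP.m≤n+m (suc m) d))

  fix-eq : ∀ {Φ} → Contractive Φ → fix Φ ≋ Φ (fix Φ)
  fix-eq {Φ} c = eqv λ n → ≈-sym (c n (fix Φ) (iterate Φ n) (agree n) n ℕP.≤-refl)
    where
    agree : ∀ n → Agree n (fix Φ) (iterate Φ n)
    agree n m m<n = ≈-trans (fix-iterate c (n ∸ suc m) m)
      (reflexive (≡.cong (λ k → iterate Φ k m) (ℕP.m∸n+n≡m m<n)))

  -- A series with constant term 1 is 1 - u g, and its inverse is the fixed point of h ↦ 1 + u g h.
  invStep : Series → Series → Series
  invStep f h n = const 1# n + shift (mul (λ i → - f (suc i)) h) n

  inv : Series → Series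
  inv f = fix (invStep f)

  inv-fix : ∀ f → inv f ≋ invStep f (inv f)
  inv-fix f = fix-eq λ n g h p m m<n → +-congˡ (agree-shift (agree-mul (λ _ _ → ≈-refl) p) m m<n)

  mul-neg : ∀ f g n → mul (λ i → - f i) g n ≈ - mul f g n
  mul-neg f g zero = ≈-sym (-‿distribˡ-* _ _)
  mul-neg f g (suc n) = ≈-trans (+-cong (≈-sym (-‿distribˡ-* _ _)) (mul-neg (tail f) g n))
    (solve 2 (λ a b → :- a :+ :- b := :- (a :+ b)) ≈-refl _ _)

  mul-inv : ∀ f → f 0 ≈ 1# → mul f (inv f) ≋ const 1#
  mul-inv f f0 = eqv λ
    { zero → ≈-trans (*-cong f0 (at (inv-fix f) 0)) (≈-trans (*-identityˡ _) (+-identityʳ _))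
    ; (suc n) → ≈-trans (+-congʳ (≈-trans (*-congʳ f0) (≈-trans (*-identityˡ _) (≈-trans (at (inv-fix f) (suc n))
                   (≈-trans (+-identityˡ _) (mul-neg (tail f) (inv f) n))))))
                 (-‿inverseˡ _) }

  -- The Euler operator u d/du.
  θ : Series → Series
  θ f zero = 0#
  θ f (suc n) = f (suc n) + θ (tail f) n

  θ-cong : ∀ {f g} → (∀ n → f n ≈ g n) → ∀ n → θ f n ≈ θ g n
  θ-cong p zero = ≈-refl
  θ-cong p (suc n) = +-cong (p (suc n)) (θ-cong (λ i → p (suc i)) n)

  θ-+ : ∀ f g n → θ (λ i → f i + g i) n ≈ θ f n + θ g n
  θ-+ f g zero = ≈-sym (+-identityˡ _)
  θ-+ f g (suc n) = ≈-trans (+-congˡ (θ-+ (tail f) (tail g) n))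
    (solve 4 (λ a b c d → (a :+ b) :+ (c :+ d) := (a :+ c) :+ (b :+ d)) ≈-refl _ _ _ _)

  θ-scale : ∀ c f n → θ (λ i → c * f i) n ≈ c * θ f n
  θ-scale c f zero = ≈-sym (zeroʳ _)
  θ-scale c f (suc n) = ≈-trans (+-congˡ (θ-scale c (tail f) n)) (≈-sym (distribˡ _ _ _))

  θ-mul : ∀ f g n → θ (mul f g) n ≈ mul (θ f) g n + mul f (θ g) n
  θ-mul f g zero = ≈-sym (≈-trans (+-cong (zeroˡ _) (zeroʳ _)) (+-identityˡ _))
  θ-mul f g (suc n) = begin
    (f 0 * g (suc n) + mul f′ g n) + θ (λ i → f 0 * g (suc i) + mul f′ g i) n
      ≈⟨ +-congˡ (≈-trans (θ-+ _ _ n) (+-cong (θ-scale (f 0) (tail g) n) (θ-mul f′ g n))) ⟩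
    (f 0 * g (suc n) + mul f′ g n) + (f 0 * θ (tail g) n + (mul (θ f′) g n + mul f′ (θ g) n))
      ≈⟨ solve 6 (λ a b c d e h → (a :* b :+ c) :+ (a :* d :+ (e :+ h)) := (c :+ e) :+ (a :* (b :+ d) :+ h)) ≈-refl
           (f 0) (g (suc n)) (mul f′ g n) (θ (tail g) n) (mul (θ f′) g n) (mul f′ (θ g) n) ⟩
    (mul f′ g n + mul (θ f′) g n) + (f 0 * (g (suc n) + θ (tail g) n) + mul f′ (θ g) n)
      ≈⟨ +-congʳ (≈-sym (≈-trans (+-congʳ (zeroˡ _)) (≈-trans (+-identityˡ _) (mul-distribʳ g f′ (θ f′) n)))) ⟩
    (0# * g (suc n) + mul (λ i → f′ i + θ f′ i) g n) + (f 0 * (g (suc n) + θ (tail g) n) + mul f′ (θ g) n) ∎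
    where
    f′ : Series
    f′ = tail f

  θ-shift : ∀ f n → θ (shift f) n ≈ shift (λ i → f i + θ f i) n
  θ-shift f zero = ≈-refl
  θ-shift f (suc n) = ≈-refl

  -- Substitution of u / (1 - c u) for the variable.
  module Substitution (c : Carrier) where
    T : Series → Series
    T f zero = f 0
    T f (suc zero) = f 1
    T f (suc (suc n)) = c * T f (suc n) + T (tail f) (suc n)

    T-cong : ∀ {f g} → (∀ n → f n ≈ g n) → ∀ n → T f n ≈ T g n
    T-cong p zero = p 0
    T-cong p (suc zero) = p 1
    T-cong p (suc (suc n)) = +-cong (*-congˡ (T-cong p (suc n))) (T-cong (λ i → p (suc i)) (suc n))

    T-+ : ∀ f g n → T (λ i → f i + g i) n ≈ T f n + T g n
    T-+ f g zero = ≈-refl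
    T-+ f g (suc zero) = ≈-refl
    T-+ f g (suc (suc n)) = ≈-trans (+-cong (*-congˡ (T-+ f g (suc n))) (T-+ (tail f) (tail g) (suc n)))
      (solve 5 (λ c a b d e → c :* (a :+ b) :+ (d :+ e) := (c :* a :+ d) :+ (c :* b :+ e)) ≈-refl c _ _ _ _)

    T-scale : ∀ a f n → T (λ i → a * f i) n ≈ a * T f n
    T-scale a f zero = ≈-refl
    T-scale a f (suc zero) = ≈-refl
    T-scale a f (suc (suc n)) = ≈-trans (+-cong (*-congˡ (T-scale a f (suc n))) (T-scale a (tail f) (suc n)))
      (solve 4 (λ c a b d → c :* (a :* b) :+ a :* d := a :* (c :* b :+ d)) ≈-refl c a _ _)

    T-zero : ∀ n → T (λ _ → 0#) n ≈ 0#
    T-zero zero = ≈-refl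
    T-zero (suc zero) = ≈-refl
    T-zero (suc (suc n)) = ≈-trans (+-cong (≈-trans (*-congˡ (T-zero (suc n))) (zeroʳ c)) (T-zero (suc n))) (+-identityˡ _)

    T-const : ∀ a n → T (const a) n ≈ const a n
    T-const a zero = ≈-refl
    T-const a (suc zero) = ≈-refl
    T-const a (suc (suc n)) = ≈-trans (+-cong (≈-trans (*-congˡ (T-const a (suc n))) (zeroʳ c)) (T-zero (suc n))) (+-identityˡ _)

    -- (1 - c u) (T f - f₀) = u T (tail f)
    T-tail : ∀ f n → T f (suc n) ≈ T (tail f) n + c * shift (tail (T f)) n
    T-tail f zero = ≈-sym (≈-trans (+-congˡ (zeroʳ c)) (+-identityʳ _))
    T-tail f (suc n) = +-comm _ _

    T-mul : ∀ f g n → T (mul f g) n ≈ mul (T f) (T g) n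
    T-mul f g zero = ≈-refl
    T-mul f g (suc zero) = ≈-refl
    T-mul f g (suc (suc n)) = begin
      c * T (mul f g) (suc n) + T (λ i → f 0 * g (suc i) + mul f′ g i) (suc n)
        ≈⟨ +-cong (*-congˡ (T-mul f g (suc n)))
                  (≈-trans (T-+ _ _ (suc n)) (+-cong (T-scale (f 0) (tail g) (suc n)) (T-mul f′ g (suc n)))) ⟩
      c * (f 0 * T g (suc n) + mul (tail (T f)) (T g) n) + (f 0 * T (tail g) (suc n) + mul (T f′) (T g) (suc n))
        ≈⟨ solve 6 (λ c a b d e h → c :* (a :* b :+ d) :+ (a :* e :+ h) := a :* (c :* b :+ e) :+ (h :+ c :* d)) ≈-refl
             c (f 0) (T g (suc n)) (mul (tail (T f)) (T g) n) (T (tail g) (suc n)) (mul (T f′) (T g) (suc n)) ⟩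
      f 0 * (c * T g (suc n) + T (tail g) (suc n)) + (mul (T f′) (T g) (suc n) + c * mul (tail (T f)) (T g) n)
        ≈⟨ +-congˡ (≈-sym tail-mul) ⟩
      f 0 * T g (suc (suc n)) + mul (tail (T f)) (T g) (suc n) ∎
      where
      f′ : Series
      f′ = tail f
      tail-mul : mul (tail (T f)) (T g) (suc n) ≈ mul (T f′) (T g) (suc n) + c * mul (tail (T f)) (T g) n
      tail-mul = begin
        mul (tail (T f)) (T g) (suc n)
          ≈⟨ mul-cong (T-tail f) (λ _ → ≈-refl) (suc n) ⟩
        mul (λ i → T f′ i + c * shift (tail (T f)) i) (T g) (suc n)
          ≈⟨ mul-distribʳ (T g) (T f′) (λ i → c * shift (tail (T f)) i) (suc n) ⟩
        mul (T f′) (T g) (suc n) + mul (λ i → c * shift (tail (T f)) i) (T g) (suc n)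
          ≈⟨ +-congˡ (≈-trans (mul-scale c (shift (tail (T f))) (T g) (suc n)) (*-congˡ (mul-shift (tail (T f)) (T g) (suc n)))) ⟩
        mul (T f′) (T g) (suc n) + c * mul (tail (T f)) (T g) n ∎

-- Algebra of the Narayana equation

module Narayana (K : Ring₀) (φ : ℤ⟶ K) where
  open CommutativeRing K renaming (refl to ≈-refl)
  open _-Raw-AlmostCommutative⟶_ φ using (⟦_⟧)
  open Solver K φ
  open SetoidReasoning setoid

  from-motzkin : ∀ t u m → m ≈ ⟦ + 1 ⟧ + u * (m + t * (u * (m * m))) →
    u * m ≈ u * (⟦ + 1 ⟧ + u * m + t * (u * m) * (u * m))
  from-motzkin t u m m-eq = begin
    u * m ≈⟨ *-congˡ m-eq ⟩
    u * (⟦ + 1 ⟧ + u * (m + t * (u * (m * m))))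
      ≈⟨ solve 3 (λ t u m → u :* (con (+ 1) :+ u :* (m :+ t :* (u :* (m :* m))))
           := u :* (con (+ 1) :+ (u :* m) :+ t :* (u :* m) :* (u :* m))) ≈-refl t u m ⟩
    u * (⟦ + 1 ⟧ + u * m + t * (u * m) * (u * m)) ∎

  subst-tail : ∀ t u f n g → f ≈ u * n → n ≈ g + t * (u * n) → f * (⟦ + 1 ⟧ - t * u) ≈ u * g
  subst-tail t u f n g f-eq n-eq = begin
    f * (⟦ + 1 ⟧ - t * u) ≈⟨ *-congʳ f-eq ⟩
    u * n * (⟦ + 1 ⟧ - t * u) ≈⟨ solve 3 (λ t u n → u :* n :* (con (+ 1) :- t :* u) := u :* (n :- t :* (u :* n))) ≈-refl t u n ⟩
    u * (n - t * (u * n)) ≈⟨ *-congˡ (+-congʳ n-eq) ⟩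
    u * (g + t * (u * n) - t * (u * n)) ≈⟨ solve 3 (λ u a b → u :* (a :+ b :- b) := u :* a) ≈-refl u g (t * (u * n)) ⟩
    u * g ∎

  inverse-unique : ∀ a b c → a * b ≈ ⟦ + 1 ⟧ → a * c ≈ ⟦ + 1 ⟧ → b ≈ c
  inverse-unique a b c ab ac = begin
    b ≈⟨ solve 1 (λ b → b := con (+ 1) :* b) ≈-refl b ⟩
    ⟦ + 1 ⟧ * b ≈⟨ *-congʳ ac ⟨
    a * c * b ≈⟨ solve 3 (λ a b c → a :* c :* b := a :* b :* c) ≈-refl a b c ⟩
    a * b * c ≈⟨ *-congʳ ab ⟩
    ⟦ + 1 ⟧ * c ≈⟨ solve 1 (λ c → con (+ 1) :* c := c) ≈-refl c ⟩
    c ∎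

  module Relations (t u X I J Vi : Carrier)
    (X-eq : X * (⟦ + 1 ⟧ - t * u) ≈ u * (⟦ + 1 ⟧ + X + t * X * X))
    (I-eq : (⟦ + 1 ⟧ + X) * I ≈ ⟦ + 1 ⟧)
    (J-eq : (⟦ + 1 ⟧ + t * X) * J ≈ ⟦ + 1 ⟧)
    (Vi-eq : (⟦ + 1 ⟧ - t * X * X) * Vi ≈ ⟦ + 1 ⟧)
    where

    -- By `AX`, `X` is a root of `t u X² - A X + u`, whose discriminant is `S²`. `Num / Den` is
    -- minus the fraction of the theorem with a common factor 2 removed: the stated denominator has
    -- constant term 2, whereas `Den` has constant term 1 and is invertible over the integers. `PW`
    -- is the wheel series after the substitution.
    one A S Den Num PW Er : Carrier
    one = ⟦ + 1 ⟧
    A = one - (t + one) * u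
    S = A - ⟦ + 2 ⟧ * t * u * X
    Den = A - t * u * u - t * u * X
    Num = A * (u + t * u + t * u * u)
    PW = X * (X + t * X * X + t * t * X * X * X * X) * I * Vi
    Er = X * (one + t * X * X) * I

    X-narayana : X ≈ u * ((one + X) * (one + t * X))
    X-narayana = begin
      X ≈⟨ solve 3 (λ t u X → X := X :* (con (+ 1) :- t :* u) :+ t :* u :* X) ≈-refl t u X ⟩
      X * (one - t * u) + t * u * X ≈⟨ +-congʳ X-eq ⟩
      u * (one + X + t * X * X) + t * u * X
        ≈⟨ solve 3 (λ t u X → u :* (con (+ 1) :+ X :+ t :* X :* X) :+ t :* u :* X
                    := u :* ((con (+ 1) :+ X) :* (con (+ 1) :+ t :* X))) ≈-refl t u X ⟩
      u * ((one + X) * (one + t * X)) ∎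

    AX : A * X ≈ u + t * u * X * X
    AX = begin
      A * X ≈⟨ solve 3 (λ t u X → (con (+ 1) :- (t :+ con (+ 1)) :* u) :* X := X :* (con (+ 1) :- t :* u) :- u :* X) ≈-refl t u X ⟩
      X * (one - t * u) - u * X ≈⟨ +-congʳ X-eq ⟩
      u * (one + X + t * X * X) - u * X
        ≈⟨ solve 3 (λ t u X → u :* (con (+ 1) :+ X :+ t :* X :* X) :- u :* X := u :+ t :* u :* X :* X) ≈-refl t u X ⟩
      u + t * u * X * X ∎

    S² : S * S ≈ A * A - ⟦ + 4 ⟧ * t * u * u
    S² = begin
      S * S ≈⟨ solve 4 (λ t u X A → (A :- con (+ 2) :* t :* u :* X) :* (A :- con (+ 2) :* t :* u :* X)
                  := A :* A :- con (+ 4) :* t :* u :* (A :* X) :+ con (+ 4) :* t :* u :* t :* u :* X :* X) ≈-refl t u X A ⟩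
      A * A - ⟦ + 4 ⟧ * t * u * (A * X) + ⟦ + 4 ⟧ * t * u * t * u * X * X
        ≈⟨ +-congʳ (+-congˡ (-‿cong (*-congˡ AX))) ⟩
      A * A - ⟦ + 4 ⟧ * t * u * (u + t * u * X * X) + ⟦ + 4 ⟧ * t * u * t * u * X * X
        ≈⟨ solve 4 (λ t u X A → A :* A :- con (+ 4) :* t :* u :* (u :+ t :* u :* X :* X) :+ con (+ 4) :* t :* u :* t :* u :* X :* X
                  := A :* A :- con (+ 4) :* t :* u :* u) ≈-refl t u X A ⟩
      A * A - ⟦ + 4 ⟧ * t * u * u ∎

    w : Carrier
    w = (one + X) * (one + t * X)

    S-w : S * w ≈ one - t * X * X
    S-w = begin
      S * w
        ≈⟨ solve 4 (λ t u X w → (con (+ 1) :- (t :+ con (+ 1)) :* u :- con (+ 2) :* t :* u :* X) :* w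
                    := w :- (t :+ con (+ 1) :+ con (+ 2) :* t :* X) :* (u :* w)) ≈-refl t u X w ⟩
      w - (t + one + ⟦ + 2 ⟧ * t * X) * (u * w)
        ≈⟨ +-congˡ (-‿cong (*-congˡ (sym X-narayana))) ⟩
      w - (t + one + ⟦ + 2 ⟧ * t * X) * X
        ≈⟨ solve 2 (λ t X → (con (+ 1) :+ X) :* (con (+ 1) :+ t :* X) :- (t :+ con (+ 1) :+ con (+ 2) :* t :* X) :* X
                    := con (+ 1) :- t :* X :* X) ≈-refl t X ⟩
      one - t * X * X ∎

    1* : ∀ a → one * a ≈ a
    1* a = solve 1 (λ a → con (+ 1) :* a := a) ≈-refl a

    quotient : ∀ M → Den * M ≈ one →
      - (Num * M) * (A - ⟦ + 2 ⟧ * t * u * u + S) ≈ ⟦ ℤ.- + 2 ⟧ * u * A * (t * (u + one) + one)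
    quotient M M-eq = begin
      - (Num * M) * (A - ⟦ + 2 ⟧ * t * u * u + S)
        ≈⟨ solve 5 (λ t u X A M → let o = con (+ 1) in
             :- (A :* (u :+ t :* u :+ t :* u :* u) :* M) :* (A :- con (+ 2) :* t :* u :* u :+ (A :- con (+ 2) :* t :* u :* X))
             := con (ℤ.- + 2) :* u :* A :* (t :* (u :+ o) :+ o) :* ((A :- t :* u :* u :- t :* u :* X) :* M)) ≈-refl t u X A M ⟩
      ⟦ ℤ.- + 2 ⟧ * u * A * (t * (u + one) + one) * (Den * M) ≈⟨ *-congˡ M-eq ⟩
      ⟦ ℤ.- + 2 ⟧ * u * A * (t * (u + one) + one) * one
        ≈⟨ solve 1 (λ a → a :* con (+ 1) := a) ≈-refl (⟦ ℤ.- + 2 ⟧ * u * A * (t * (u + one) + one)) ⟩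
      ⟦ ℤ.- + 2 ⟧ * u * A * (t * (u + one) + one) ∎

    -- The Narayana equation, written in `I = 1 / (1 + X)` and `J = 1 / (1 + t X)`, is a rational
    -- parametrization: `u`, `t u` and `t u X` become polynomials in `I` and `J`. Identities between
    -- them can then be left to the solver, with no side relation to apply.
    uJ : u ≈ (one - I) * J
    uJ = begin
      u ≈⟨ solve 1 (λ u → u := u :* con (+ 1) :* con (+ 1)) ≈-refl u ⟩
      u * one * one ≈⟨ *-cong (*-congˡ I-eq) J-eq ⟨
      u * ((one + X) * I) * ((one + t * X) * J)
        ≈⟨ solve 5 (λ t u X I J → u :* ((con (+ 1) :+ X) :* I) :* ((con (+ 1) :+ t :* X) :* J)
             := (u :* ((con (+ 1) :+ X) :* (con (+ 1) :+ t :* X))) :* I :* J) ≈-refl t u X I J ⟩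
      (u * w) * I * J ≈⟨ *-congʳ (*-congʳ X-narayana) ⟨
      X * I * J ≈⟨ *-congʳ (solve 2 (λ X I → X :* I := (con (+ 1) :+ X) :* I :- I) ≈-refl X I) ⟩
      ((one + X) * I - I) * J ≈⟨ *-congʳ (+-congʳ I-eq) ⟩
      (one - I) * J ∎

    tX : t * X * J ≈ one - J
    tX = trans (solve 3 (λ t X J → t :* X :* J := (con (+ 1) :+ t :* X) :* J :- J) ≈-refl t X J) (+-congʳ J-eq)

    XI : X * I ≈ one - I
    XI = trans (solve 2 (λ X I → X :* I := (con (+ 1) :+ X) :* I :- I) ≈-refl X I) (+-congʳ I-eq)

    tuI : t * u ≈ (one - J) * I
    tuI = begin
      t * u ≈⟨ *-congˡ uJ ⟩
      t * ((one - I) * J) ≈⟨ *-congˡ (*-congʳ XI) ⟨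
      t * (X * I * J) ≈⟨ solve 4 (λ t X I J → t :* (X :* I :* J) := t :* X :* J :* I) ≈-refl t X I J ⟩
      t * X * J * I ≈⟨ *-congʳ tX ⟩
      (one - J) * I ∎

    tuX : t * u * X ≈ (one - J) * (one - I)
    tuX = begin
      t * u * X ≈⟨ *-congʳ tuI ⟩
      (one - J) * I * X ≈⟨ solve 3 (λ X I J → (con (+ 1) :- J) :* I :* X := (con (+ 1) :- J) :* (X :* I)) ≈-refl X I J ⟩
      (one - J) * (X * I) ≈⟨ *-congˡ XI ⟩
      (one - J) * (one - I) ∎

    EIJ : Er * (I * J) ≈ (one - I) * (I * J + (one - I) * (one - J))
    EIJ = begin
      Er * (I * J)
        ≈⟨ solve 4 (λ t X I J → X :* (con (+ 1) :+ t :* X :* X) :* I :* (I :* J)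
             := X :* I :* (I :* J :+ X :* I :* (t :* X :* J))) ≈-refl t X I J ⟩
      X * I * (I * J + X * I * (t * X * J)) ≈⟨ *-cong XI (+-congˡ (*-cong XI tX)) ⟩
      (one - I) * (I * J + (one - I) * (one - J)) ∎

    A-IJ : A ≈ one - (one - I) * J - (one - J) * I
    A-IJ = begin
      A ≈⟨ solve 2 (λ t u → con (+ 1) :- (t :+ con (+ 1)) :* u := con (+ 1) :- u :- t :* u) ≈-refl t u ⟩
      one - u - t * u ≈⟨ +-cong (+-congˡ (-‿cong uJ)) (-‿cong tuI) ⟩
      one - (one - I) * J - (one - J) * I ∎

    tuu : t * u * u ≈ (one - J) * I * ((one - I) * J)
    tuu = *-cong tuI uJ

    Den-IJ : Den ≈ I * J * (I + J - I * J)
    Den-IJ = begin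
      Den ≈⟨ +-cong (+-cong A-IJ (-‿cong tuu)) (-‿cong tuX) ⟩
      one - (one - I) * J - (one - J) * I - (one - J) * I * ((one - I) * J) - (one - J) * (one - I)
        ≈⟨ solve 2 (λ I J → con (+ 1) :- (con (+ 1) :- I) :* J :- (con (+ 1) :- J) :* I
               :- (con (+ 1) :- J) :* I :* ((con (+ 1) :- I) :* J) :- (con (+ 1) :- J) :* (con (+ 1) :- I)
             := I :* J :* (I :+ J :- I :* J)) ≈-refl I J ⟩
      I * J * (I + J - I * J) ∎

    -- Both sides turn into polynomials in the free variables `I` and `J`; `a` and `b` stand for `u`
    -- and `t u`. The factor `I J` of `Den` is what clears the square of `X` in `Er`.
    Er-Den : (Er + t * u - (t + one) * t * u * u) * Den ≈ (one - t * u) * Num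
    Er-Den = begin
      (Er + t * u - (t + one) * t * u * u) * Den ≈⟨ *-congˡ Den-IJ ⟩
      (Er + t * u - (t + one) * t * u * u) * (I * J * (I + J - I * J))
        ≈⟨ solve 5 (λ t u I J Er → (Er :+ t :* u :- (t :+ con (+ 1)) :* t :* u :* u) :* (I :* J :* (I :+ J :- I :* J))
             := (Er :* (I :* J) :+ (t :* u :- t :* u :* (t :* u) :- t :* u :* u) :* (I :* J)) :* (I :+ J :- I :* J)) ≈-refl t u I J Er ⟩
      (Er * (I * J) + (t * u - t * u * (t * u) - t * u * u) * (I * J)) * (I + J - I * J)
        ≈⟨ *-congʳ (+-cong EIJ (*-congʳ (+-cong (+-cong tuI (-‿cong (*-cong tuI tuI))) (-‿cong tuu)))) ⟩
      ((one - I) * (I * J + (one - I) * (one - J)) + (b - b * b - b * a) * (I * J)) * (I + J - I * J)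
        ≈⟨ solve 2 (λ I J → let a = (con (+ 1) :- I) :* J; b = (con (+ 1) :- J) :* I; o = con (+ 1) in
             ((o :- I) :* (I :* J :+ (o :- I) :* (o :- J)) :+ (b :- b :* b :- b :* a) :* (I :* J)) :* (I :+ J :- I :* J)
             := (o :- b) :* ((o :- a :- b) :* (a :+ b :+ b :* a))) ≈-refl I J ⟩
      (one - b) * ((one - a - b) * (a + b + b * a))
        ≈⟨ *-cong (+-congˡ (-‿cong tuI)) (*-cong A-IJ (+-cong (+-cong uJ tuI) tuu)) ⟨
      (one - t * u) * Num ∎
      where
      a b : Carrier
      a = (one - I) * J
      b = (one - J) * I

    -- Separates the two sources of the answer: the first term leads to `1 / S` through `whirl`, and
    -- `Er` to the fraction through `Er-D`.
    whirl-Er : X * (one + X + t * X * X) * I * Vi - Er ≈ PW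
    whirl-Er = begin
      X * (one + X + t * X * X) * I * Vi - Er
        ≈⟨ +-congˡ (-‿cong (trans (sym (1* Er)) (*-congʳ (sym Vi-eq)))) ⟩
      X * (one + X + t * X * X) * I * Vi - (one - t * X * X) * Vi * Er
        ≈⟨ solve 4 (λ t X I Vi → let o = con (+ 1) in
             X :* (o :+ X :+ t :* X :* X) :* I :* Vi :- (o :- t :* X :* X) :* Vi :* (X :* (o :+ t :* X :* X) :* I)
             := X :* (X :+ t :* X :* X :+ t :* t :* X :* X :* X :* X) :* I :* Vi) ≈-refl t X I Vi ⟩
      PW ∎

    module _ (R : Carrier) (R-eq : S * R ≈ one) where

      R-w : R ≈ w * Vi
      R-w = begin
        R ≈⟨ 1* R ⟨
        one * R ≈⟨ *-congʳ (trans (*-congʳ S-w) Vi-eq) ⟨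
        S * w * Vi * R ≈⟨ solve 4 (λ S w Vi R → S :* w :* Vi :* R := S :* R :* (w :* Vi)) ≈-refl S w Vi R ⟩
        S * R * (w * Vi) ≈⟨ *-congʳ R-eq ⟩
        one * (w * Vi) ≈⟨ 1* _ ⟩
        w * Vi ∎

      whirl : (one - t * u) * (R - one - t * X - (one + t * X) * t * u * X * R) ≈ X * (one + X + t * X * X) * I * Vi
      whirl = begin
        (one - t * u) * (R - one - t * X - (one + t * X) * t * u * X * R)
          ≈⟨ *-congˡ (+-cong (+-congʳ (+-congʳ R-w)) (-‿cong (*-congˡ R-w))) ⟩
        (one - t * u) * (w * Vi - one - t * X - (one + t * X) * t * u * X * (w * Vi))
          ≈⟨ *-congˡ (+-cong (+-cong (+-congˡ (-‿cong (sym Vi-eq)))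
                (-‿cong (trans (sym (solve 2 (λ t X → con (+ 1) :* (t :* X) := t :* X) ≈-refl t X)) (*-congʳ (sym Vi-eq)))))
                (-‿cong (solve 5 (λ t u X w Vi → (con (+ 1) :+ t :* X) :* t :* u :* X :* (w :* Vi)
                   := (con (+ 1) :+ t :* X) :* t :* X :* (u :* w) :* Vi) ≈-refl t u X w Vi))) ⟩
        (one - t * u) * (w * Vi - (one - t * X * X) * Vi - (one - t * X * X) * Vi * (t * X) - (one + t * X) * t * X * (u * w) * Vi)
          ≈⟨ *-congˡ (+-congˡ (-‿cong (*-congʳ (*-congˡ (sym X-narayana))))) ⟩
        (one - t * u) * (w * Vi - (one - t * X * X) * Vi - (one - t * X * X) * Vi * (t * X) - (one + t * X) * t * X * X * Vi)
          ≈⟨ solve 4 (λ t u X Vi → let o = con (+ 1) in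
               (o :- t :* u) :* ((o :+ X) :* (o :+ t :* X) :* Vi :- (o :- t :* X :* X) :* Vi
                  :- (o :- t :* X :* X) :* Vi :* (t :* X) :- (o :+ t :* X) :* t :* X :* X :* Vi)
               := (X :* (o :- t :* u)) :* (o :+ t :* X) :* Vi) ≈-refl t u X Vi ⟩
        X * (one - t * u) * (one + t * X) * Vi
          ≈⟨ *-congʳ (*-congʳ X-eq) ⟩
        u * (one + X + t * X * X) * (one + t * X) * Vi
          ≈⟨ *-congʳ (solve 3 (λ t u X → u :* (con (+ 1) :+ X :+ t :* X :* X) :* (con (+ 1) :+ t :* X)
                 := u :* (con (+ 1) :+ X :+ t :* X :* X) :* (con (+ 1) :+ t :* X) :* con (+ 1)) ≈-refl t u X) ⟩
        u * (one + X + t * X * X) * (one + t * X) * one * Vi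
          ≈⟨ *-congʳ (*-congˡ I-eq) ⟨
        u * (one + X + t * X * X) * (one + t * X) * ((one + X) * I) * Vi
          ≈⟨ solve 5 (λ t u X I Vi → u :* (con (+ 1) :+ X :+ t :* X :* X) :* (con (+ 1) :+ t :* X) :* ((con (+ 1) :+ X) :* I) :* Vi
               := (u :* ((con (+ 1) :+ X) :* (con (+ 1) :+ t :* X))) :* (con (+ 1) :+ X :+ t :* X :* X) :* I :* Vi) ≈-refl t u X I Vi ⟩
        (u * w) * (one + X + t * X * X) * I * Vi ≈⟨ *-congʳ (*-congʳ (*-congʳ X-narayana)) ⟨
        X * (one + X + t * X * X) * I * Vi ∎

      module _ (D M : Carrier) (M-eq : Den * M ≈ one) (D-eq : D ≈ Num * M) where

        Er-D : Er + t * u - (t + one) * t * u * u ≈ (one - t * u) * D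
        Er-D = begin
          Er′ ≈⟨ 1* Er′ ⟨
          one * Er′ ≈⟨ *-congʳ M-eq ⟨
          Den * M * Er′ ≈⟨ solve 3 (λ D M Er → D :* M :* Er := Er :* D :* M) ≈-refl Den M Er′ ⟩
          Er′ * Den * M ≈⟨ *-congʳ Er-Den ⟩
          (one - t * u) * Num * M ≈⟨ *-assoc _ _ _ ⟩
          (one - t * u) * (Num * M) ≈⟨ *-congˡ D-eq ⟨
          (one - t * u) * D ∎
          where
          Er′ : Carrier
          Er′ = Er + t * u - (t + one) * t * u * u

        -- Divided by `1 - t u`, the left side is what the hub-free flats contribute. The terms in
        -- `X` on the right are minus the contribution of the flats with a hub, up to its constant
        -- term, and cancel in `total`.
        wheel-eq : PW + t * u * u ≈ (one - t * u) * (R - D - one + t * u - t * X - (one + t * X) * t * u * X * R)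
        wheel-eq = begin
          PW + t * u * u ≈⟨ +-congʳ (sym whirl-Er) ⟩
          X * (one + X + t * X * X) * I * Vi - Er + t * u * u ≈⟨ +-congʳ (+-congʳ whirl) ⟨
          Y - Er + t * u * u
            ≈⟨ solve 4 (λ t u Y Er → Y :- Er :+ t :* u :* u := Y :- (Er :+ t :* u :- (t :+ con (+ 1)) :* t :* u :* u)
                   :+ t :* u :* (con (+ 1) :- t :* u)) ≈-refl t u Y Er ⟩
          Y - (Er + t * u - (t + one) * t * u * u) + t * u * (one - t * u) ≈⟨ +-congʳ (+-congˡ (-‿cong Er-D)) ⟩
          Y - (one - t * u) * D + t * u * (one - t * u)
            ≈⟨ solve 5 (λ t u X R D → let o = con (+ 1) in
                 (o :- t :* u) :* (R :- o :- t :* X :- (o :+ t :* X) :* t :* u :* X :* R) :- (o :- t :* u) :* D :+ t :* u :* (o :- t :* u)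
                 := (o :- t :* u) :* (R :- D :- o :+ t :* u :- t :* X :- (o :+ t :* X) :* t :* u :* X :* R)) ≈-refl t u X R D ⟩
          (one - t * u) * (R - D - one + t * u - t * X - (one + t * X) * t * u * X * R) ∎
          where
          Y : Carrier
          Y = (one - t * u) * (R - one - t * X - (one + t * X) * t * u * X * R)

-- Functional equations of the word sums

module ScanAlgebra (K : Ring₀) (φ : ℤ⟶ K) where
  open CommutativeRing K renaming (refl to ≈-refl)
  open _-Raw-AlmostCommutative⟶_ φ using (⟦_⟧)
  open Solver K φ
  open SetoidReasoning setoid

  one : Carrier
  one = ⟦ + 1 ⟧

  divide : ∀ t u G a b → (one - t * u) * G ≈ one → a * (one - t * u) ≈ b → a ≈ G * b
  divide t u G a b G-eq ab = begin
    a ≈⟨ solve 1 (λ a → a := a :* con (+ 1)) ≈-refl a ⟩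
    a * one ≈⟨ *-congˡ G-eq ⟨
    a * ((one - t * u) * G) ≈⟨ solve 4 (λ a t u G → a :* ((con (+ 1) :- t :* u) :* G) := G :* (a :* (con (+ 1) :- t :* u))) ≈-refl a t u G ⟩
    G * (a * (one - t * u)) ≈⟨ *-congˡ ab ⟩
    G * b ∎

  unfold : ∀ t u a b → a * (one - t * u) ≈ b → a ≈ b + u * (t * a)
  unfold t u a b e = trans (solve 3 (λ a t u → a := a :* (con (+ 1) :- t :* u) :+ u :* (t :* a)) ≈-refl a t u) (+-congʳ e)

  fan-mid : ∀ t u h X c X′ → X * (one - t * u) ≈ u * (c + X′) → h * X ≈ u * (c * h + h * X′ + t * (h * X))
  fan-mid t u h X c X′ e = begin
    h * X ≈⟨ *-congˡ (unfold t u X _ e) ⟩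
    h * (u * (c + X′) + u * (t * X))
      ≈⟨ solve 6 (λ t u h X c X′ → h :* (u :* (c :+ X′) :+ u :* (t :* X)) := u :* (c :* h :+ h :* X′ :+ t :* (h :* X))) ≈-refl t u h X c X′ ⟩
    u * (c * h + h * X′ + t * (h * X)) ∎

  fan-hub : ∀ t u X → X ≈ u * ((one + X) * (one + t * X)) →
    one + t * X ≈ one + u * (t * ((one + t * X) + (one + t * X) * X))
  fan-hub t u X e = +-congˡ (trans (*-congˡ e)
    (solve 3 (λ t u X → t :* (u :* ((con (+ 1) :+ X) :* (con (+ 1) :+ t :* X)))
      := u :* (t :* ((con (+ 1) :+ t :* X) :+ (con (+ 1) :+ t :* X) :* X))) ≈-refl t u X))

  arc-end : ∀ t u G f c f′ → (one - t * u) * G ≈ one → (f - c) * (one - t * u) ≈ u * f′ →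
    G * f ≈ c + u * (G * f′ + t * (G * f))
  arc-end t u G f c f′ G-eq e = trans (unfold t u (G * f) (c + u * (G * f′)) lem)
    (solve 4 (λ c u a b → c :+ u :* a :+ u :* b := c :+ u :* (a :+ b)) ≈-refl c u (G * f′) (t * (G * f)))
    where
    lem : G * f * (one - t * u) ≈ c + u * (G * f′)
    lem = begin
      G * f * (one - t * u) ≈⟨ solve 4 (λ t u G f → G :* f :* (con (+ 1) :- t :* u) := (con (+ 1) :- t :* u) :* G :* f) ≈-refl t u G f ⟩
      (one - t * u) * G * f ≈⟨ *-congʳ G-eq ⟩
      one * f ≈⟨ solve 2 (λ f c → con (+ 1) :* f := c :+ (f :- c)) ≈-refl f c ⟩
      c + (f - c) ≈⟨ +-congˡ (divide t u G (f - c) _ G-eq e) ⟩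
      c + G * (u * f′) ≈⟨ solve 4 (λ c G u f → c :+ G :* (u :* f) := c :+ u :* (G :* f)) ≈-refl c G u f′ ⟩
      c + u * (G * f′) ∎

  wrap-hub : ∀ t u X Y → X ≈ u * ((one + X) * (one + t * X)) → let h = (one + t * X) * (t * u * Y) in
    h ≈ u * (t * (h + (h * X + Y)))
  wrap-hub t u X Y e = begin
    (one + t * X) * (t * u * Y)
      ≈⟨ *-congʳ (+-congˡ (*-congˡ e)) ⟩
    (one + t * (u * ((one + X) * (one + t * X)))) * (t * u * Y)
      ≈⟨ solve 4 (λ t u X Y → let o = con (+ 1); h = (o :+ t :* X) :* (t :* u :* Y) in
           (o :+ t :* (u :* ((o :+ X) :* (o :+ t :* X)))) :* (t :* u :* Y) := u :* (t :* (h :+ (h :* X :+ Y)))) ≈-refl t u X Y ⟩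
    _ ∎

  wrap-mid : ∀ t u h X c X′ Y d Y′ → X * (one - t * u) ≈ u * (c + X′) → Y ≈ d + u * (Y′ + t * Y) →
    h * X + Y ≈ d + u * (c * h + (h * X′ + Y′) + t * (h * X + Y))
  wrap-mid t u h X c X′ Y d Y′ eX eY = begin
    h * X + Y ≈⟨ +-cong (fan-mid t u h X c X′ eX) eY ⟩
    u * (c * h + h * X′ + t * (h * X)) + (d + u * (Y′ + t * Y))
      ≈⟨ solve 8 (λ t u a b e Y d Y′ → u :* (a :+ b :+ t :* e) :+ (d :+ u :* (Y′ :+ t :* Y))
           := d :+ u :* (a :+ (b :+ Y′) :+ t :* (e :+ Y))) ≈-refl t u (c * h) (h * X′) (h * X) Y d Y′ ⟩
    d + u * (c * h + (h * X′ + Y′) + t * (h * X + Y)) ∎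

  start-mid : ∀ t u a g c g′ W F W′ G → (one - t * u) * G ≈ one → g ≈ c + u * (g′ + t * g) →
    W * (one - t * u) ≈ u * (F + W′) →
    g + a * (t * u * (G * W)) ≈ c + u * (a * (t * u * (G * F)) + (g′ + a * (t * u * (G * W′))) + t * (g + a * (t * u * (G * W))))
  start-mid t u a g c g′ W F W′ G G-eq eg eW = begin
    g + a * (t * u * (G * W)) ≈⟨ +-cong eg (*-congˡ (*-congˡ (*-congˡ (unfold t u W _ eW)))) ⟩
    c + u * (g′ + t * g) + a * (t * u * (G * (u * (F + W′) + u * (t * W))))
      ≈⟨ solve 10 (λ t u a g c g′ W F W′ G → c :+ u :* (g′ :+ t :* g) :+ a :* (t :* u :* (G :* (u :* (F :+ W′) :+ u :* (t :* W))))
          := c :+ u :* (a :* (t :* u :* (G :* F)) :+ (g′ :+ a :* (t :* u :* (G :* W′))) :+ t :* (g :+ a :* (t :* u :* (G :* W)))))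
         ≈-refl t u a g c g′ W F W′ G ⟩
    _ ∎

  -- The last hypothesis is the differentiated equation of `X`. It is linear in `W` with coefficient
  -- `S`, so solving it introduces the reciprocal of the square root.
  euler : ∀ t u X W G S R → (one - t * u) * G ≈ one → S ≈ one - (t + one) * u - ⟦ + 2 ⟧ * t * u * X → S * R ≈ one →
    W * (one - t * u) ≈ X * (one - t * u) + u * (W + (t * W * X + t * X * W)) → G * W ≈ X * R
  euler t u X W G S R G-eq S-eq R-eq e = begin
    G * W ≈⟨ solve 2 (λ G W → G :* W := G :* W :* con (+ 1)) ≈-refl G W ⟩
    G * W * one ≈⟨ *-congˡ R-eq ⟨
    G * W * (S * R) ≈⟨ solve 4 (λ G W S R → G :* W :* (S :* R) := G :* (W :* S) :* R) ≈-refl G W S R ⟩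
    G * (W * S) * R ≈⟨ *-congʳ (*-congˡ WS) ⟩
    G * (X * (one - t * u)) * R ≈⟨ solve 5 (λ t u X G R → G :* (X :* (con (+ 1) :- t :* u)) :* R := (con (+ 1) :- t :* u) :* G :* (X :* R)) ≈-refl t u X G R ⟩
    (one - t * u) * G * (X * R) ≈⟨ *-congʳ G-eq ⟩
    one * (X * R) ≈⟨ solve 1 (λ a → con (+ 1) :* a := a) ≈-refl (X * R) ⟩
    X * R ∎
    where
    WS : W * S ≈ X * (one - t * u)
    WS = begin
      W * S ≈⟨ *-congˡ S-eq ⟩
      W * (one - (t + one) * u - ⟦ + 2 ⟧ * t * u * X)
        ≈⟨ solve 4 (λ t u X W → W :* (con (+ 1) :- (t :+ con (+ 1)) :* u :- con (+ 2) :* t :* u :* X)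
             := W :* (con (+ 1) :- t :* u) :- u :* (W :+ (t :* W :* X :+ t :* X :* W))) ≈-refl t u X W ⟩
      W * (one - t * u) - u * (W + (t * W * X + t * X * W)) ≈⟨ +-congʳ e ⟩
      X * (one - t * u) + u * (W + (t * W * X + t * X * W)) - u * (W + (t * W * X + t * X * W))
        ≈⟨ solve 2 (λ a b → a :+ b :- b := a) ≈-refl _ _ ⟩
      X * (one - t * u) ∎

  -- The surplus `1 + t u` on the right sits in degrees 0 and 1 of `u`, below the first wheel.
  total : ∀ t u X G W PW R D → (one - t * u) * G ≈ one → G * W ≈ X * R →
    PW + t * u * u ≈ (one - t * u) * (R - D - one + t * u - t * X - (one + t * X) * t * u * X * R) →
    (one + t * X) + (G * PW + (one + t * X) * (t * u * (G * W))) + G * (t * u * u) ≈ R - D - one + (one + t * u)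
  total t u X G W PW R D G-eq eW e = begin
    (one + t * X) + (G * PW + (one + t * X) * (t * u * (G * W))) + G * (t * u * u)
      ≈⟨ solve 6 (λ t u X G PW GW → let o = con (+ 1) in (o :+ t :* X) :+ (G :* PW :+ (o :+ t :* X) :* (t :* u :* GW)) :+ G :* (t :* u :* u)
           := (o :+ t :* X) :+ (o :+ t :* X) :* (t :* u :* GW) :+ G :* (PW :+ t :* u :* u)) ≈-refl t u X G PW (G * W) ⟩
    (one + t * X) + (one + t * X) * (t * u * (G * W)) + G * (PW + t * u * u)
      ≈⟨ +-cong (+-congˡ (*-congˡ (*-congˡ eW))) (*-congˡ e) ⟩
    (one + t * X) + (one + t * X) * (t * u * (X * R)) + G * ((one - t * u) * Z)
      ≈⟨ solve 6 (λ t u X R G Z → let o = con (+ 1) in (o :+ t :* X) :+ (o :+ t :* X) :* (t :* u :* (X :* R)) :+ G :* ((o :- t :* u) :* Z)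
           := (o :+ t :* X) :+ (o :+ t :* X) :* (t :* u :* (X :* R)) :+ (o :- t :* u) :* G :* Z) ≈-refl t u X R G Z ⟩
    (one + t * X) + (one + t * X) * (t * u * (X * R)) + (one - t * u) * G * Z
      ≈⟨ +-congˡ (*-congʳ G-eq) ⟩
    (one + t * X) + (one + t * X) * (t * u * (X * R)) + one * Z
      ≈⟨ solve 5 (λ t u X R D → let o = con (+ 1) in (o :+ t :* X) :+ (o :+ t :* X) :* (t :* u :* (X :* R))
             :+ o :* (R :- D :- o :+ t :* u :- t :* X :- (o :+ t :* X) :* t :* u :* X :* R) := R :- D :- o :+ (o :+ t :* u)) ≈-refl t u X R D ⟩
    R - D - one + (one + t * u) ∎
    where
    Z : Carrier
    Z = R - D - one + t * u - t * X - (one + t * X) * t * u * X * R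

-- Gradings of polynomials and series

module ℤt = PowerSeries ℤP.+-*-commutativeRing (-raw-almostCommutative⟶ (fromCommutativeRing ℤP.+-*-commutativeRing))
module Su = PowerSeries ℤt.series ℤt.const-hom
module KT = CommutativeRing ℤt.series
module KU = CommutativeRing Su.series
module ST = Solver ℤt.series ℤt.const-hom
module SU = Solver Su.series Su.const-hom

Pol : Set
Pol = ℕ → ℤ

tP : Pol
tP = ℤt.var

-- The coefficient of `uⁿ` carries weight `n`. A relation between two polynomials, rather than a
-- predicate on one, lets the same closure properties serve for degree bounds (used on the diagonal)
-- and for the reversal `t ↦ 1/t`.
module Graded
  (Gr : ℕ → Pol → Pol → Set)
  (gr-cong : ∀ {n p p′ q q′} → p KT.≈ p′ → q KT.≈ q′ → Gr n p q → Gr n p′ q′)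
  (gr-zero : ∀ {n} → Gr n KT.0# KT.0#)
  (gr-one : Gr 0 KT.1# KT.1#)
  (gr-+ : ∀ {n p p′ q q′} → Gr n p q → Gr n p′ q′ → Gr n (p KT.+ p′) (q KT.+ q′))
  (gr-neg : ∀ {n p q} → Gr n p q → Gr n (KT.- p) (KT.- q))
  (gr-* : ∀ {n m p p′ q q′} → Gr n p q → Gr m p′ q′ → Gr (n ℕ.+ m) (p KT.* p′) (q KT.* q′))
  where

  -- The offset `a` absorbs the shift of weights when the recursion of `mul` passes to the tail of
  -- its first factor; the bound `N` is for strong induction on the exponent of `u`.
  Upto : ℕ → ℕ → Ser → Ser → Set
  Upto N a f g = ∀ i → i < N → Gr (a ℕ.+ i) (f i) (g i)

  All : Ser → Ser → Set
  All f g = ∀ i → Gr i (f i) (g i)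

  upto-mul : ∀ {N a b f f′ g g′} → Upto N a f f′ → Upto N b g g′ → Upto N (a ℕ.+ b) (f KU.* g) (f′ KU.* g′)
  upto-mul {N} {a} {b} {f} {f′} {g} {g′} p q zero i<N =
    ≡.subst (λ k → Gr k (f 0 KT.* g 0) (f′ 0 KT.* g′ 0))
      (≡.trans (≡.cong₂ ℕ._+_ (ℕP.+-identityʳ a) (ℕP.+-identityʳ b)) (≡.sym (ℕP.+-identityʳ (a ℕ.+ b))))
      (gr-* (p 0 i<N) (q 0 i<N))
  upto-mul {suc N} {a} {b} {f} {f′} {g} {g′} p q (suc i) (s≤s i<N) = gr-+
    (≡.subst (λ k → Gr k (f 0 KT.* g (suc i)) (f′ 0 KT.* g′ (suc i)))
      (≡.trans (≡.cong (ℕ._+ (b ℕ.+ suc i)) (ℕP.+-identityʳ a)) (≡.sym (ℕP.+-assoc a b (suc i))))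
      (gr-* (p 0 (s≤s z≤n)) (q (suc i) (s≤s i<N))))
    (≡.subst (λ k → Gr k (Su.mul (Su.tail f) g i) (Su.mul (Su.tail f′) g′ i)) (≡.sym (ℕP.+-suc (a ℕ.+ b) i))
      (upto-mul {N} {suc a} {b}
        (λ j j<N → ≡.subst (λ k → Gr k (f (suc j)) (f′ (suc j))) (ℕP.+-suc a j) (p (suc j) (s≤s j<N)))
        (λ j j<N → q j (ℕP.m<n⇒m<1+n j<N)) i i<N))

  all-upto : ∀ {N f g} → All f g → Upto N 0 f g
  all-upto p i _ = p i

  all-mul : ∀ {f f′ g g′} → All f f′ → All g g′ → All (f KU.* g) (f′ KU.* g′)
  all-mul p q i = upto-mul {suc i} {0} {0} (all-upto p) (all-upto q) i ℕP.≤-refl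

  all-+ : ∀ {f f′ g g′} → All f f′ → All g g′ → All (f KU.+ g) (f′ KU.+ g′)
  all-+ p q i = gr-+ (p i) (q i)

  all-neg : ∀ {f f′} → All f f′ → All (KU.- f) (KU.- f′)
  all-neg p i = gr-neg (p i)

  all-one : All KU.1# KU.1#
  all-one zero = gr-one
  all-one (suc i) = gr-zero

  all-cong : ∀ {f f′ g g′} → f KU.≈ f′ → g KU.≈ g′ → All f g → All f′ g′
  all-cong p q r i = gr-cong (Su.at p i) (Su.at q i) (r i)

  all-strong : ∀ {f g} → (∀ n → Upto n 0 f g → Gr n (f n) (g n)) → All f g
  all-strong {f} {g} step n = upto (suc n) n ℕP.≤-refl
    where
    upto : ∀ N → Upto N 0 f g
    upto (suc N) i (s≤s i≤N) = step i (λ j j<i → upto N j (ℕP.<-≤-trans j<i i≤N))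

  all-inv : ∀ {f g} → All f g → All (Su.inv f) (Su.inv g)
  all-inv {f} {g} p = all-strong step
    where
    step : ∀ n → Upto n 0 (Su.inv f) (Su.inv g) → Gr n (Su.inv f n) (Su.inv g n)
    step zero _ = gr-cong (KT.sym (Su.at (Su.inv-fix f) 0)) (KT.sym (Su.at (Su.inv-fix g) 0)) (gr-+ gr-one gr-zero)
    step (suc n) ih = gr-cong (KT.sym (Su.at (Su.inv-fix f) (suc n))) (KT.sym (Su.at (Su.inv-fix g) (suc n)))
      (gr-+ gr-zero (upto-mul {suc n} {1} {0} (λ i _ → gr-neg (p (suc i))) ih n ℕP.≤-refl))

-- Polynomials of degree at most `n / 2`, given by generators rather than by vanishing coefficients,
-- so that closure under products is a structural induction.
data Half : ℕ → Pol → Set where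
  const : ∀ {n} c → Half n (ℤt.const c)
  add   : ∀ {n p q} → Half n p → Half n q → Half n (p KT.+ q)
  t·    : ∀ {n p} → Half n p → Half (suc (suc n)) (tP KT.* p)
  resp  : ∀ {n p q} → p KT.≈ q → Half n p → Half n q

half-coeff : ∀ {n p} → Half n p → ∀ i → n < i ℕ.+ i → p i ≡ + 0
half-coeff (const c) (suc i) n<i = refl
half-coeff (add p q) i n<i = ≡.cong₂ ℤ._+_ (half-coeff p i n<i) (half-coeff q i n<i)
half-coeff (t· {n} {p} h) (suc i) n<i = ≡.trans (ℤt.mul-var p (suc i)) (half-coeff h i bound)
  where
  bound : n < i ℕ.+ i
  bound with ≡.subst (suc (suc n) <_) (≡.cong suc (ℕP.+-suc i i)) n<i
  ... | s≤s (s≤s b) = b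
half-coeff (resp p≈q h) i n<i = ≡.trans (≡.sym (ℤt.at p≈q i)) (half-coeff h i n<i)

half-raise : ∀ {n p} m → Half n p → Half (m ℕ.+ n) p
half-raise m (const c) = const c
half-raise m (add p q) = add (half-raise m p) (half-raise m q)
half-raise m (t· {n} {p} h) = ≡.subst (λ k → Half k (tP KT.* p))
  (≡.sym (≡.trans (ℕP.+-suc m (suc n)) (≡.cong suc (ℕP.+-suc m n)))) (t· (half-raise m h))
half-raise m (resp e h) = resp e (half-raise m h)

half-scale : ∀ {n p} c → Half n p → Half n (ℤt.const c KT.* p)
half-scale c (const d) = resp (ℤt.eqv λ { zero → refl ; (suc n) → ≡.sym (≡.trans (ℤt.mul-const c _ (suc n)) (ℤP.*-zeroʳ c)) }) (const (c ℤ.* d))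
half-scale c (add p q) = resp (KT.sym (KT.distribˡ _ _ _)) (add (half-scale c p) (half-scale c q))
half-scale c (t· {n} {p} h) = resp (ST.solve 3 (λ t c p → t ST.:* (c ST.:* p) ST.:= c ST.:* (t ST.:* p)) KT.refl tP (ℤt.const c) p) (t· (half-scale c h))
half-scale c (resp e h) = resp (KT.*-congˡ e) (half-scale c h)

half-mul : ∀ {n m p q} → Half n p → Half m q → Half (n ℕ.+ m) (p KT.* q)
half-mul {n} (const c) h = half-raise n (half-scale c h)
half-mul (add p p′) h = resp (KT.sym (KT.distribʳ _ _ _)) (add (half-mul p h) (half-mul p′ h))
half-mul (t· p) h = resp (KT.sym (KT.*-assoc _ _ _)) (t· (half-mul p h))
half-mul (resp e p) h = resp (KT.*-congʳ e) (half-mul p h)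

neg-scale : ∀ p → ℤt.const (ℤ.- + 1) KT.* p KT.≈ KT.- p
neg-scale p = ST.solve 1 (λ p → ST.con (ℤ.- + 1) ST.:* p ST.:= ST.:- p) KT.refl p

half-neg : ∀ {n p} → Half n p → Half n (KT.- p)
half-neg h = resp (neg-scale _) (half-scale _ h)

half-zero : ∀ {n} → Half n KT.0#
half-zero = resp (ℤt.eqv λ { zero → refl ; (suc n) → refl }) (const (+ 0))

module Halfs = Graded (λ n p q → Half n p × Half n q)
  (λ e e′ (h , h′) → resp e h , resp e′ h′)
  (half-zero , half-zero)
  (const (+ 1) , const (+ 1))
  (λ (h , h′) (k , k′) → add h k , add h′ k′)
  (λ (h , h′) → half-neg h , half-neg h′)
  (λ (h , h′) (k , k′) → half-mul h k , half-mul h′ k′)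

HalfS : Ser → Set
HalfS f = Halfs.All f f

-- Rev n p q: p and q have degree at most n and q(t) = tⁿ p(1/t).
data Rev : ℕ → Pol → Pol → Set where
  const : ∀ c → Rev 0 (ℤt.const c) (ℤt.const c)
  nil   : ∀ {n} → Rev n KT.0# KT.0#
  add   : ∀ {n p p′ q q′} → Rev n p q → Rev n p′ q′ → Rev n (p KT.+ p′) (q KT.+ q′)
  t·ˡ   : ∀ {n p q} → Rev n p q → Rev (suc n) (tP KT.* p) q
  t·ʳ   : ∀ {n p q} → Rev n p q → Rev (suc n) p (tP KT.* q)
  resp  : ∀ {n p p′ q q′} → p KT.≈ p′ → q KT.≈ q′ → Rev n p q → Rev n p′ q′

rev-sym : ∀ {n p q} → Rev n p q → Rev n q p
rev-sym (const c) = const c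
rev-sym nil = nil
rev-sym (add h h′) = add (rev-sym h) (rev-sym h′)
rev-sym (t·ˡ h) = t·ʳ (rev-sym h)
rev-sym (t·ʳ h) = t·ˡ (rev-sym h)
rev-sym (resp e e′ h) = resp e′ e (rev-sym h)

rev-degree : ∀ {n p q} → Rev n p q → ∀ i → n < i → p i ≡ + 0
rev-degree (const c) (suc i) _ = refl
rev-degree nil i _ = refl
rev-degree (add h h′) i n<i = ≡.cong₂ ℤ._+_ (rev-degree h i n<i) (rev-degree h′ i n<i)
rev-degree (t·ˡ {p = p} h) (suc i) (s≤s n<i) = ≡.trans (ℤt.mul-var p (suc i)) (rev-degree h i n<i)
rev-degree (t·ʳ h) (suc i) n<i = rev-degree h (suc i) (ℕP.<-trans (ℕP.n<1+n _) n<i)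
rev-degree (resp e _ h) i n<i = ≡.trans (≡.sym (ℤt.at e i)) (rev-degree h i n<i)

rev-coeff : ∀ {n p q} → Rev n p q → ∀ i j → i ℕ.+ j ≡ n → p i ≡ q j
rev-coeff (const c) zero zero refl = refl
rev-coeff nil i j _ = refl
rev-coeff (add h h′) i j e = ≡.cong₂ ℤ._+_ (rev-coeff h i j e) (rev-coeff h′ i j e)
rev-coeff (t·ˡ {n} {p} {q} h) zero j refl = ≡.trans (ℤt.mul-var p 0) (≡.sym (rev-degree (rev-sym h) j ℕP.≤-refl))
rev-coeff (t·ˡ {n} {p} {q} h) (suc i) j refl = ≡.trans (ℤt.mul-var p (suc i)) (rev-coeff h i j refl)
rev-coeff (t·ʳ {n} {p} {q} h) i zero e = ≡.trans (rev-degree h i (ℕP.≤-reflexive (≡.trans (≡.sym e) (ℕP.+-identityʳ i)))) (≡.sym (ℤt.mul-var q 0))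
rev-coeff (t·ʳ {n} {p} {q} h) i (suc j) e = ≡.trans (rev-coeff h i j (ℕP.suc-injective (≡.trans (≡.sym (ℕP.+-suc i j)) e))) (≡.sym (ℤt.mul-var q (suc j)))
rev-coeff (resp e e′ h) i j k = ≡.trans (≡.sym (ℤt.at e i)) (≡.trans (rev-coeff h i j k) (ℤt.at e′ j))

rev-scale : ∀ {n p q} c → Rev n p q → Rev n (ℤt.const c KT.* p) (ℤt.const c KT.* q)
rev-scale c (const d) = resp e e (const (c ℤ.* d))
  where
  e : ℤt.const (c ℤ.* d) KT.≈ ℤt.const c KT.* ℤt.const d
  e = ℤt.eqv λ { zero → refl ; (suc n) → ≡.sym (≡.trans (ℤt.mul-const c _ (suc n)) (ℤP.*-zeroʳ c)) }
rev-scale c nil = resp (KT.sym (KT.zeroʳ _)) (KT.sym (KT.zeroʳ _)) nil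
rev-scale c (add h h′) = resp (KT.sym (KT.distribˡ _ _ _)) (KT.sym (KT.distribˡ _ _ _)) (add (rev-scale c h) (rev-scale c h′))
rev-scale c (t·ˡ {n} {p} h) = resp (ST.solve 3 (λ t c p → t ST.:* (c ST.:* p) ST.:= c ST.:* (t ST.:* p)) KT.refl tP (ℤt.const c) p) KT.refl (t·ˡ (rev-scale c h))
rev-scale c (t·ʳ {n} {p} {q} h) = resp KT.refl (ST.solve 3 (λ t c p → t ST.:* (c ST.:* p) ST.:= c ST.:* (t ST.:* p)) KT.refl tP (ℤt.const c) q) (t·ʳ (rev-scale c h))
rev-scale c (resp e e′ h) = resp (KT.*-congˡ e) (KT.*-congˡ e′) (rev-scale c h)

rev-mul : ∀ {n m p p′ q q′} → Rev n p q → Rev m p′ q′ → Rev (n ℕ.+ m) (p KT.* p′) (q KT.* q′)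
rev-mul (const c) h = rev-scale c h
rev-mul nil h = resp (KT.sym (KT.zeroˡ _)) (KT.sym (KT.zeroˡ _)) nil
rev-mul (add g g′) h = resp (KT.sym (KT.distribʳ _ _ _)) (KT.sym (KT.distribʳ _ _ _)) (add (rev-mul g h) (rev-mul g′ h))
rev-mul (t·ˡ g) h = resp (KT.sym (KT.*-assoc _ _ _)) KT.refl (t·ˡ (rev-mul g h))
rev-mul (t·ʳ g) h = resp KT.refl (KT.sym (KT.*-assoc _ _ _)) (t·ʳ (rev-mul g h))
rev-mul (resp e e′ g) h = resp (KT.*-congʳ e) (KT.*-congʳ e′) (rev-mul g h)

rev-neg : ∀ {n p q} → Rev n p q → Rev n (KT.- p) (KT.- q)
rev-neg h = resp (neg-scale _) (neg-scale _) (rev-scale _ h)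

module Revs = Graded Rev resp nil (const (+ 1)) add rev-neg rev-mul

-- Sums over subsets

true≢false : true ≢ false
true≢false ()

bool-iff : ∀ {a b : Bool} → (a ≡ true → b ≡ true) → (b ≡ true → a ≡ true) → a ≡ b
bool-iff {true} f g = ≡.sym (f refl)
bool-iff {false} {true} f g = g refl
bool-iff {false} {false} f g = refl

∧-true : ∀ {a b} → a ∧ b ≡ true → a ≡ true × b ≡ true
∧-true {true} e = refl , e

∧-true′ : ∀ {a b} → a ≡ true → b ≡ true → a ∧ b ≡ true
∧-true′ refl e = e

⇒-true : ∀ {a b} → not a ∨ b ≡ true → a ≡ true → b ≡ true
⇒-true {true} e refl = e

⇒-true′ : ∀ {a b} → (a ≡ true → b ≡ true) → not a ∨ b ≡ true
⇒-true′ {true} f = f refl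
⇒-true′ {false} f = refl

not-true : ∀ {a} → not a ≡ true → a ≡ false
not-true {false} _ = refl

not-true′ : ∀ {a} → (a ≡ true → ⊥) → not a ≡ true
not-true′ {false} _ = refl
not-true′ {true} f = ⊥-elim (f refl)

≢true : ∀ {a} → (a ≡ true → ⊥) → a ≡ false
≢true f = not-true (not-true′ f)

bool-cases : ∀ b → b ≡ true ⊎ b ≡ false
bool-cases true = inj₁ refl
bool-cases false = inj₂ refl

all-tabulate : ∀ {A : Set} {n} (p : A → Bool) (f : Fin n → A) → all p (tabulate f) ≡ all (p ∘ f) (allFin n)
all-tabulate {n = zero} p f = refl
all-tabulate {n = suc n} p f = ≡.cong (p (f zero) ∧_)
  (≡.trans (all-tabulate p (f ∘ suc)) (≡.sym (all-tabulate (p ∘ f) suc)))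

any-tabulate : ∀ {A : Set} {n} (p : A → Bool) (f : Fin n → A) → any p (tabulate f) ≡ any (p ∘ f) (allFin n)
any-tabulate {n = zero} p f = refl
any-tabulate {n = suc n} p f = ≡.cong (p (f zero) ∨_)
  (≡.trans (any-tabulate p (f ∘ suc)) (≡.sym (any-tabulate (p ∘ f) suc)))

all-true : ∀ {n} {p : Fin n → Bool} → all p (allFin n) ≡ true → ∀ i → p i ≡ true
all-true e zero = proj₁ (∧-true e)
all-true {suc n} {p} e (suc i) = all-true (≡.trans (≡.sym (all-tabulate p suc)) (proj₂ (∧-true {p zero} e))) i

all-true′ : ∀ {n} {p : Fin n → Bool} → (∀ i → p i ≡ true) → all p (allFin n) ≡ true
all-true′ {zero} f = refl
all-true′ {suc n} {p} f = ∧-true′ (f zero) (≡.trans (all-tabulate p suc) (all-true′ (λ i → f (suc i))))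

any-true : ∀ {n} {p : Fin n → Bool} → any p (allFin n) ≡ true → Σ (Fin n) λ i → p i ≡ true
any-true {suc n} {p} e with p zero in eq
... | true = zero , eq
... | false with any-true (≡.trans (≡.sym (any-tabulate p suc)) e)
...   | i , pi = suc i , pi

any-true′ : ∀ {n} {p : Fin n → Bool} i → p i ≡ true → any p (allFin n) ≡ true
any-true′ {suc n} {p} zero e = ≡.cong (_∨ any p (tabulate suc)) e
any-true′ {suc n} {p} (suc i) e with p zero
... | true = refl
... | false = ≡.trans (any-tabulate p suc) (any-true′ i e)

⊆-true : ∀ {m} {A B : Subset m} → (A ⊆ᵇ B) ≡ true → ∀ i → A i ≡ true → B i ≡ true
⊆-true e i = ⇒-true (all-true e i)

⊆-true′ : ∀ {m} {A B : Subset m} → (∀ i → A i ≡ true → B i ≡ true) → (A ⊆ᵇ B) ≡ true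
⊆-true′ f = all-true′ λ i → ⇒-true′ (f i)

⊆-ext : ∀ {m} (A B : Subset (suc m)) → (A ⊆ᵇ B) ≡ (not (A zero) ∨ B zero) ∧ ((A ∘ suc) ⊆ᵇ (B ∘ suc))
⊆-ext A B = ≡.cong ((not (A zero) ∨ B zero) ∧_) (all-tabulate (λ i → not (A i) ∨ B i) suc)

∅ : ∀ {m} → Subset m
∅ _ = false

empty : ∀ {m} {A : Subset m} → nonempty A ≡ false → ∀ i → A i ≡ false
empty {A = A} e i with A i in eq
... | false = refl
... | true = ⊥-elim (true≢false (≡.trans (≡.sym (any-true′ i eq)) e))

iv : Bool → ℤ → ℤ
iv b z = if b then z else + 0

iv-cong : ∀ {b b′ z z′} → b ≡ b′ → (b ≡ true → z ≡ z′) → iv b z ≡ iv b′ z′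
iv-cong {true} refl f = f refl
iv-cong {false} refl f = refl

iv-∧ : ∀ a b z → iv (a ∧ b) z ≡ iv a (iv b z)
iv-∧ true b z = refl
iv-∧ false b z = refl

iv-0 : ∀ b → iv b (+ 0) ≡ + 0
iv-0 true = refl
iv-0 false = refl

iv-* : ∀ b y z → y ℤ.* iv b z ≡ iv b (y ℤ.* z)
iv-* true y z = refl
iv-* false y z = ℤP.*-zeroʳ y

iv-swap : ∀ a b z → iv a (iv b z) ≡ iv b (iv a z)
iv-swap true b z = refl
iv-swap false b z = ≡.sym (iv-0 b)

sumL : ∀ {A : Set} → List A → (A → ℤ) → ℤ
sumL [] f = + 0
sumL (a ∷ as) f = f a ℤ.+ sumL as f

sumL-cong : ∀ {A : Set} (as : List A) {f g : A → ℤ} → (∀ a → f a ≡ g a) → sumL as f ≡ sumL as g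
sumL-cong [] e = refl
sumL-cong (a ∷ as) e = ≡.cong₂ ℤ._+_ (e a) (sumL-cong as e)

sumL-0 : ∀ {A : Set} (as : List A) → sumL as (λ _ → + 0) ≡ + 0
sumL-0 [] = refl
sumL-0 (a ∷ as) = ≡.trans (ℤP.+-identityˡ _) (sumL-0 as)

+-interchange : ∀ a b c d → (a ℤ.+ b) ℤ.+ (c ℤ.+ d) ≡ (a ℤ.+ c) ℤ.+ (b ℤ.+ d)
+-interchange = interchange
  where open import Algebra.Properties.CommutativeSemigroup ℤP.+-commutativeSemigroup using (interchange)

sumL-+ : ∀ {A : Set} (as : List A) (f g : A → ℤ) → sumL as (λ a → f a ℤ.+ g a) ≡ sumL as f ℤ.+ sumL as g
sumL-+ [] f g = refl
sumL-+ (a ∷ as) f g = ≡.trans (≡.cong (λ z → f a ℤ.+ g a ℤ.+ z) (sumL-+ as f g)) (+-interchange (f a) (g a) _ _)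

sumL-* : ∀ {A : Set} (as : List A) c (f : A → ℤ) → sumL as (λ a → c ℤ.* f a) ≡ c ℤ.* sumL as f
sumL-* [] c f = ≡.sym (ℤP.*-zeroʳ c)
sumL-* (a ∷ as) c f = ≡.trans (≡.cong (λ z → c ℤ.* f a ℤ.+ z) (sumL-* as c f)) (≡.sym (ℤP.*-distribˡ-+ c (f a) _))

sumL-iv : ∀ {A : Set} (as : List A) b (f : A → ℤ) → sumL as (λ a → iv b (f a)) ≡ iv b (sumL as f)
sumL-iv as true f = refl
sumL-iv as false f = sumL-0 as

sumL-swap : ∀ {A B : Set} (as : List A) (bs : List B) (f : A → B → ℤ) →
  sumL as (λ a → sumL bs (f a)) ≡ sumL bs (λ b → sumL as (λ a → f a b))
sumL-swap [] bs f = ≡.sym (sumL-0 bs)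
sumL-swap (a ∷ as) bs f = ≡.trans (≡.cong (λ z → sumL bs (f a) ℤ.+ z) (sumL-swap as bs f)) (≡.sym (sumL-+ bs (f a) _))

sumL-filter : ∀ {A : Set} (p : A → Bool) as (f : A → ℤ) → sumL (filterᵇ p as) f ≡ sumL as (λ a → iv (p a) (f a))
sumL-filter p [] f = refl
sumL-filter p (a ∷ as) f with p a
... | true = ≡.cong (λ z → f a ℤ.+ z) (sumL-filter p as f)
... | false = ≡.trans (sumL-filter p as f) (≡.sym (ℤP.+-identityˡ _))

sumL-map : ∀ {A B : Set} (h : A → B) as (f : B → ℤ) → sumL (map h as) f ≡ sumL as (f ∘ h)
sumL-map h [] f = refl
sumL-map h (a ∷ as) f = ≡.cong (λ z → f (h a) ℤ.+ z) (sumL-map h as f)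

Σs : ∀ m → (Subset m → ℤ) → ℤ
Σs m = sumL (allSubsets m)

Σs-suc : ∀ m f → Σs (suc m) f ≡ Σs m (λ A → f (ext false A) ℤ.+ f (ext true A))
Σs-suc m f = go (allSubsets m)
  where
  go : ∀ as → sumL (concatMap (λ A → ext false A ∷ ext true A ∷ []) as) f ≡ sumL as (λ A → f (ext false A) ℤ.+ f (ext true A))
  go [] = refl
  go (a ∷ as) = ≡.trans (≡.cong (λ z → f (ext false a) ℤ.+ (f (ext true a) ℤ.+ z)) (go as)) (≡.sym (ℤP.+-assoc (f (ext false a)) _ _))

-- Subsets are functions, and pointwise equal ones need not be identical. Any summand that is
-- carried from one subset to another therefore has to be shown invariant under pointwise equality.
Ext : ∀ {m} {B : Set} → (Subset m → B) → Set
Ext f = ∀ {A B} → A ≗ B → f A ≡ f B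

Σs-cong : ∀ m {f g : Subset m → ℤ} → (∀ A → f A ≡ g A) → Σs m f ≡ Σs m g
Σs-cong m = sumL-cong (allSubsets m)

ext-cong : ∀ {m} b {A B : Subset m} → A ≗ B → ext b A ≗ ext b B
ext-cong b e zero = refl
ext-cong b e (suc i) = e i

Σs-∅ : ∀ m (g : Subset m → ℤ) → Ext g → Σs m (λ F → iv (not (nonempty F)) (g F)) ≡ g ∅
Σs-∅ zero g x = ≡.trans (ℤP.+-identityʳ _) (x λ ())
Σs-∅ (suc m) g x = ≡.trans (Σs-suc m _) (≡.trans (Σs-cong m step) (≡.trans (Σs-∅ m (g ∘ ext false) (λ e → x (ext-cong false e)))
    (x λ { zero → refl ; (suc i) → refl })))
  where
  step : ∀ A → iv (not (nonempty (ext false A))) (g (ext false A)) ℤ.+ + 0 ≡ iv (not (nonempty A)) (g (ext false A))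
  step A = ≡.trans (ℤP.+-identityʳ _) (≡.cong (λ b → iv (not b) (g (ext false A))) (any-tabulate (ext false A) suc))

filter-tabulate : ∀ {A : Set} {n} (p : A → Bool) (f : Fin n → A) → length (filterᵇ p (tabulate f)) ≡ length (filterᵇ (p ∘ f) (allFin n))
filter-tabulate {n = zero} p f = refl
filter-tabulate {n = suc n} p f with p (f zero)
... | true = ≡.cong suc (≡.trans (filter-tabulate p (f ∘ suc)) (≡.sym (filter-tabulate (p ∘ f) suc)))
... | false = ≡.trans (filter-tabulate p (f ∘ suc)) (≡.sym (filter-tabulate (p ∘ f) suc))

card-true : ∀ {m} (A : Subset m) → card (ext true A) ≡ suc (card A)
card-true A = ≡.cong suc (filter-tabulate (ext true A) suc)

card-false : ∀ {m} (A : Subset m) → card (ext false A) ≡ card A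
card-false A = filter-tabulate (ext false A) suc

-- Adding or removing a fixed element of `F` pairs off terms of opposite sign.
Σs-sign : ∀ m (F : Subset m) → Σs m (λ A → iv (A ⊆ᵇ F) (sign (card A))) ≡ iv (not (nonempty F)) (+ 1)
Σs-sign zero F = refl
Σs-sign (suc m) F = ≡.trans (Σs-suc m _) (≡.trans (Σs-cong m step) (go (F zero) refl))
  where
  step : ∀ A → iv (ext false A ⊆ᵇ F) (sign (card (ext false A))) ℤ.+ iv (ext true A ⊆ᵇ F) (sign (card (ext true A)))
       ≡ iv (not (F zero)) (iv (A ⊆ᵇ (F ∘ suc)) (sign (card A)))
  step A = ≡.trans (≡.cong₂ ℤ._+_ (≡.cong₂ (λ b n → iv b (sign n)) (⊆-ext (ext false A) F) (card-false A))
                                  (≡.cong₂ (λ b n → iv b (sign n)) (⊆-ext (ext true A) F) (card-true A)))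
                   (cases (F zero) (A ⊆ᵇ (F ∘ suc)))
    where
    s : ℤ
    s = sign (card A)
    cases : ∀ b c → iv c s ℤ.+ iv (b ∧ c) (ℤ.- s) ≡ iv (not b) (iv c s)
    cases true true = ℤP.+-inverseʳ s
    cases true false = refl
    cases false c = ℤP.+-identityʳ _
  go : ∀ b → F zero ≡ b → Σs m (λ A → iv (not (F zero)) (iv (A ⊆ᵇ (F ∘ suc)) (sign (card A)))) ≡ iv (not (nonempty F)) (+ 1)
  go true e = ≡.trans (Σs-cong m (λ A → ≡.cong (λ b → iv (not b) (iv (A ⊆ᵇ (F ∘ suc)) (sign (card A)))) e))
    (≡.trans (sumL-0 (allSubsets m)) (≡.cong (λ b → iv (not b) (+ 1)) (≡.sym (any-true′ {p = F} zero e))))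
  go false e = ≡.trans (Σs-cong m (λ A → ≡.cong (λ b → iv (not b) (iv (A ⊆ᵇ (F ∘ suc)) (sign (card A)))) e))
    (≡.trans (Σs-sign m (F ∘ suc)) (≡.cong (λ b → iv (not b) (+ 1))
      (≡.sym (≡.trans (≡.cong (_∨ any F (tabulate suc)) e) (any-tabulate F suc)))))

compl : ∀ {m} → Subset m → Subset m
compl F i = not (F i)

-- The map `F ↦ F ∪ F₀` is a bijection from the sets disjoint from `F₀` to the sets containing it.
-- It is what identifies the flats of a contraction with flats of the matroid.
Σs-reindex : ∀ m (F₀ : Subset m) (g : Subset m → ℤ) → Ext g →
  Σs m (λ F → iv (F ⊆ᵇ compl F₀) (g (F ∪ F₀))) ≡ Σs m (λ F → iv (F₀ ⊆ᵇ F) (g F))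
Σs-reindex zero F₀ g x = ≡.cong (ℤ._+ + 0) (x λ ())
Σs-reindex (suc m) F₀ g x = ≡.trans (Σs-suc m _) (≡.trans (Σs-cong m left) (≡.trans middle (≡.sym (≡.trans (Σs-suc m _) (Σs-cong m right)))))
  where
  b : Bool
  b = F₀ zero
  F₁ : Subset m
  F₁ = F₀ ∘ suc
  h : Subset m → ℤ
  h F = iv (not b) (g (ext false F)) ℤ.+ g (ext true F)
  hx : Ext h
  hx e = ≡.cong₂ (λ y z → iv (not b) y ℤ.+ z) (x (ext-cong false e)) (x (ext-cong true e))
  left : ∀ F → iv (ext false F ⊆ᵇ compl F₀) (g (ext false F ∪ F₀)) ℤ.+ iv (ext true F ⊆ᵇ compl F₀) (g (ext true F ∪ F₀))
       ≡ iv (F ⊆ᵇ compl F₁) (h (F ∪ F₁))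
  left F = ≡.trans (≡.cong₂ (λ b c → iv b (g (ext false F ∪ F₀)) ℤ.+ iv c (g (ext true F ∪ F₀))) (⊆-ext (ext false F) (compl F₀)) (⊆-ext (ext true F) (compl F₀)))
      (cases (F ⊆ᵇ compl F₁) (F₀ zero) refl)
    where
    cases : ∀ c d → F₀ zero ≡ d → iv c (g (ext false F ∪ F₀)) ℤ.+ iv (not d ∧ c) (g (ext true F ∪ F₀))
      ≡ iv c (iv (not d) (g (ext false (F ∪ F₁))) ℤ.+ g (ext true (F ∪ F₁)))
    cases true true eq = ≡.trans (ℤP.+-identityʳ _) (≡.trans (x λ { zero → eq ; (suc i) → refl }) (≡.sym (ℤP.+-identityˡ _)))
    cases true false eq = ≡.cong₂ ℤ._+_ (x λ { zero → eq ; (suc i) → refl }) (x λ { zero → refl ; (suc i) → refl })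
    cases false true _ = refl
    cases false false _ = refl
  middle : Σs m (λ F → iv (F ⊆ᵇ compl F₁) (h (F ∪ F₁))) ≡ Σs m (λ F → iv (F₁ ⊆ᵇ F) (h F))
  middle = Σs-reindex m F₁ h hx
  right : ∀ F → iv (F₀ ⊆ᵇ ext false F) (g (ext false F)) ℤ.+ iv (F₀ ⊆ᵇ ext true F) (g (ext true F)) ≡ iv (F₁ ⊆ᵇ F) (h F)
  right F = ≡.trans (≡.cong₂ (λ b c → iv b (g (ext false F)) ℤ.+ iv c (g (ext true F))) (⊆-ext F₀ (ext false F)) (⊆-ext F₀ (ext true F)))
      (cases (F₁ ⊆ᵇ F) (F₀ zero))
    where
    cases : ∀ c d → iv ((not d ∨ false) ∧ c) (g (ext false F)) ℤ.+ iv ((not d ∨ true) ∧ c) (g (ext true F))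
      ≡ iv c (iv (not d) (g (ext false F)) ℤ.+ g (ext true F))
    cases true true = refl
    cases true false = refl
    cases false true = refl
    cases false false = refl

coeff-add : ∀ p q j → coeff (addP p q) j ≡ coeff p j ℤ.+ coeff q j
coeff-add [] q j = ≡.sym (ℤP.+-identityˡ _)
coeff-add (a ∷ p) [] j = ≡.sym (ℤP.+-identityʳ _)
coeff-add (a ∷ p) (b ∷ q) zero = refl
coeff-add (a ∷ p) (b ∷ q) (suc j) = coeff-add p q j

coeff-sum : ∀ {A : Set} (as : List A) (f : A → Poly) j → coeff (sumP (map f as)) j ≡ sumL as (λ a → coeff (f a) j)
coeff-sum [] f j = refl
coeff-sum (a ∷ as) f j = ≡.trans (coeff-add (f a) _ j) (≡.cong (λ z → coeff (f a) j ℤ.+ z) (coeff-sum as f j))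

coeff-scale : ∀ c p j → coeff (scaleP c p) j ≡ c ℤ.* coeff p j
coeff-scale c [] j = ≡.sym (ℤP.*-zeroʳ c)
coeff-scale c (a ∷ p) zero = refl
coeff-scale c (a ∷ p) (suc j) = coeff-scale c p j

coeff-mul : ∀ p q j → coeff (mulP p q) j ≡ ℤt.mul (coeff p) (coeff q) j
coeff-mul [] q j = ≡.sym (ℤt.mul-zero (coeff q) j)
coeff-mul (a ∷ p) q zero = ≡.trans (coeff-add (scaleP a q) _ 0) (≡.trans (ℤP.+-identityʳ _) (coeff-scale a q 0))
coeff-mul (a ∷ p) q (suc j) = ≡.trans (coeff-add (scaleP a q) _ (suc j)) (≡.cong₂ ℤ._+_ (coeff-scale a q (suc j)) (coeff-mul p q j))

-- sh k p = tᵏ p, and rv d p = t^d p(1/t) for p of degree at most d.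
sh rv : ℕ → Pol → Pol
sh zero p j = p j
sh (suc k) p zero = + 0
sh (suc k) p (suc j) = sh k p j
rv d p zero = p d
rv zero p (suc j) = + 0
rv (suc d) p (suc j) = rv d p j

sh-cong : ∀ k {p q : Pol} → p ≗ q → sh k p ≗ sh k q
sh-cong zero e j = e j
sh-cong (suc k) e zero = refl
sh-cong (suc k) e (suc j) = sh-cong k e j

rv-cong : ∀ d {p q : Pol} → p ≗ q → rv d p ≗ rv d q
rv-cong d e zero = e d
rv-cong zero e (suc j) = refl
rv-cong (suc d) e (suc j) = rv-cong d e j

rv-∸ : ∀ d p i → i ≤ d → rv d p (d ∸ i) ≡ p i
rv-∸ d p i i≤d = ≡.trans (go d (d ∸ i) (ℕP.m∸n≤m d i)) (≡.cong p (ℕP.m∸[m∸n]≡n i≤d))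
  where
  go : ∀ d j → j ≤ d → rv d p j ≡ p (d ∸ j)
  go d zero _ = refl
  go (suc d) (suc j) (s≤s le) = go d j le

mono-mul : ∀ k c p j → ℤt.mul (coeff (monoP k c)) p j ≡ c ℤ.* sh k p j
mono-mul zero c p zero = refl
mono-mul zero c p (suc j) = ≡.trans (≡.cong (λ z → c ℤ.* p (suc j) ℤ.+ z) (ℤt.mul-zero p j)) (ℤP.+-identityʳ _)
mono-mul (suc k) c p zero = ≡.sym (ℤP.*-zeroʳ c)
mono-mul (suc k) c p (suc j) = ≡.trans (ℤP.+-identityˡ _) (mono-mul k c p j)

coeff-mono : ∀ k c j → coeff (monoP k c) j ≡ iv (j ≡ᵇ k) c
coeff-mono zero c zero = refl
coeff-mono zero c (suc j) = refl
coeff-mono (suc k) c zero = refl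
coeff-mono (suc k) c (suc j) = coeff-mono k c j

mul-sumL : ∀ {A : Set} (as : List A) (f : A → Pol) p j →
  ℤt.mul (λ i → sumL as (λ a → f a i)) p j ≡ sumL as (λ a → ℤt.mul (f a) p j)
mul-sumL [] f p j = ℤt.mul-zero p j
mul-sumL (a ∷ as) f p j = ≡.trans (ℤt.mul-distribʳ p (f a) _ j) (≡.cong (λ z → ℤt.mul (f a) p j ℤ.+ z) (mul-sumL as f p j))

-- The palindromicity criterion for Kazhdan–Lusztig polynomials

≡ᵇ-true : ∀ a b → (a ≡ᵇ b) ≡ true → a ≡ b
≡ᵇ-true zero zero _ = refl
≡ᵇ-true (suc a) (suc b) e = ≡.cong suc (≡ᵇ-true a b e)

≡ᵇ-refl : ∀ a → (a ≡ᵇ a) ≡ true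
≡ᵇ-refl zero = refl
≡ᵇ-refl (suc a) = ≡ᵇ-refl a

<ᵇ-true : ∀ a b → (a <ᵇ b) ≡ true → a < b
<ᵇ-true zero (suc b) _ = s≤s z≤n
<ᵇ-true (suc a) (suc b) e = s≤s (<ᵇ-true a b e)

<ᵇ-true′ : ∀ {a b} → a < b → (a <ᵇ b) ≡ true
<ᵇ-true′ (s≤s z≤n) = refl
<ᵇ-true′ (s≤s (s≤s p)) = <ᵇ-true′ (s≤s p)

<ᵇ-false : ∀ a b → (a <ᵇ b) ≡ false → b ≤ a
<ᵇ-false a zero _ = z≤n
<ᵇ-false (suc a) (suc b) e = s≤s (<ᵇ-false a b e)

single-true : ∀ {m} (e i : Fin m) → single e i ≡ true → e ≡ i
single-true e i p = FP.toℕ-injective (≡ᵇ-true _ _ p)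

single-self : ∀ {m} (e : Fin m) → single e e ≡ true
single-self e = ≡ᵇ-refl (toℕ e)

∪-true : ∀ {a b} → a ∨ b ≡ true → a ≡ true ⊎ b ≡ true
∪-true {true} _ = inj₁ refl
∪-true {false} e = inj₂ e

∪-l : ∀ {a b} → a ≡ true → a ∨ b ≡ true
∪-l refl = refl

∪-r : ∀ {a b} → b ≡ true → a ∨ b ≡ true
∪-r {true} _ = refl
∪-r {false} e = e

allFin-cong : ∀ {m} {p q : Fin m → Bool} → p ≗ q → all p (allFin m) ≡ all q (allFin m)
allFin-cong e = bool-iff (λ t → all-true′ λ i → ≡.trans (≡.sym (e i)) (all-true t i))
                      (λ t → all-true′ λ i → ≡.trans (e i) (all-true t i))

⊆-cong : ∀ {m} {A A′ B B′ : Subset m} → A ≗ A′ → B ≗ B′ → (A ⊆ᵇ B) ≡ (A′ ⊆ᵇ B′)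
⊆-cong e e′ = allFin-cong λ i → ≡.cong₂ (λ a b → not a ∨ b) (e i) (e′ i)

∸-cancel : ∀ a b c → c ≤ b → (a ∸ c) ∸ (b ∸ c) ≡ a ∸ b
∸-cancel a b c c≤b = ≡.trans (ℕP.∸-+-assoc a c (b ∸ c)) (≡.cong (a ∸_) (ℕP.m+[n∸m]≡n c≤b))

sumL-delta : ∀ N (f : ℕ → ℤ) i → sumL (upTo N) (λ a → iv (i ≡ᵇ a) (f a)) ≡ iv (i <ᵇ N) (f i)
sumL-applyUpTo : ∀ N (h : ℕ → ℕ) (f : ℕ → ℤ) → sumL (applyUpTo h N) f ≡ sumL (upTo N) (f ∘ h)
sumL-applyUpTo N h f = ≡.trans (≡.cong (λ l → sumL l f) (≡.sym (LP.map-upTo h N))) (sumL-map h (upTo N) f)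
sumL-delta zero f i = refl
sumL-delta (suc N) f zero = ≡.trans (≡.cong (λ z → f 0 ℤ.+ z) (≡.trans (sumL-applyUpTo N suc _) (sumL-0 (upTo N)))) (ℤP.+-identityʳ _)
sumL-delta (suc N) f (suc i) = ≡.trans (ℤP.+-identityˡ _) (≡.trans (sumL-applyUpTo N suc _) (sumL-delta N (f ∘ suc) i))

module Criterion (m : ℕ) (rk : Subset m → ℕ) (rk-ext : Ext rk)
  (rk-mono : ∀ {A B} → (∀ i → A i ≡ true → B i ≡ true) → rk A ≤ rk B)
  (P : Subset m → Pol) (P-ext : ∀ {A B} → A ≗ B → P A ≗ P B)
  where

  full : Subset m
  full _ = true

  M : Mat
  M = record { m = m ; gr = full ; rk = rk }

  r : ℕ
  r = rk full

  flat : Subset m → Bool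
  flat = isFlat M

  flat-ext : Ext flat
  flat-ext {A} {B} e = ≡.cong₂ _∧_ (⊆-cong e (λ _ → refl)) (allFin-cong λ i → ≡.cong₂ (λ a b → not (not a) ∨ not b) (e i)
    (≡.cong₂ _≡ᵇ_ (rk-ext (λ j → ≡.cong (_∨ single i j) (e j))) (rk-ext e)))

  flat-true : ∀ {F} → flat F ≡ true → ∀ e → F e ≡ false → rk (F ∪ single e) ≢ rk F
  flat-true {F} p e Fe eq = true≢false (≡.trans (≡.sym lem) (≡.trans (≡.cong not (≡.cong (_≡ᵇ rk F) eq)) (≡.cong not (≡ᵇ-refl (rk F)))))
    where
    lem : not (rk (F ∪ single e) ≡ᵇ rk F) ≡ true
    lem = ⇒-true (all-true (proj₂ (∧-true {F ⊆ᵇ full} p)) e) (≡.cong not Fe)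

  -- gr′ and rk′ are the data of the contraction of M at F₀.
  module Contraction (F₀ : Subset m) (gr′ : Subset m) (rk′ : Subset m → ℕ)
    (gr-eq : ∀ i → gr′ i ≡ not (F₀ i)) (rk-eq : ∀ A → rk′ A ≡ rk (A ∪ F₀) ∸ rk F₀)
    where

    N : Mat
    N = record { m = m ; gr = gr′ ; rk = rk′ }

    F₀≤ : ∀ A → rk F₀ ≤ rk (A ∪ F₀)
    F₀≤ A = rk-mono λ i e → ∪-r {A i} e

    rank-N : rankM N ≡ r ∸ rk F₀
    rank-N = ≡.trans (rk-eq gr′) (≡.cong (_∸ rk F₀) (rk-ext λ i → ≡.trans (≡.cong (_∨ F₀ i) (gr-eq i)) (excluded (F₀ i))))
      where
      excluded : ∀ b → not b ∨ b ≡ true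
      excluded true = refl
      excluded false = refl

    rk-∸ : ∀ F A → rk′ F ∸ rk′ A ≡ rk (F ∪ F₀) ∸ rk (A ∪ F₀)
    rk-∸ F A = ≡.trans (≡.cong₂ _∸_ (rk-eq F) (rk-eq A)) (∸-cancel (rk (F ∪ F₀)) (rk (A ∪ F₀)) (rk F₀) (F₀≤ A))

    flat-N : ∀ F → isFlat N F ≡ (F ⊆ᵇ compl F₀) ∧ flat (F ∪ F₀)
    flat-N F = ≡.cong₂ _∧_ (⊆-cong (λ _ → refl) gr-eq) (≡.sym (≡.trans
        (≡.cong (_∧ all (λ e → not ((full ∖ (F ∪ F₀)) e) ∨ not (rk ((F ∪ F₀) ∪ single e) ≡ᵇ rk (F ∪ F₀))) (allFin m)) (⊆-true′ {A = F ∪ F₀} {full} λ _ _ → refl))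
        (allFin-cong λ e → ≡.cong₂ (λ a b → not a ∨ not b) (outside e) (ranks e))))
      where
      outside : ∀ e → not (F e ∨ F₀ e) ≡ gr′ e ∧ not (F e)
      outside e = ≡.trans (deMorgan (F e) (F₀ e)) (≡.cong (_∧ not (F e)) (≡.sym (gr-eq e)))
        where
        deMorgan : ∀ a b → not (a ∨ b) ≡ not b ∧ not a
        deMorgan true true = refl
        deMorgan true false = refl
        deMorgan false true = refl
        deMorgan false false = refl
      union : ∀ e → (F ∪ F₀) ∪ single e ≗ (F ∪ single e) ∪ F₀
      union e i = ≡.trans (BP.∨-assoc (F i) (F₀ i) _) (≡.trans (≡.cong (F i ∨_) (BP.∨-comm (F₀ i) _)) (≡.sym (BP.∨-assoc (F i) _ (F₀ i))))
      ranks : ∀ e → (rk ((F ∪ F₀) ∪ single e) ≡ᵇ rk (F ∪ F₀)) ≡ (rk′ (F ∪ single e) ≡ᵇ rk′ F)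
      ranks e = bool-iff
        (λ t → ≡.subst (λ k → (rk′ (F ∪ single e) ≡ᵇ k) ≡ true)
          (≡.trans (rk-eq (F ∪ single e)) (≡.trans (≡.cong (_∸ rk F₀) (≡.trans (≡.sym (rk-ext (union e))) (≡ᵇ-true _ _ t))) (≡.sym (rk-eq F))))
          (≡ᵇ-refl (rk′ (F ∪ single e))))
        (λ t → ≡.subst (λ k → (rk ((F ∪ F₀) ∪ single e) ≡ᵇ k) ≡ true)
          (≡.trans (rk-ext (union e)) (ℕP.∸-cancelʳ-≡ (F₀≤ (F ∪ single e)) (F₀≤ F) (≡.trans (≡.sym (rk-eq (F ∪ single e))) (≡.trans (≡ᵇ-true _ _ t) (rk-eq F)))))
          (≡ᵇ-refl (rk ((F ∪ F₀) ∪ single e))))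

    module _ (pal : ∀ A j → Σs m (λ F → iv (flat F ∧ (A ⊆ᵇ F)) (sh (rk F ∸ rk A) (P F) j))
                          ≡ Σs m (λ F → iv (flat F ∧ (A ⊆ᵇ F)) (rv (r ∸ rk F) (P F) j))) where

      ⊆-swap : ∀ A F → (A ⊆ᵇ compl F₀) ≡ true → (F ⊆ᵇ compl F₀) ≡ true → (A ⊆ᵇ F) ≡ ((A ∪ F₀) ⊆ᵇ (F ∪ F₀))
      ⊆-swap A F a f = bool-iff
        (λ t → ⊆-true′ λ i e → case i (∪-true {A i} e) (⊆-true {A = A} t))
        (λ t → ⊆-true′ λ i e → only i e (∪-true {F i} (⊆-true {A = A ∪ F₀} t i (∪-l e))))
        where
        case : ∀ i → A i ≡ true ⊎ F₀ i ≡ true → (∀ i → A i ≡ true → F i ≡ true) → (F ∪ F₀) i ≡ true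
        case i (inj₁ Ai) f = ∪-l (f i Ai)
        case i (inj₂ Fi) f = ∪-r {F i} Fi
        only : ∀ i → A i ≡ true → F i ≡ true ⊎ F₀ i ≡ true → F i ≡ true
        only i Ai (inj₁ Fi) = Fi
        only i Ai (inj₂ F₀i) = ⊥-elim (true≢false (≡.trans (≡.sym (⊆-true {A = A} a i Ai)) (≡.cong not F₀i)))

      ∪-cong : ∀ {A B : Subset m} → A ≗ B → A ∪ F₀ ≗ B ∪ F₀
      ∪-cong e i = ≡.cong (_∨ F₀ i) (e i)

      -- Palindromicity is assumed for `M` only, so sums over flats of the contraction have to be
      -- moved there. Disjointness of `A` from `F₀` makes inclusion in `F` equivalent to inclusion
      -- of the unions with `F₀`.
      to-M : ∀ A (g : Subset m → ℤ) → Ext g → (A ⊆ᵇ compl F₀) ≡ true →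
        Σs m (λ F → iv (isFlat N F) (iv (A ⊆ᵇ F) (g (F ∪ F₀)))) ≡ Σs m (λ F → iv (flat F ∧ ((A ∪ F₀) ⊆ᵇ F)) (g F))
      to-M A g gx a = ≡.trans (Σs-cong m step) (≡.trans (Σs-reindex m F₀ h hx) (Σs-cong m back))
        where
        h : Subset m → ℤ
        h F = iv (flat F ∧ ((A ∪ F₀) ⊆ᵇ F)) (g F)
        hx : Ext h
        hx e = iv-cong (≡.cong₂ _∧_ (flat-ext e) (⊆-cong (λ _ → refl) e)) (λ _ → gx e)
        step : ∀ F → iv (isFlat N F) (iv (A ⊆ᵇ F) (g (F ∪ F₀))) ≡ iv (F ⊆ᵇ compl F₀) (h (F ∪ F₀))
        step F = ≡.trans (≡.cong (λ b → iv b (iv (A ⊆ᵇ F) (g (F ∪ F₀)))) (flat-N F)) (≡.trans (iv-∧ (F ⊆ᵇ compl F₀) (flat (F ∪ F₀)) (iv (A ⊆ᵇ F) (g (F ∪ F₀))))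
          (iv-cong {F ⊆ᵇ compl F₀} refl (λ f → ≡.trans (≡.sym (iv-∧ (flat (F ∪ F₀)) (A ⊆ᵇ F) (g (F ∪ F₀)))) (≡.cong (λ b → iv (flat (F ∪ F₀) ∧ b) (g (F ∪ F₀))) (⊆-swap A F a f)))))
        back : ∀ F → iv (F₀ ⊆ᵇ F) (h F) ≡ h F
        back F = ≡.trans (≡.sym (iv-∧ (F₀ ⊆ᵇ F) (flat F ∧ ((A ∪ F₀) ⊆ᵇ F)) (g F))) (iv-cong (bool-iff (λ t → proj₂ (∧-true {F₀ ⊆ᵇ F} t))
          (λ t → ∧-true′ (⊆-true′ λ i e → ⊆-true {A = A ∪ F₀} (proj₂ (∧-true {flat F} t)) i (∪-r {A i} e)) t)) (λ _ → refl))

      weight : Subset m → Subset m → ℕ → ℤ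
      weight A F j = sh (rk′ F ∸ rk′ A) (P (F ∪ F₀)) j

      rweight : Subset m → ℕ → ℤ
      rweight F j = rv (r ∸ rk (F ∪ F₀)) (P (F ∪ F₀)) j

      swap-A : ∀ A j → Σs m (λ F → iv (isFlat N F) (iv (A ⊆ᵇ F) (weight A F j))) ≡ Σs m (λ F → iv (isFlat N F) (iv (A ⊆ᵇ F) (rweight F j)))
      swap-A A j with bool-cases (A ⊆ᵇ compl F₀)
      ... | inj₁ a = ≡.trans (Σs-cong m λ F → ≡.cong (λ k → iv (isFlat N F) (iv (A ⊆ᵇ F) (sh k (P (F ∪ F₀)) j))) (rk-∸ F A))
          (≡.trans (to-M A (λ F → sh (rk F ∸ rk (A ∪ F₀)) (P F) j) (λ {B} {C} e → ≡.trans (≡.cong (λ k → sh (k ∸ rk (A ∪ F₀)) (P B) j) (rk-ext e)) (sh-cong (rk C ∸ rk (A ∪ F₀)) (P-ext e) j)) a)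
          (≡.trans (pal (A ∪ F₀) j)
          (≡.sym (to-M A (λ F → rv (r ∸ rk F) (P F) j) (λ {B} {C} e → ≡.trans (≡.cong (λ k → rv (r ∸ k) (P B) j) (rk-ext e)) (rv-cong (r ∸ rk C) (P-ext e) j)) a))))
      -- If `A` meets `F₀`, no flat of the contraction contains it, and both sums are empty.
      ... | inj₂ a = Σs-cong m λ F → ≡.trans (≡.cong (λ b → iv b (iv (A ⊆ᵇ F) (weight A F j))) (flat-N F))
          (≡.trans (vanish F (weight A F j)) (≡.sym (≡.trans (≡.cong (λ b → iv b (iv (A ⊆ᵇ F) (rweight F j))) (flat-N F)) (vanish F (rweight F j)))))
        where
        vanish : ∀ F z → iv ((F ⊆ᵇ compl F₀) ∧ flat (F ∪ F₀)) (iv (A ⊆ᵇ F) z) ≡ + 0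
        vanish F z = ≡.trans (≡.sym (iv-∧ ((F ⊆ᵇ compl F₀) ∧ flat (F ∪ F₀)) (A ⊆ᵇ F) z)) (≡.cong (λ b → iv b z)
          (≢true λ t → true≢false (≡.trans (≡.sym (⊆-true′ {A = A} λ i Ai → ⊆-true {A = F} (proj₁ (∧-true (proj₁ (∧-true {(F ⊆ᵇ compl F₀) ∧ flat (F ∪ F₀)} t)))) i
            (⊆-true {A = A} (proj₂ (∧-true {(F ⊆ᵇ compl F₀) ∧ flat (F ∪ F₀)} t)) i Ai))) a)))

      term : Subset m → ℕ → ℤ
      term F j = Σs m (λ A → iv (A ⊆ᵇ F) (sign (card A) ℤ.* weight A F j))

      -- Σ_F χ_{N_F} P_F = t^d P(1/t) with d the rank of N.
      total : flat F₀ ≡ true → ∀ j → Σs m (λ F → iv (isFlat N F) (term F j)) ≡ rv (r ∸ rk F₀) (P F₀) j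
      total fl j = begin
        Σs m (λ F → iv (isFlat N F) (term F j))
          ≡⟨ Σs-cong m (λ F → ≡.sym (sumL-iv (allSubsets m) (isFlat N F) _)) ⟩
        Σs m (λ F → Σs m (λ A → iv (isFlat N F) (iv (A ⊆ᵇ F) (sign (card A) ℤ.* weight A F j))))
          ≡⟨ sumL-swap (allSubsets m) (allSubsets m) _ ⟩
        Σs m (λ A → Σs m (λ F → iv (isFlat N F) (iv (A ⊆ᵇ F) (sign (card A) ℤ.* weight A F j))))
          ≡⟨ Σs-cong m (λ A → pull A (λ F → weight A F j)) ⟩
        Σs m (λ A → sign (card A) ℤ.* Σs m (λ F → iv (isFlat N F) (iv (A ⊆ᵇ F) (weight A F j))))
          ≡⟨ Σs-cong m (λ A → ≡.cong (sign (card A) ℤ.*_) (swap-A A j)) ⟩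
        Σs m (λ A → sign (card A) ℤ.* Σs m (λ F → iv (isFlat N F) (iv (A ⊆ᵇ F) (rweight F j))))
          ≡⟨ Σs-cong m (λ A → ≡.sym (pull A (λ F → rweight F j))) ⟩
        Σs m (λ A → Σs m (λ F → iv (isFlat N F) (iv (A ⊆ᵇ F) (sign (card A) ℤ.* rweight F j))))
          ≡⟨ sumL-swap (allSubsets m) (allSubsets m) _ ⟩
        Σs m (λ F → Σs m (λ A → iv (isFlat N F) (iv (A ⊆ᵇ F) (sign (card A) ℤ.* rweight F j))))
          ≡⟨ Σs-cong m collapse ⟩
        Σs m (λ F → iv (not (nonempty F)) (iv (isFlat N F) (rweight F j)))
          ≡⟨ Σs-∅ m _ gx ⟩
        iv (isFlat N ∅) (rweight ∅ j)
          ≡⟨ ≡.cong (λ b → iv b (rweight ∅ j)) (≡.trans (flat-N ∅) (∧-true′ (⊆-true′ {A = ∅} {compl F₀} λ _ ()) fl)) ⟩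
        rv (r ∸ rk F₀) (P F₀) j ∎
        where
        open ≡.≡-Reasoning
        pull : ∀ A (g : Subset m → ℤ) → Σs m (λ F → iv (isFlat N F) (iv (A ⊆ᵇ F) (sign (card A) ℤ.* g F)))
          ≡ sign (card A) ℤ.* Σs m (λ F → iv (isFlat N F) (iv (A ⊆ᵇ F) (g F)))
        pull A g = ≡.trans (Σs-cong m λ F → ≡.sym (≡.trans (iv-* (isFlat N F) (sign (card A)) (iv (A ⊆ᵇ F) (g F))) (≡.cong (iv (isFlat N F)) (iv-* (A ⊆ᵇ F) (sign (card A)) (g F)))))
          (sumL-* (allSubsets m) (sign (card A)) _)
        collapse : ∀ F → Σs m (λ A → iv (isFlat N F) (iv (A ⊆ᵇ F) (sign (card A) ℤ.* rweight F j))) ≡ iv (not (nonempty F)) (iv (isFlat N F) (rweight F j))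
        collapse F = ≡.trans (sumL-iv (allSubsets m) (isFlat N F) _) (≡.trans (≡.cong (iv (isFlat N F)) inner) (iv-swap (isFlat N F) (not (nonempty F)) (rweight F j)))
          where
          inner : Σs m (λ A → iv (A ⊆ᵇ F) (sign (card A) ℤ.* rweight F j)) ≡ iv (not (nonempty F)) (rweight F j)
          inner = ≡.trans (Σs-cong m λ A → ≡.trans (≡.cong (iv (A ⊆ᵇ F)) (ℤP.*-comm (sign (card A)) (rweight F j))) (≡.sym (iv-* (A ⊆ᵇ F) (rweight F j) (sign (card A)))))
            (≡.trans (sumL-* (allSubsets m) (rweight F j) _) (≡.trans (≡.cong (rweight F j ℤ.*_) (Σs-sign m F))
            (≡.trans (iv-* (not (nonempty F)) (rweight F j) (+ 1)) (≡.cong (iv (not (nonempty F))) (ℤP.*-identityʳ (rweight F j))))))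
        gx : Ext (λ F → iv (isFlat N F) (rweight F j))
        gx {B} {C} e = ≡.cong₂ iv (≡.trans (flat-N B) (≡.trans (≡.cong₂ _∧_ (⊆-cong e (λ _ → refl)) (flat-ext (∪-cong e))) (≡.sym (flat-N C))))
          (≡.trans (≡.cong (λ k → rv (r ∸ k) (P (B ∪ F₀)) j) (rk-ext (∪-cong e))) (rv-cong (r ∸ rk (C ∪ F₀)) (P-ext (∪-cong e)) j))

      term-∅ : ∀ F j → nonempty F ≡ false → term F j ≡ P (F ∪ F₀) j
      term-∅ F j e = begin
        term F j
          ≡⟨ Σs-cong m (λ A → iv-cong {A ⊆ᵇ F} refl (λ a → ≡.cong (sign (card A) ℤ.*_) (≡.cong (λ k → sh k (P (F ∪ F₀)) j) (diff A a)))) ⟩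
        Σs m (λ A → iv (A ⊆ᵇ F) (sign (card A) ℤ.* P (F ∪ F₀) j))
          ≡⟨ Σs-cong m (λ A → ≡.trans (≡.cong (iv (A ⊆ᵇ F)) (ℤP.*-comm (sign (card A)) _)) (≡.sym (iv-* (A ⊆ᵇ F) (P (F ∪ F₀) j) (sign (card A))))) ⟩
        Σs m (λ A → P (F ∪ F₀) j ℤ.* iv (A ⊆ᵇ F) (sign (card A)))
          ≡⟨ sumL-* (allSubsets m) (P (F ∪ F₀) j) _ ⟩
        P (F ∪ F₀) j ℤ.* Σs m (λ A → iv (A ⊆ᵇ F) (sign (card A)))
          ≡⟨ ≡.cong (P (F ∪ F₀) j ℤ.*_) (≡.trans (Σs-sign m F) (≡.cong (λ b → iv (not b) (+ 1)) e)) ⟩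
        P (F ∪ F₀) j ℤ.* + 1 ≡⟨ ℤP.*-identityʳ _ ⟩
        P (F ∪ F₀) j ∎
        where
        open ≡.≡-Reasoning
        diff : ∀ A → (A ⊆ᵇ F) ≡ true → rk′ F ∸ rk′ A ≡ 0
        diff A a = ≡.trans (rk-∸ F A) (ℕP.m≤n⇒m∸n≡0 (rk-mono λ i t → pick i (∪-true {F i} t)))
          where
          pick : ∀ i → F i ≡ true ⊎ F₀ i ≡ true → (A ∪ F₀) i ≡ true
          pick i (inj₁ Fi) = ⊥-elim (true≢false (≡.trans (≡.sym Fi) (empty {A = F} e i)))
          pick i (inj₂ F₀i) = ∪-r {A i} F₀i

      -- The recursion of `KLfuel` omits the empty flat, whose term is `P F₀` itself. This is the
      -- identity `Q(t) + P(t) = t^d P(1/t)`, with `d` the corank of `F₀`.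
      nonempty-total : flat F₀ ≡ true → ∀ j →
        Σs m (λ F → iv (isFlat N F) (iv (nonempty F) (term F j))) ℤ.+ P F₀ j ≡ rv (r ∸ rk F₀) (P F₀) j
      nonempty-total fl j = begin
        Σs m (λ F → iv (isFlat N F) (iv (nonempty F) (term F j))) ℤ.+ P F₀ j
          ≡⟨ ≡.cong (λ z → Σs m (λ F → iv (isFlat N F) (iv (nonempty F) (term F j))) ℤ.+ z) (≡.sym at-∅) ⟩
        Σs m (λ F → iv (isFlat N F) (iv (nonempty F) (term F j))) ℤ.+ Σs m (λ F → iv (not (nonempty F)) (g F))
          ≡⟨ sumL-+ (allSubsets m) _ _ ⟨
        Σs m (λ F → iv (isFlat N F) (iv (nonempty F) (term F j)) ℤ.+ iv (not (nonempty F)) (g F))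
          ≡⟨ Σs-cong m split ⟩
        Σs m (λ F → iv (isFlat N F) (term F j)) ≡⟨ total fl j ⟩
        rv (r ∸ rk F₀) (P F₀) j ∎
        where
        open ≡.≡-Reasoning
        g : Subset m → ℤ
        g F = iv (isFlat N F) (P (F ∪ F₀) j)
        gx : Ext g
        gx {B} {C} e = ≡.cong₂ iv (≡.trans (flat-N B) (≡.trans (≡.cong₂ _∧_ (⊆-cong e (λ _ → refl)) (flat-ext (∪-cong e))) (≡.sym (flat-N C))))
          (P-ext (∪-cong e) j)
        at-∅ : Σs m (λ F → iv (not (nonempty F)) (g F)) ≡ P F₀ j
        at-∅ = ≡.trans (Σs-∅ m g gx) (≡.cong (λ b → iv b (P F₀ j)) (≡.trans (flat-N ∅) (∧-true′ (⊆-true′ {A = ∅} {compl F₀} λ _ ()) fl)))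
        split : ∀ F → iv (isFlat N F) (iv (nonempty F) (term F j)) ℤ.+ iv (not (nonempty F)) (g F) ≡ iv (isFlat N F) (term F j)
        split F with nonempty F in eq
        ... | true = ℤP.+-identityʳ _
        ... | false = ≡.trans (≡.cong (λ z → z ℤ.+ g F) (iv-0 (isFlat N F))) (≡.trans (ℤP.+-identityˡ _) (≡.cong (iv (isFlat N F)) (≡.sym (term-∅ F j eq))))

      char-mul : ∀ F (p : Pol) j → (∀ i → p i ≡ P (F ∪ F₀) i) → ℤt.mul (coeff (charPoly (restrict N F))) p j ≡ term F j
      char-mul F p j e = begin
        ℤt.mul (coeff (charPoly (restrict N F))) p j
          ≡⟨ ℤt.mul-cong (coeff-sum (subsetsOf (restrict N F)) mono) e j ⟩
        ℤt.mul (λ i → sumL (subsetsOf (restrict N F)) (λ A → coeff (mono A) i)) (P (F ∪ F₀)) j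
          ≡⟨ mul-sumL (subsetsOf (restrict N F)) (λ A → coeff (mono A)) (P (F ∪ F₀)) j ⟩
        sumL (subsetsOf (restrict N F)) (λ A → ℤt.mul (coeff (mono A)) (P (F ∪ F₀)) j)
          ≡⟨ sumL-cong (subsetsOf (restrict N F)) (λ A → mono-mul (rk′ F ∸ rk′ A) (sign (card A)) (P (F ∪ F₀)) j) ⟩
        sumL (subsetsOf (restrict N F)) (λ A → sign (card A) ℤ.* weight A F j)
          ≡⟨ sumL-filter (λ A → A ⊆ᵇ F) (allSubsets m) _ ⟩
        term F j ∎
        where
        open ≡.≡-Reasoning
        mono : Subset m → Poly
        mono A = monoP (rk′ F ∸ rk′ A) (sign (card A))

  -- The corank drops along the recursion, so it can be compared with the fuel.
  ∪-flat-< : ∀ {F₀ F} → flat F₀ ≡ true → (F ⊆ᵇ compl F₀) ≡ true → nonempty F ≡ true → rk F₀ < rk (F ∪ F₀)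
  ∪-flat-< {F₀} {F} fl disj ne with any-true ne
  ... | e , Fe = ℕP.<-≤-trans (ℕP.≤∧≢⇒< (rk-mono λ i → ∪-l) (λ eq → flat-true fl e F₀e (≡.sym eq))) (rk-mono λ i t → pick i (∪-true {F₀ i} t))
    where
    F₀e : F₀ e ≡ false
    F₀e = not-true (⊆-true {A = F} disj e Fe)
    pick : ∀ i → F₀ i ≡ true ⊎ single e i ≡ true → (F ∪ F₀) i ≡ true
    pick i (inj₁ t) = ∪-r {F i} t
    pick i (inj₂ t) with single-true e i t
    ... | refl = ∪-l Fe

  module Palindromic
    (pal : ∀ A j → Σs m (λ F → iv (flat F ∧ (A ⊆ᵇ F)) (sh (rk F ∸ rk A) (P F) j))
                 ≡ Σs m (λ F → iv (flat F ∧ (A ⊆ᵇ F)) (rv (r ∸ rk F) (P F) j)))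
    (P-top : ∀ {F} → flat F ≡ true → r ≤ rk F → ∀ i → P F i ≡ coeff (+ 1 ∷ []) i)
    (P-deg : ∀ {F} → flat F ≡ true → rk F < r → ∀ i → r ∸ rk F ≤ i ℕ.+ i → P F i ≡ + 0)
    where

    -- Induction on the fuel, which has to cover the corank; fuel 0 thus means corank 0, where the
    -- default 1 is correct. Ground set and rank function are described only pointwise, because an
    -- iterated contraction does not compute to the contraction at the union.
    KL-eq : ∀ k F₀ gr′ rk′ → flat F₀ ≡ true → (∀ i → gr′ i ≡ not (F₀ i)) → (∀ A → rk′ A ≡ rk (A ∪ F₀) ∸ rk F₀) →
      r ∸ rk F₀ ≤ k → ∀ i → coeff (KLfuel k (record { m = m ; gr = gr′ ; rk = rk′ })) i ≡ P F₀ i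
    KL-eq zero F₀ gr′ rk′ fl ge re le i = ≡.sym (P-top fl (ℕP.m∸n≡0⇒m≤n (ℕP.n≤0⇒n≡0 le)) i)
    KL-eq (suc k) F₀ gr′ rk′ fl ge re le i with rk′ gr′ in eq
    ... | zero = ≡.sym (P-top fl (ℕP.m∸n≡0⇒m≤n (≡.trans (≡.sym (Contraction.rank-N F₀ gr′ rk′ ge re)) eq)) i)
    ... | suc r′ = begin
        coeff (sumP (map (λ a → monoP a (coeff Q (suc r′ ∸ a))) (filterᵇ (λ a → (a ℕ.+ a) <ᵇ suc r′) (upTo (suc r′))))) i
          ≡⟨ coeff-sum (filterᵇ (λ a → (a ℕ.+ a) <ᵇ suc r′) (upTo (suc r′))) (λ a → monoP a (coeff Q (suc r′ ∸ a))) i ⟩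
        sumL (filterᵇ (λ a → (a ℕ.+ a) <ᵇ suc r′) (upTo (suc r′))) (λ a → coeff (monoP a (coeff Q (suc r′ ∸ a))) i)
          ≡⟨ sumL-filter (λ a → (a ℕ.+ a) <ᵇ suc r′) (upTo (suc r′)) (λ a → coeff (monoP a (coeff Q (suc r′ ∸ a))) i) ⟩
        sumL (upTo (suc r′)) (λ a → iv ((a ℕ.+ a) <ᵇ suc r′) (coeff (monoP a (coeff Q (suc r′ ∸ a))) i))
          ≡⟨ sumL-cong (upTo (suc r′)) (λ a → ≡.trans (≡.cong (iv ((a ℕ.+ a) <ᵇ suc r′)) (coeff-mono a _ i)) (iv-swap ((a ℕ.+ a) <ᵇ suc r′) (i ≡ᵇ a) _)) ⟩
        sumL (upTo (suc r′)) (λ a → iv (i ≡ᵇ a) (iv ((a ℕ.+ a) <ᵇ suc r′) (coeff Q (suc r′ ∸ a))))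
          ≡⟨ sumL-delta (suc r′) _ i ⟩
        iv (i <ᵇ suc r′) (iv ((i ℕ.+ i) <ᵇ suc r′) (coeff Q (suc r′ ∸ i)))
          ≡⟨ final ⟩
        P F₀ i ∎
      where
      open ≡.≡-Reasoning
      open Contraction F₀ gr′ rk′ ge re
      Q : Poly
      Q = sumP (map (λ F → mulP (charPoly (restrict N F)) (KLfuel k (contract N F))) (filterᵇ nonempty (flats N)))
      r-eq : r ∸ rk F₀ ≡ suc r′
      r-eq = ≡.trans (≡.sym rank-N) eq
      summand : ∀ F j → isFlat N F ≡ true → nonempty F ≡ true →
        coeff (mulP (charPoly (restrict N F)) (KLfuel k (contract N F))) j ≡ term pal F j
      summand F j fF ne = ≡.trans (coeff-mul (charPoly (restrict N F)) (KLfuel k (contract N F)) j) (char-mul pal F _ j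
        (KL-eq k (F ∪ F₀) (gr′ ∖ F) (λ A → rk′ (A ∪ F) ∸ rk′ F) (proj₂ both)
          (λ e → ≡.trans (≡.cong (_∧ not (F e)) (ge e)) (deMorgan (F e) (F₀ e)))
          (λ A → ≡.trans (rk-∸ (A ∪ F) F) (≡.cong (_∸ rk (F ∪ F₀)) (rk-ext λ e → BP.∨-assoc (A e) (F e) (F₀ e))))
          (ℕP.≤-pred (ℕP.≤-trans (ℕP.∸-monoʳ-< (∪-flat-< fl (proj₁ both) ne) (rk-mono λ _ _ → refl)) le))))
        where
        both : (F ⊆ᵇ compl F₀) ≡ true × flat (F ∪ F₀) ≡ true
        both = ∧-true (≡.trans (≡.sym (flat-N F)) fF)
        deMorgan : ∀ a b → not b ∧ not a ≡ not (a ∨ b)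
        deMorgan true true = refl
        deMorgan true false = refl
        deMorgan false true = refl
        deMorgan false false = refl
      Q-coeff : ∀ j → coeff Q j ≡ Σs m (λ F → iv (isFlat N F) (iv (nonempty F) (term pal F j)))
      Q-coeff j = ≡.trans (coeff-sum (filterᵇ nonempty (flats N)) _ j) (≡.trans (sumL-filter nonempty (flats N) _)
        (≡.trans (sumL-filter (isFlat N) (allSubsets m) _)
        (Σs-cong m λ F → iv-cong {isFlat N F} refl λ f → iv-cong {nonempty F} refl λ ne → summand F j f ne)))
      Q-total : ∀ j → coeff Q j ℤ.+ P F₀ j ≡ rv (suc r′) (P F₀) j
      Q-total j = ≡.trans (≡.cong (λ z → z ℤ.+ P F₀ j) (Q-coeff j)) (≡.trans (nonempty-total pal fl j) (≡.cong (λ k → rv k (P F₀) j) r-eq))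
      F₀<r : rk F₀ < r
      F₀<r = ℕP.m∸n≢0⇒n<m λ z → ℕP.1+n≢0 (≡.trans (≡.sym r-eq) z)
      final : iv (i <ᵇ suc r′) (iv ((i ℕ.+ i) <ᵇ suc r′) (coeff Q (suc r′ ∸ i))) ≡ P F₀ i
      final with (i ℕ.+ i) <ᵇ suc r′ in lt
      ... | false = ≡.trans (iv-0 (i <ᵇ suc r′)) (≡.sym (P-deg fl F₀<r i (≡.subst (_≤ i ℕ.+ i) (≡.sym r-eq) (<ᵇ-false (i ℕ.+ i) (suc r′) lt))))
      -- Let `d` be `suc r′`. From `2i < d` follows `2(d - i) ≥ d`, so `P F₀` has no coefficient at
      -- `d - i`. Adding this zero completes `Q` to the reversal of `P F₀`, whose coefficient at
      -- `d - i` is the one of `P F₀` at `i`.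
      ... | true = ≡.trans (≡.cong (λ b → iv b (coeff Q (suc r′ ∸ i))) (<ᵇ-true′ i<r)) (≡.trans
          (≡.sym (ℤP.+-identityʳ _)) (≡.trans (≡.cong (λ z → coeff Q (suc r′ ∸ i) ℤ.+ z) (≡.sym (P-deg fl F₀<r (suc r′ ∸ i) high)))
          (≡.trans (Q-total (suc r′ ∸ i)) (rv-∸ (suc r′) (P F₀) i (ℕP.<⇒≤ i<r)))))
        where
        2i<r : i ℕ.+ i < suc r′
        2i<r = <ᵇ-true (i ℕ.+ i) (suc r′) lt
        i<r : i < suc r′
        i<r = ℕP.≤-<-trans (ℕP.m≤m+n i i) 2i<r
        i≤ : i ≤ suc r′ ∸ i
        i≤ = ≡.subst (_≤ suc r′ ∸ i) (ℕP.m+n∸n≡m i i) (ℕP.∸-monoˡ-≤ i (ℕP.<⇒≤ 2i<r))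
        high : r ∸ rk F₀ ≤ (suc r′ ∸ i) ℕ.+ (suc r′ ∸ i)
        high = ≡.subst (_≤ (suc r′ ∸ i) ℕ.+ (suc r′ ∸ i)) (≡.trans (ℕP.m∸n+n≡m (ℕP.<⇒≤ i<r)) (≡.sym r-eq)) (ℕP.+-monoʳ-≤ (suc r′ ∸ i) i≤)

    Zpoly-eq : r ≤ suc m → ∀ j → coeff (Zpoly M) j ≡ Σs m (λ F → iv (flat F) (sh (rk F) (P F) j))
    Zpoly-eq r≤ j = ≡.trans (coeff-sum (flats M) _ j) (≡.trans (sumL-filter flat (allSubsets m) _)
      (Σs-cong m λ F → iv-cong {flat F} refl λ fl → ≡.trans (coeff-mul (monoP (rk F) (+ 1)) (KL (contract M F)) j)
        (≡.trans (ℤt.mul-cong {f = coeff (monoP (rk F) (+ 1))} (λ _ → refl)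
          (KL-eq (suc m) F (full ∖ F) (λ A → rk (A ∪ F) ∸ rk F) fl (λ _ → refl) (λ _ → refl) (ℕP.≤-trans (ℕP.m∸n≤m r (rk F)) r≤)) j)
        (≡.trans (mono-mul (rk F) (+ 1) (P F) j) (ℤP.*-identityˡ _)))))

-- Sums over cyclic words

data Letter : Set where
  hub end mid : Letter

-- A set of edges of the wheel is the cyclic word whose i-th entry tells whether it contains
-- the spoke at rim vertex i and the rim edge from i to i + 1.
Bits : Set
Bits = Bool × Bool

letter : Bits → Letter
letter (true , _) = hub
letter (false , false) = end
letter (false , true) = mid

letters : List Bits → List Letter
letters = map letter

-- Throughout, `σ` is the spoke bit of whatever follows the word: its own first bit when the word is
-- read cyclically, `true` when a hub comes next.
hd : Bool → List Bits → Bool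
hd σ [] = σ
hd σ ((s , _) ∷ _) = s

-- The triangle on rim vertices i, i + 1 does not meet the set in exactly two edges.
ok3 : Bits → Bool → Bool
ok3 (true , true) c = c
ok3 (true , false) c = not c
ok3 (false , true) c = not c
ok3 (false , false) c = true

loc : Bool → List Bits → Bool
loc σ [] = true
loc σ (y ∷ w) = ok3 y (hd σ w) ∧ loc σ w

leq : Bits → Bits → Bool
leq (a , b) (s , r) = (not a ∨ s) ∧ (not b ∨ r)

sub : List Bits → List Bits → Bool
sub [] [] = true
sub (x ∷ v) (y ∷ w) = leq x y ∧ sub v w
sub _ _ = false

-- Locality of the upper word and inclusion of the lower one, interleaved so that sums over upper
-- words reduce letter by letter; `adm-loc` takes the two conditions apart.
adm : Bool → List Bits → List Bits → Bool
adm σ [] [] = true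
adm σ (x ∷ v) (y ∷ w) = leq x y ∧ (ok3 y (hd σ w) ∧ adm σ v w)
adm σ _ _ = false

-- On a local word, a block avoiding the centre has exactly one last vertex, which is marked by the
-- bits counted here. The full rim is the only block without one, hence the correction in `crk#`.
ends# : List Bits → ℕ
ends# [] = 0
ends# ((false , false) ∷ w) = suc (ends# w)
ends# (_ ∷ w) = ends# w

merged-step : Bits → Bits → ℕ
merged-step (false , false) (false , false) = 0
merged-step (false , false) _ = 1
merged-step _ _ = 0

-- The number of blocks of v that are no longer blocks of w.
merged : List Bits → List Bits → ℕ
merged [] _ = 0
merged (_ ∷ _) [] = 0
merged (x ∷ v) (y ∷ w) = merged-step x y ℕ.+ merged v w

-- The part of locality that the scans ask of the lower word. Being weaker than `loc`, it holds for
-- a hub-free word even when a hub of the upper word follows it (`nohub-good`).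
Good : Bool → List Bits → Set
Good σ [] = ⊤
Good σ ((true , true) ∷ v) = hd σ v ≡ true × Good σ v
Good σ (_ ∷ v) = Good σ v

allmid : List Bits → Bool
allmid [] = true
allmid ((false , true) ∷ w) = allmid w
allmid (_ ∷ w) = false

nohub : List Bits → Bool
nohub [] = true
nohub ((s , _) ∷ w) = not s ∧ nohub w

hd-++ : ∀ σ v w → hd σ (v ++ w) ≡ hd (hd σ w) v
hd-++ σ [] w = refl
hd-++ σ (_ ∷ v) w = refl

loc-++ : ∀ σ v w → loc σ (v ++ w) ≡ loc (hd σ w) v ∧ loc σ w
loc-++ σ [] w = refl
loc-++ σ (y ∷ v) w = ≡.trans (≡.cong₂ _∧_ (≡.cong (ok3 y) (hd-++ σ v w)) (loc-++ σ v w)) (≡.sym (BP.∧-assoc (ok3 y (hd (hd σ w) v)) _ _))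

adm-++ : ∀ σ v g w h → length v ≡ length g → adm σ (v ++ w) (g ++ h) ≡ adm (hd σ h) v g ∧ adm σ w h
adm-++ σ [] [] w h _ = refl
adm-++ σ (x ∷ v) (y ∷ g) w h l = ≡.trans
  (≡.cong (leq x y ∧_) (≡.trans (≡.cong₂ _∧_ (≡.cong (ok3 y) (hd-++ σ g h)) (adm-++ σ v g w h (ℕP.suc-injective l))) (≡.sym (BP.∧-assoc (ok3 y (hd (hd σ h) g)) _ _))))
  (≡.sym (BP.∧-assoc (leq x y) _ _))

merged-++ : ∀ v g w h → length v ≡ length g → merged (v ++ w) (g ++ h) ≡ merged v g ℕ.+ merged w h
merged-++ [] [] w h _ = refl
merged-++ (x ∷ v) (y ∷ g) w h l = ≡.trans (≡.cong (merged-step x y ℕ.+_) (merged-++ v g w h (ℕP.suc-injective l)))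
  (≡.sym (ℕP.+-assoc (merged-step x y) _ _))

adm-loc : ∀ σ v w → adm σ v w ≡ loc σ w ∧ sub v w
adm-loc σ [] [] = refl
adm-loc σ [] (y ∷ w) = ≡.sym (BP.∧-zeroʳ _)
adm-loc σ (x ∷ v) [] = refl
adm-loc σ (x ∷ v) (y ∷ w) = ≡.trans (≡.cong (λ b → leq x y ∧ (ok3 y (hd σ w) ∧ b)) (adm-loc σ v w)) (rearrange (leq x y) (ok3 y (hd σ w)) (loc σ w) (sub v w))
  where
  rearrange : ∀ a b c d → a ∧ (b ∧ (c ∧ d)) ≡ (b ∧ c) ∧ (a ∧ d)
  rearrange true b c d = ≡.sym (BP.∧-assoc b c d)
  rearrange false b c d = ≡.sym (BP.∧-zeroʳ (b ∧ c))

loc-good : ∀ σ w → loc σ w ≡ true → Good σ w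
loc-good σ [] e = tt
loc-good σ ((true , true) ∷ w) e = ∧-true e .proj₁ , loc-good σ w (∧-true {hd σ w} e .proj₂)
loc-good σ ((true , false) ∷ w) e = loc-good σ w (∧-true {not (hd σ w)} e .proj₂)
loc-good σ ((false , true) ∷ w) e = loc-good σ w (∧-true {not (hd σ w)} e .proj₂)
loc-good σ ((false , false) ∷ w) e = loc-good σ w e

nohub-good : ∀ σ w → nohub w ≡ true → Good σ w
nohub-good σ [] e = tt
nohub-good σ ((false , true) ∷ w) e = nohub-good σ w e
nohub-good σ ((false , false) ∷ w) e = nohub-good σ w e

ends-merged : ∀ v w → sub v w ≡ true → merged v w ℕ.+ ends# w ≡ ends# v
ends-merged [] [] e = refl
ends-merged ((true , true) ∷ v) ((true , true) ∷ w) e = ends-merged v w e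
ends-merged ((true , false) ∷ v) ((true , true) ∷ w) e = ends-merged v w e
ends-merged ((true , false) ∷ v) ((true , false) ∷ w) e = ends-merged v w e
ends-merged ((false , true) ∷ v) ((true , true) ∷ w) e = ends-merged v w e
ends-merged ((false , true) ∷ v) ((false , true) ∷ w) e = ends-merged v w e
ends-merged ((false , false) ∷ v) ((true , true) ∷ w) e = ≡.cong suc (ends-merged v w e)
ends-merged ((false , false) ∷ v) ((true , false) ∷ w) e = ≡.cong suc (ends-merged v w e)
ends-merged ((false , false) ∷ v) ((false , true) ∷ w) e = ≡.cong suc (ends-merged v w e)
ends-merged ((false , false) ∷ v) ((false , false) ∷ w) e = ≡.trans (ℕP.+-suc (merged v w) _) (≡.cong suc (ends-merged v w e))

ends-of : List Letter → ℕ
ends-of [] = 0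
ends-of (end ∷ w) = suc (ends-of w)
ends-of (_ ∷ w) = ends-of w

ends-letters : ∀ w → ends-of (letters w) ≡ ends# w
ends-letters [] = refl
ends-letters ((true , true) ∷ w) = ends-letters w
ends-letters ((true , false) ∷ w) = ends-letters w
ends-letters ((false , true) ∷ w) = ends-letters w
ends-letters ((false , false) ∷ w) = ≡.cong suc (ends-letters w)

ends-++ : ∀ v w → ends# (v ++ w) ≡ ends# v ℕ.+ ends# w
ends-++ [] w = refl
ends-++ ((true , true) ∷ v) w = ends-++ v w
ends-++ ((true , false) ∷ v) w = ends-++ v w
ends-++ ((false , true) ∷ v) w = ends-++ v w
ends-++ ((false , false) ∷ v) w = ≡.cong suc (ends-++ v w)

data Hubs : List Bits → Set where
  none : ∀ {w} → nohub w ≡ true → Hubs w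
  some : ∀ v b w → Hubs (v ++ (true , b) ∷ w)

hubs? : ∀ w → Hubs w
hubs? [] = none refl
hubs? ((true , b) ∷ w) = some [] b w
hubs? ((false , b) ∷ w) with hubs? w
... | none e = none e
... | some v b′ w′ = some ((false , b) ∷ v) b′ w′

nohub-some : ∀ v b w → nohub (v ++ (true , b) ∷ w) ≡ false
nohub-some [] b w = refl
nohub-some ((true , _) ∷ v) b w = refl
nohub-some ((false , _) ∷ v) b w = nohub-some v b w

allmid-nohub : ∀ w → allmid w ≡ true → nohub w ≡ true
allmid-nohub [] _ = refl
allmid-nohub ((false , true) ∷ w) e = allmid-nohub w e

nohub-allmid : ∀ w → nohub w ≡ true → ends# w ≡ 0 → allmid w ≡ true
nohub-allmid [] _ _ = refl
nohub-allmid ((false , true) ∷ w) n e = nohub-allmid w n e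

ends-allmid : ∀ w → allmid w ≡ true → ends# w ≡ 0
ends-allmid [] _ = refl
ends-allmid ((false , true) ∷ w) e = ends-allmid w e

nohub-ends : ∀ w {k} → ends# w ≡ suc k → allmid w ≡ false
nohub-ends w e with allmid w in am
... | true = ⊥-elim (ℕP.1+n≢0 (≡.trans (≡.sym e) (ends-allmid w am)))
... | false = refl

#ᵇ : Bool → ℕ
#ᵇ true = 1
#ᵇ false = 0

-- The corank of the flat: its number of blocks not containing the centre.
crk# : List Bits → ℕ
crk# w = ends# w ℕ.+ #ᵇ (allmid w)

hd-allmid : ∀ w → allmid w ≡ true → hd false w ≡ false
hd-allmid [] _ = refl
hd-allmid ((false , true) ∷ w) _ = refl

crk-allmid : ∀ w → allmid w ≡ true → crk# w ≡ 1
crk-allmid w e = ≡.cong₂ (λ n b → n ℕ.+ #ᵇ b) (ends-allmid w e) e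

module WordSums (K : Ring₀) (φ : ℤ⟶ K) (t : CommutativeRing.Carrier K) (fan wheelP : ℕ → CommutativeRing.Carrier K)
  (fan-0 : CommutativeRing._≈_ K (fan 0) (CommutativeRing.1# K))
  where

  open CommutativeRing K renaming (refl to ≈-refl; sym to ≈-sym; trans to ≈-trans)
  open Solver K φ
  open SetoidReasoning setoid

  -- Sums over the flats above a flat read as a word; scanH and scanN collect the flats whose first letter
  -- is, respectively is not, a hub, where k is the number of blocks already closed in the current arc.
  module Scan (h₀ : Carrier) (n₀ : ℕ → Carrier) where
    scanH : List Letter → Carrier
    scanN : List Letter → ℕ → Carrier
    scanH [] = h₀
    scanH (hub ∷ w) = scanH w + scanN w 0
    scanH (end ∷ w) = t * (scanH w + scanN w 0)
    scanH (mid ∷ w) = scanH w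
    scanN [] k = n₀ k
    scanN (hub ∷ w) k = 0#
    scanN (end ∷ w) k = fan (suc k) * scanH w + scanN w (suc k) + t * scanN w k
    scanN (mid ∷ w) k = scanN w k

    -- Letters `mid` do not affect the scans, so a hub-free stretch matters only through its number
    -- of ends (`scan-nohub`). The recursion in that number is later solved by generating series.
    scan-ends : ∀ (h : ℕ → Carrier) (n : ℕ → ℕ → Carrier) → h 0 ≈ h₀ → (∀ b → h (suc b) ≈ t * (h b + n 0 b)) →
      (∀ k → n k 0 ≈ n₀ k) → (∀ k b → n k (suc b) ≈ fan (suc k) * h b + n (suc k) b + t * n k b) →
      ∀ b → scanH (replicate b end) ≈ h b × (∀ k → scanN (replicate b end) k ≈ n k b)
    scan-ends h n h-0 h-suc n-0 n-suc zero = ≈-sym h-0 , λ k → ≈-sym (n-0 k)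
    scan-ends h n h-0 h-suc n-0 n-suc (suc b) with scan-ends h n h-0 h-suc n-0 n-suc b
    ... | ihH , ihN = ≈-trans (*-congˡ (+-cong ihH (ihN 0))) (≈-sym (h-suc b))
      , λ k → ≈-trans (+-cong (+-cong (*-congˡ ihH) (ihN (suc k))) (*-congˡ (ihN k))) (≈-sym (n-suc k b))

    scan-nohub : ∀ a → nohub a ≡ true → scanH (letters a) ≡ scanH (replicate (ends# a) end) ×
      (∀ k → scanN (letters a) k ≡ scanN (replicate (ends# a) end) k)
    scan-nohub [] _ = refl , λ _ → refl
    scan-nohub ((false , true) ∷ a) e = scan-nohub a e
    scan-nohub ((false , false) ∷ a) e with scan-nohub a e
    ... | eH , eN = ≡.cong₂ (λ h n → t * (h + n)) eH (eN 0)
      , λ k → ≡.cong₂ _+_ (≡.cong₂ (λ h n → fan (suc k) * h + n) eH (eN (suc k))) (≡.cong (t *_) (eN k))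

  -- `FanScan` reads a word that is followed by a hub. `WrapScan j` reads one whose last arc runs on
  -- into the `j` blocks with which the cyclic word began.
  module FanScan = Scan 1# (λ _ → 0#)
  module WrapScan (j : ℕ) = Scan 0# (λ k → fan (k ℕ.+ j))

  -- Flats whose first letter is not a hub, with c blocks closed so far and no hub so far.
  scanStart : List Letter → ℕ → Carrier
  scanStart [] c = wheelP c
  scanStart (hub ∷ w) c = 0#
  scanStart (end ∷ w) c = WrapScan.scanH (suc c) w + scanStart w (suc c) + t * scanStart w c
  scanStart (mid ∷ w) c = scanStart w c

  start-ends : ∀ (n h : ℕ → ℕ → Carrier) → (∀ c b → WrapScan.scanH c (replicate b end) ≈ h c b) → (∀ c → n c 0 ≈ wheelP c) →
    (∀ c b → n c (suc b) ≈ h (suc c) b + n (suc c) b + t * n c b) → ∀ b c → scanStart (replicate b end) c ≈ n c b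
  start-ends n h h-eq n-0 n-suc zero c = ≈-sym (n-0 c)
  start-ends n h h-eq n-0 n-suc (suc b) c = ≈-trans
    (+-cong (+-cong (h-eq (suc c) b) (start-ends n h h-eq n-0 n-suc b (suc c))) (*-congˡ (start-ends n h h-eq n-0 n-suc b c))) (≈-sym (n-suc c b))

  start-nohub : ∀ a → nohub a ≡ true → ∀ c → scanStart (letters a) c ≡ scanStart (replicate (ends# a) end) c
  start-nohub [] _ c = refl
  start-nohub ((false , true) ∷ a) e c = start-nohub a e c
  start-nohub ((false , false) ∷ a) e c = ≡.cong₂ _+_
    (≡.cong₂ _+_ (proj₁ (WrapScan.scan-nohub (suc c) a e)) (start-nohub a e (suc c))) (≡.cong (t *_) (start-nohub a e c))

  -- `Q n p` is to be read as: `p` is palindromic of degree `n`. A word read after a hub splits at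
  -- its hubs into arcs, and for a single arc the claim is the one for fans.
  module Graded-product (Q : ℕ → Carrier → Set) (Q-cong : ∀ {n p q} → p ≈ q → Q n p → Q n q) (Q-one : Q 0 1#)
    (Q-mul : ∀ {m n p q} → Q m p → Q n q → Q (m ℕ.+ n) (p * q))
    (Q-arc : ∀ b → Q b (FanScan.scanH (replicate b end) + FanScan.scanN (replicate b end) 0))
    where
    open FanScan

    -- The sum for a word is the sum for its first arc, with b blocks, times the sum q for the rest.
    record Factored (w : List Letter) : Set where
      constructor factored
      field
        b m : ℕ
        q : Carrier
        ends-eq : ends-of w ≡ b ℕ.+ m
        graded : Q m q
        eH : scanH w ≈ scanH (replicate b end) * q
        eN : ∀ k → scanN w k ≈ scanN (replicate b end) k * q

    total-graded : ∀ {w} → Factored w → Q (ends-of w) (scanH w + scanN w 0)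
    total-graded {w} (factored b m q ends-eq graded eH eN) = ≡.subst (λ n → Q n (scanH w + scanN w 0)) (≡.sym ends-eq)
      (Q-cong (≈-trans (distribʳ _ _ _) (≈-sym (+-cong eH (eN 0)))) (Q-mul (Q-arc b) graded))

    factor : ∀ w → Factored w
    factor [] = factored 0 0 1# refl Q-one (≈-sym (*-identityʳ _)) (λ k → ≈-sym (zeroˡ _))
    factor (hub ∷ w) = factored 0 (ends-of w) (scanH w + scanN w 0) refl (total-graded (factor w)) (≈-sym (*-identityˡ _)) (λ k → ≈-sym (zeroˡ _))
    factor (mid ∷ w) = let factored b m q e g eH eN = factor w in factored b m q e g eH eN
    factor (end ∷ w) = let factored b m q e g eH eN = factor w in factored (suc b) m q (≡.cong suc e) g
      (≈-trans (*-congˡ (+-cong eH (eN 0))) (solve 4 (λ t h n q → t :* (h :* q :+ n :* q) := t :* (h :+ n) :* q) ≈-refl _ _ _ _))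
      (λ k → ≈-trans (+-cong (+-cong (*-congˡ eH) (eN (suc k))) (*-congˡ (eN k)))
        (solve 6 (λ f h n n′ t q → f :* (h :* q) :+ n :* q :+ t :* (n′ :* q) := (f :* h :+ n :+ t :* n′) :* q) ≈-refl _ _ _ _ _ _))

  ivK : Bool → Carrier → Carrier
  ivK b p = if b then p else 0#

  ivK-cong : ∀ b {p q} → (b ≡ true → p ≈ q) → ivK b p ≈ ivK b q
  ivK-cong true f = f refl
  ivK-cong false f = ≈-refl

  ivK-* : ∀ b c p → ivK b (c * p) ≈ c * ivK b p
  ivK-* true c p = ≈-refl
  ivK-* false c p = ≈-sym (zeroʳ c)

  ΣW : ℕ → (List Bits → Carrier) → Carrier
  ΣW zero f = f []
  ΣW (suc n) f = ΣW n (λ w → f ((true , true) ∷ w)) + ΣW n (λ w → f ((true , false) ∷ w))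
               + (ΣW n (λ w → f ((false , true) ∷ w)) + ΣW n (λ w → f ((false , false) ∷ w)))

  ΣW-cong : ∀ n {f g} → (∀ w → length w ≡ n → f w ≈ g w) → ΣW n f ≈ ΣW n g
  ΣW-cong zero e = e [] refl
  ΣW-cong (suc n) e = +-cong (+-cong (go _) (go _)) (+-cong (go _) (go _))
    where
    go : ∀ y → ΣW n _ ≈ ΣW n _
    go y = ΣW-cong n λ w l → e (y ∷ w) (≡.cong suc l)

  ΣW-0 : ∀ n → ΣW n (λ _ → 0#) ≈ 0#
  ΣW-0 zero = ≈-refl
  ΣW-0 (suc n) = ≈-trans (+-cong (+-cong (ΣW-0 n) (ΣW-0 n)) (+-cong (ΣW-0 n) (ΣW-0 n)))
    (≈-trans (+-cong (+-identityˡ 0#) (+-identityˡ 0#)) (+-identityˡ 0#))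

  ΣW-+ : ∀ n f g → ΣW n (λ w → f w + g w) ≈ ΣW n f + ΣW n g
  ΣW-+ zero f g = ≈-refl
  ΣW-+ (suc n) f g = ≈-trans (+-cong (+-cong (ΣW-+ n _ _) (ΣW-+ n _ _)) (+-cong (ΣW-+ n _ _) (ΣW-+ n _ _)))
    (solve 8 (λ a b c d e f g h → a :+ b :+ (c :+ d) :+ (e :+ f :+ (g :+ h)) := a :+ c :+ (e :+ g) :+ (b :+ d :+ (f :+ h))) ≈-refl _ _ _ _ _ _ _ _)

  ΣW-* : ∀ n c f → ΣW n (λ w → c * f w) ≈ c * ΣW n f
  ΣW-* zero c f = ≈-refl
  ΣW-* (suc n) c f = ≈-trans (+-cong (+-cong (ΣW-* n c _) (ΣW-* n c _)) (+-cong (ΣW-* n c _) (ΣW-* n c _)))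
    (solve 5 (λ c a b d e → c :* a :+ c :* b :+ (c :* d :+ c :* e) := c :* (a :+ b :+ (d :+ e))) ≈-refl _ _ _ _ _)

  pow : ℕ → Carrier
  pow zero = 1#
  pow (suc n) = t * pow n

  -- Here `k` blocks of the current arc are pending. The last arc is left to the continuation `κ`,
  -- because on a cycle it closes only together with the beginning of the word.
  linK : (ℕ → Carrier) → ℕ → List Bits → Carrier
  linK κ k [] = κ k
  linK κ k ((true , _) ∷ w) = fan k * linK κ 0 w
  linK κ k ((false , false) ∷ w) = linK κ (suc k) w
  linK κ k ((false , true) ∷ w) = linK κ k w

  -- The product of the Kazhdan–Lusztig polynomials of the arcs; without a hub, that of the wheel.
  arcsP : ℕ → List Bits → Carrier
  arcsP c [] = wheelP c
  arcsP c ((true , _) ∷ w) = linK (λ k → fan (k ℕ.+ c)) 0 w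
  arcsP c ((false , false) ∷ w) = arcsP (suc c) w
  arcsP c ((false , true) ∷ w) = arcsP c w

  HS NS : Bool → List Bits → (List Bits → Carrier) → Carrier
  HS σ a f = ΣW (length a) (λ g → ivK (hd σ g ∧ adm σ a g) (pow (merged a g) * f g))
  NS σ a f = ΣW (length a) (λ g → ivK (not (hd σ g) ∧ adm σ a g) (pow (merged a g) * f g))

  HS+NS : ∀ σ a f → ΣW (length a) (λ g → ivK (adm σ a g) (pow (merged a g) * f g)) ≈ HS σ a f + NS σ a f
  HS+NS σ a f = ≈-trans (ΣW-cong (length a) λ g _ → cases (hd σ g) (adm σ a g) _) (ΣW-+ (length a) _ _)
    where
    cases : ∀ b c p → ivK c p ≈ ivK (b ∧ c) p + ivK (not b ∧ c) p
    cases true c p = ≈-sym (+-identityʳ _)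
    cases false c p = ≈-sym (+-identityˡ _)

  sum-scale : ∀ n c (b : List Bits → Bool) (p q : List Bits → Carrier) →
    ΣW n (λ g → ivK (b g) (p g * (c * q g))) ≈ c * ΣW n (λ g → ivK (b g) (p g * q g))
  sum-scale n c b p q = ≈-trans (ΣW-cong n λ g _ → ≈-trans
    (ivK-cong (b g) λ _ → solve 3 (λ p c q → p :* (c :* q) := c :* (p :* q)) ≈-refl (p g) c (q g)) (ivK-* (b g) c _)) (ΣW-* n c _)

  sum-t : ∀ n (b : List Bits → Bool) (p q : List Bits → Carrier) →
    ΣW n (λ g → ivK (b g) (t * p g * q g)) ≈ t * ΣW n (λ g → ivK (b g) (p g * q g))
  sum-t n b p q = ≈-trans (ΣW-cong n λ g _ → ≈-trans (ivK-cong (b g) λ _ → *-assoc t (p g) (q g)) (ivK-* (b g) t _)) (ΣW-* n t _)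

  -- The base conditions describe the end of the word for both values of `σ`, so that one induction
  -- yields `FanScan` at `σ = true` and `WrapScan` at `σ = false`.
  module _ (σ : Bool) (κ : ℕ → Carrier) (h₀ : Carrier) (n₀ : ℕ → Carrier)
    (base-h : ∀ k → ivK (σ ∧ true) (1# * κ k) ≈ fan k * h₀) (base-n : ∀ k → ivK (not σ ∧ true) (1# * κ k) ≈ n₀ k)
    (base-z : σ ≡ true → ∀ k → n₀ k ≈ 0#)
    where

    open Scan h₀ n₀

    -- After `(true , true)` a good word continues with a hub, so the extra term that the scan adds
    -- for a non-hub continuation is zero. For this reason `Letter` can forget the rim bit at a hub.
    scanN-hub : ∀ v k → hd σ v ≡ true → scanN (letters v) k ≈ 0#
    scanN-hub [] k e = base-z e k
    scanN-hub ((true , _) ∷ v) k e = ≈-refl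

    -- An upper word decides the fate of each block end of the lower word: it is kept, or absorbed
    -- into the following block, or absorbed into the centre. The last two cost a factor `t`. In
    -- each case below, the four sums are indexed by the first entry of the upper word in the order
    -- of `ΣW`, and the entries not above that of `a` give zero.
    scan-H : ∀ a → Good σ a → ∀ k → HS σ a (linK κ k) ≈ fan k * scanH (letters a)
    scan-N : ∀ a → Good σ a → ∀ k → NS σ a (linK κ k) ≈ scanN (letters a) k

    private
      Z : ∀ n → ΣW n (λ _ → 0#) ≈ 0#
      Z = ΣW-0
      drop₀ : ∀ {a b c} → b ≈ 0# → c ≈ 0# → a + (b + c) ≈ a
      drop₀ p q = ≈-trans (+-congˡ (≈-trans (+-cong p q) (+-identityˡ 0#))) (+-identityʳ _)

    scan-H [] _ k = base-h k
    scan-H ((true , true) ∷ v) (e , gd) k = begin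
      ΣW n _ + ΣW n _ + (ΣW n _ + ΣW n _)
        ≈⟨ drop₀ (Z n) (Z n) ⟩
      ΣW n _ + ΣW n _
        ≈⟨ +-cong (≈-trans (sum-scale n (fan k) _ _ _) (*-congˡ (scan-H v gd 0))) (Z n) ⟩
      fan k * (fan 0 * scanH (letters v)) + 0#
        ≈⟨ +-cong (*-congˡ (≈-trans (*-congʳ fan-0) (*-identityˡ _))) (≈-sym (≈-trans (*-congˡ (scanN-hub v 0 e)) (zeroʳ _))) ⟩
      fan k * scanH (letters v) + fan k * scanN (letters v) 0
        ≈⟨ distribˡ _ _ _ ⟨
      fan k * (scanH (letters v) + scanN (letters v) 0) ∎
      where
      n : ℕ
      n = length v
    scan-H ((true , false) ∷ v) gd k = begin
      ΣW n _ + ΣW n _ + (ΣW n _ + ΣW n _)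
        ≈⟨ drop₀ (Z n) (Z n) ⟩
      ΣW n _ + ΣW n _
        ≈⟨ +-cong (≈-trans (sum-scale n (fan k) _ _ _) (*-congˡ (≈-trans (scan-H v gd 0) (≈-trans (*-congʳ fan-0) (*-identityˡ _)))))
                  (≈-trans (sum-scale n (fan k) _ _ _) (*-congˡ (scan-N v gd 0))) ⟩
      fan k * scanH (letters v) + fan k * scanN (letters v) 0
        ≈⟨ distribˡ _ _ _ ⟨
      fan k * (scanH (letters v) + scanN (letters v) 0) ∎
      where
      n : ℕ
      n = length v
    scan-H ((false , true) ∷ v) gd k = begin
      ΣW n _ + ΣW n _ + (ΣW n _ + ΣW n _)
        ≈⟨ drop₀ (Z n) (Z n) ⟩
      ΣW n _ + ΣW n _
        ≈⟨ +-cong (≈-trans (sum-scale n (fan k) _ _ _) (*-congˡ (≈-trans (scan-H v gd 0) (≈-trans (*-congʳ fan-0) (*-identityˡ _))))) (Z n) ⟩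
      fan k * scanH (letters v) + 0# ≈⟨ +-identityʳ _ ⟩
      fan k * scanH (letters v) ∎
      where
      n : ℕ
      n = length v
    scan-H ((false , false) ∷ v) gd k = begin
      ΣW n _ + ΣW n _ + (ΣW n _ + ΣW n _)
        ≈⟨ drop₀ (Z n) (Z n) ⟩
      ΣW n _ + ΣW n _
        ≈⟨ +-cong (≈-trans (sum-t n _ _ _) (*-congˡ (≈-trans (sum-scale n (fan k) _ _ _) (*-congˡ (≈-trans (scan-H v gd 0) (≈-trans (*-congʳ fan-0) (*-identityˡ _)))))))
                  (≈-trans (sum-t n _ _ _) (*-congˡ (≈-trans (sum-scale n (fan k) _ _ _) (*-congˡ (scan-N v gd 0))))) ⟩
      t * (fan k * scanH (letters v)) + t * (fan k * scanN (letters v) 0)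
        ≈⟨ solve 4 (λ t f h n → t :* (f :* h) :+ t :* (f :* n) := f :* (t :* (h :+ n))) ≈-refl _ _ _ _ ⟩
      fan k * (t * (scanH (letters v) + scanN (letters v) 0)) ∎
      where
      n : ℕ
      n = length v

    scan-N [] _ k = base-n k
    scan-N ((true , true) ∷ v) _ k = ≈-trans (drop₀ (Z (length v)) (Z (length v))) (≈-trans (+-cong (Z (length v)) (Z (length v))) (+-identityˡ 0#))
    scan-N ((true , false) ∷ v) _ k = ≈-trans (drop₀ (Z (length v)) (Z (length v))) (≈-trans (+-cong (Z (length v)) (Z (length v))) (+-identityˡ 0#))
    scan-N ((false , true) ∷ v) gd k = begin
      ΣW n _ + ΣW n _ + (ΣW n _ + ΣW n _)
        ≈⟨ +-cong (+-cong (Z n) (Z n)) (+-cong (scan-N v gd k) (Z n)) ⟩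
      0# + 0# + (scanN (letters v) k + 0#)
        ≈⟨ ≈-trans (+-cong (+-identityˡ 0#) (+-identityʳ _)) (+-identityˡ _) ⟩
      scanN (letters v) k ∎
      where
      n : ℕ
      n = length v
    scan-N ((false , false) ∷ v) gd k = begin
      ΣW n _ + ΣW n _ + (ΣW n _ + ΣW n _)
        ≈⟨ +-cong (+-cong (Z n) (Z n)) (+-cong (≈-trans (sum-t n _ _ _) (*-congˡ (scan-N v gd k)))
             (≈-trans (HS+NS σ v (linK κ (suc k))) (+-cong (scan-H v gd (suc k)) (scan-N v gd (suc k))))) ⟩
      0# + 0# + (t * scanN (letters v) k + (fan (suc k) * scanH (letters v) + scanN (letters v) (suc k)))
        ≈⟨ ≈-trans (+-congʳ (+-identityˡ 0#)) (≈-trans (+-identityˡ _) (+-comm _ _)) ⟩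
      fan (suc k) * scanH (letters v) + scanN (letters v) (suc k) + t * scanN (letters v) k ∎
      where
      n : ℕ
      n = length v

  linK-cong : ∀ {κ κ′} → (∀ k → κ k ≈ κ′ k) → ∀ k w → linK κ k w ≈ linK κ′ k w
  linK-cong e k [] = e k
  linK-cong e k ((true , _) ∷ w) = *-congˡ (linK-cong e 0 w)
  linK-cong e k ((false , false) ∷ w) = linK-cong e (suc k) w
  linK-cong e k ((false , true) ∷ w) = linK-cong e k w

  linK-* : ∀ κ q k w → linK (λ k → κ k * q) k w ≈ linK κ k w * q
  linK-* κ q k [] = ≈-refl
  linK-* κ q k ((true , _) ∷ w) = ≈-trans (*-congˡ (linK-* κ q 0 w)) (≈-sym (*-assoc _ _ _))
  linK-* κ q k ((false , false) ∷ w) = linK-* κ q (suc k) w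
  linK-* κ q k ((false , true) ∷ w) = linK-* κ q k w

  linK-++ : ∀ κ k v w → linK κ k (v ++ w) ≡ linK (λ k → linK κ k w) k v
  linK-++ κ k [] w = refl
  linK-++ κ k ((true , _) ∷ v) w = ≡.cong (fan k *_) (linK-++ κ 0 v w)
  linK-++ κ k ((false , false) ∷ v) w = linK-++ κ (suc k) v w
  linK-++ κ k ((false , true) ∷ v) w = linK-++ κ k v w

  arcsP-hub : ∀ c r w → arcsP c ((true , r) ∷ w) ≈ linK (λ k → fan (k ℕ.+ c)) 0 ((true , r) ∷ w)
  arcsP-hub c r w = ≈-sym (≈-trans (*-congʳ fan-0) (*-identityˡ _))

  -- Cyclic invariance: reading can start at any hub.
  arcsP-rotate : ∀ c v r w → arcsP c (v ++ (true , r) ∷ w) ≈ linK (λ k → linK fan (k ℕ.+ c) v) 0 w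
  arcsP-rotate c [] r w = ≈-refl
  arcsP-rotate c ((true , r′) ∷ v) r w = begin
    linK κ 0 (v ++ (true , r) ∷ w) ≡⟨ linK-++ κ 0 v _ ⟩
    linK (λ k → fan k * linK κ 0 w) 0 v ≈⟨ linK-* fan (linK κ 0 w) 0 v ⟩
    linK fan 0 v * linK κ 0 w ≈⟨ *-comm _ _ ⟩
    linK κ 0 w * linK fan 0 v ≈⟨ linK-* κ (linK fan 0 v) 0 w ⟨
    linK (λ k → κ k * linK fan 0 v) 0 w ∎
    where
    κ : ℕ → Carrier
    κ k = fan (k ℕ.+ c)
  arcsP-rotate c ((false , false) ∷ v) r w = ≈-trans (arcsP-rotate (suc c) v r w)
    (linK-cong (λ k → reflexive (≡.cong (λ j → linK fan j v) (ℕP.+-suc k c))) 0 w)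
  arcsP-rotate c ((false , true) ∷ v) r w = arcsP-rotate c v r w

  arcsP-swap : ∀ v r w → arcsP 0 (v ++ (true , r) ∷ w) ≈ arcsP 0 ((true , r) ∷ w ++ v)
  arcsP-swap v r w = ≈-trans (arcsP-rotate 0 v r w) (≈-trans
    (linK-cong (λ k → reflexive (≡.cong (λ j → linK fan j v) (ℕP.+-identityʳ k))) 0 w)
    (≈-trans (reflexive (≡.sym (linK-++ fan 0 w v)))
    (linK-cong (λ k → reflexive (≡.cong fan (≡.sym (ℕP.+-identityʳ k)))) 0 (w ++ v))))

  start-H : ∀ a → Good false a → ∀ c → HS false a (arcsP c) ≈ WrapScan.scanH c (letters a)
  start-H a gd c = begin
    HS false a (arcsP c)
      ≈⟨ ΣW-cong (length a) (λ g _ → ivK-cong (hd false g ∧ adm false a g) λ e → *-congˡ (to-lin g (proj₁ (∧-true e)))) ⟩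
    HS false a (linK (λ k → fan (k ℕ.+ c)) 0)
      ≈⟨ scan-H false (λ k → fan (k ℕ.+ c)) 0# (λ k → fan (k ℕ.+ c)) (λ k → ≈-sym (zeroʳ _)) (λ k → *-identityˡ _) (λ ()) a gd 0 ⟩
    fan 0 * WrapScan.scanH c (letters a) ≈⟨ ≈-trans (*-congʳ fan-0) (*-identityˡ _) ⟩
    WrapScan.scanH c (letters a) ∎
    where
    to-lin : ∀ g → hd false g ≡ true → arcsP c g ≈ linK (λ k → fan (k ℕ.+ c)) 0 g
    to-lin ((true , r) ∷ g) e = arcsP-hub c r g

  start-N : ∀ a → Good false a → ∀ c → NS false a (arcsP c) ≈ scanStart (letters a) c
  start-N [] _ c = *-identityˡ _
  start-N ((true , true) ∷ v) _ c = ≈-trans (+-cong (+-cong (ΣW-0 n) (ΣW-0 n)) (+-cong (ΣW-0 n) (ΣW-0 n))) (≈-trans (+-cong (+-identityˡ 0#) (+-identityˡ 0#)) (+-identityˡ 0#))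
    where
    n : ℕ
    n = length v
  start-N ((true , false) ∷ v) _ c = ≈-trans (+-cong (+-cong (ΣW-0 n) (ΣW-0 n)) (+-cong (ΣW-0 n) (ΣW-0 n))) (≈-trans (+-cong (+-identityˡ 0#) (+-identityˡ 0#)) (+-identityˡ 0#))
    where
    n : ℕ
    n = length v
  start-N ((false , true) ∷ v) gd c = ≈-trans (+-cong (+-cong (ΣW-0 n) (ΣW-0 n)) (+-cong (start-N v gd c) (ΣW-0 n)))
    (≈-trans (+-cong (+-identityˡ 0#) (+-identityʳ _)) (+-identityˡ _))
    where
    n : ℕ
    n = length v
  start-N ((false , false) ∷ v) gd c = ≈-trans (+-cong (+-cong (ΣW-0 n) (ΣW-0 n)) (+-cong (≈-trans (sum-t n _ _ _) (*-congˡ (start-N v gd c)))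
      (≈-trans (HS+NS false v (arcsP (suc c))) (+-cong (start-H v gd (suc c)) (start-N v gd (suc c))))))
    (≈-trans (+-congʳ (+-identityˡ 0#)) (≈-trans (+-identityˡ _) (+-comm _ _)))
    where
    n : ℕ
    n = length v

  cyclic-term : List Bits → List Bits → Carrier
  cyclic-term a g = ivK (adm (hd false g) a g) (pow (merged a g) * arcsP 0 g)

  cyclic : List Bits → Carrier
  cyclic a = ΣW (length a) (cyclic-term a)

  cyclic-split : ∀ x v → cyclic (x ∷ v) ≈ HS true (x ∷ v) (arcsP 0) + NS false (x ∷ v) (arcsP 0)
  cyclic-split x v = ≈-trans (ΣW-cong (length (x ∷ v)) term) (ΣW-+ (length (x ∷ v))
      (λ g → ivK (hd true g ∧ adm true (x ∷ v) g) (pow (merged (x ∷ v) g) * arcsP 0 g))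
      (λ g → ivK (not (hd false g) ∧ adm false (x ∷ v) g) (pow (merged (x ∷ v) g) * arcsP 0 g)))
    where
    a : List Bits
    a = x ∷ v
    term : ∀ g → length g ≡ length a → cyclic-term a g ≈ ivK (hd true g ∧ adm true a g) (pow (merged a g) * arcsP 0 g)
      + ivK (not (hd false g) ∧ adm false a g) (pow (merged a g) * arcsP 0 g)
    term ((true , _) ∷ g) _ = ≈-sym (+-identityʳ _)
    term ((false , _) ∷ g) _ = ≈-sym (+-identityˡ _)

  cyclic-H : ∀ x v → Good true (x ∷ v) → HS true (x ∷ v) (arcsP 0) ≈ FanScan.scanH (letters (x ∷ v))
  cyclic-H x v gd = begin
    HS true (x ∷ v) (arcsP 0)
      ≈⟨ ΣW-cong (length (x ∷ v)) (λ g l → ivK-cong (hd true g ∧ adm true (x ∷ v) g) λ e → *-congˡ {pow (merged (x ∷ v) g)} (to-lin g l (proj₁ (∧-true e)))) ⟩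
    HS true (x ∷ v) (linK fan 0)
      ≈⟨ scan-H true fan 1# (λ _ → 0#) (λ k → *-comm _ _) (λ _ → ≈-refl) (λ _ _ → ≈-refl) (x ∷ v) gd 0 ⟩
    fan 0 * FanScan.scanH (letters (x ∷ v)) ≈⟨ ≈-trans (*-congʳ fan-0) (*-identityˡ _) ⟩
    FanScan.scanH (letters (x ∷ v)) ∎
    where
    to-lin : ∀ g → length g ≡ suc (length v) → hd true g ≡ true → arcsP 0 g ≈ linK fan 0 g
    to-lin ((true , r) ∷ g) _ e = ≈-trans (arcsP-hub 0 r g) (linK-cong (λ k → reflexive (≡.cong fan (ℕP.+-identityʳ k))) 0 ((true , r) ∷ g))

  cyclic-hub : ∀ b v → Good true ((true , b) ∷ v) → cyclic ((true , b) ∷ v) ≈ FanScan.scanH (letters ((true , b) ∷ v))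
  cyclic-hub b v gd = ≈-trans (cyclic-split (true , b) v) (≈-trans (+-cong (cyclic-H (true , b) v gd) (vanish b)) (+-identityʳ _))
    where
    n : ℕ
    n = length v
    vanish : ∀ b → NS false ((true , b) ∷ v) (arcsP 0) ≈ 0#
    vanish true = ≈-trans (+-cong (+-cong (ΣW-0 n) (ΣW-0 n)) (+-cong (ΣW-0 n) (ΣW-0 n))) (≈-trans (+-cong (+-identityˡ 0#) (+-identityˡ 0#)) (+-identityˡ 0#))
    vanish false = ≈-trans (+-cong (+-cong (ΣW-0 n) (ΣW-0 n)) (+-cong (ΣW-0 n) (ΣW-0 n))) (≈-trans (+-cong (+-identityˡ 0#) (+-identityˡ 0#)) (+-identityˡ 0#))

  ΣW-++ : ∀ m n f → ΣW (m ℕ.+ n) f ≈ ΣW m (λ v → ΣW n (λ w → f (v ++ w)))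
  ΣW-++ zero n f = ≈-refl
  ΣW-++ (suc m) n f = +-cong (+-cong (ΣW-++ m n _) (ΣW-++ m n _)) (+-cong (ΣW-++ m n _) (ΣW-++ m n _))

  ΣW-swap : ∀ m n (f : List Bits → List Bits → Carrier) → ΣW m (λ v → ΣW n (f v)) ≈ ΣW n (λ w → ΣW m (λ v → f v w))
  ΣW-swap zero n f = ≈-refl
  ΣW-swap (suc m) n f = ≈-trans (+-cong (+-cong (ΣW-swap m n _) (ΣW-swap m n _)) (+-cong (ΣW-swap m n _) (ΣW-swap m n _)))
    (≈-sym (≈-trans (ΣW-+ n _ _) (+-cong (ΣW-+ n _ _) (ΣW-+ n _ _))))

  cyclic-rotate : ∀ v b w → cyclic (v ++ (true , b) ∷ w) ≈ cyclic ((true , b) ∷ w ++ v)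
  cyclic-rotate v b w = begin
    ΣW (length (v ++ w′)) (cyclic-term (v ++ w′)) ≡⟨ ≡.cong (λ n → ΣW n (cyclic-term (v ++ w′))) (LP.length-++ v) ⟩
    ΣW (length v ℕ.+ length w′) (cyclic-term (v ++ w′)) ≈⟨ ΣW-++ (length v) (length w′) (cyclic-term (v ++ w′)) ⟩
    ΣW (length v) (λ g → ΣW (length w′) (λ h → cyclic-term (v ++ w′) (g ++ h))) ≈⟨ ΣW-swap (length v) (length w′) (λ g h → cyclic-term (v ++ w′) (g ++ h)) ⟩
    ΣW (length w′) (λ h → ΣW (length v) (λ g → cyclic-term (v ++ w′) (g ++ h)))
      ≈⟨ ΣW-cong (length w′) (λ h lh → ΣW-cong (length v) (λ g lg → term g h lg lh)) ⟩
    ΣW (length w′) (λ h → ΣW (length v) (λ g → cyclic-term (w′ ++ v) (h ++ g))) ≈⟨ ΣW-++ (length w′) (length v) (cyclic-term (w′ ++ v)) ⟨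
    ΣW (length w′ ℕ.+ length v) (cyclic-term (w′ ++ v)) ≡⟨ ≡.cong (λ n → ΣW n (cyclic-term (w′ ++ v))) (≡.sym (LP.length-++ w′)) ⟩
    ΣW (length (w′ ++ v)) (cyclic-term (w′ ++ v)) ∎
    where
    w′ : List Bits
    w′ = (true , b) ∷ w
    term : ∀ g h → length g ≡ length v → length h ≡ length w′ → cyclic-term (v ++ w′) (g ++ h) ≈ cyclic-term (w′ ++ v) (h ++ g)
    -- The lower word has a spoke here and the upper one does not: inclusion fails, and both sides
    -- are 0.
    term g ((false , r) ∷ h) lg lh = reflexive (≡.cong (λ b → ivK b (pow (merged (v ++ w′) (g ++ (false , r) ∷ h)) * arcsP 0 (g ++ (false , r) ∷ h)))
      (≡.trans (adm-++ (hd false (g ++ (false , r) ∷ h)) v g w′ ((false , r) ∷ h) (≡.sym lg)) (BP.∧-zeroʳ (adm _ v g))))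
    term g ((true , r) ∷ h) lg lh = ≈-trans (reflexive (≡.cong₂ (λ b n → ivK b (pow n * arcsP 0 (g ++ h′))) adm-eq merged-eq)) (ivK-cong (adm true (w′ ++ v) (h′ ++ g)) λ _ → *-congˡ (arcsP-swap g r h))
      where
      h′ : List Bits
      h′ = (true , r) ∷ h
      merged-eq : merged (v ++ w′) (g ++ h′) ≡ merged (w′ ++ v) (h′ ++ g)
      merged-eq = ≡.trans (merged-++ v g w′ h′ (≡.sym lg)) (≡.trans (ℕP.+-comm (merged v g) (merged w′ h′)) (≡.sym (merged-++ w′ h′ v g (≡.sym lh))))
      adm-eq : adm (hd false (g ++ h′)) (v ++ w′) (g ++ h′) ≡ adm true (w′ ++ v) (h′ ++ g)
      adm-eq = ≡.trans (adm-++ (hd false (g ++ h′)) v g w′ h′ (≡.sym lg))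
        (≡.trans (BP.∧-comm (adm true v g) (adm (hd false (g ++ h′)) w′ h′))
        (≡.sym (≡.trans (adm-++ true w′ h′ v g (≡.sym lh)) (≡.cong (λ s → adm s w′ h′ ∧ adm true v g) (≡.sym (hd-++ false g h′))))))

  -- Only one upper word is the full rim, and the words below it are exactly the hub-free ones.
  rim-sum : ∀ v c → ΣW (length v) (λ g → ivK (adm false v g) (ivK (allmid g) c)) ≈ ivK (nohub v) c
  rim-sum [] c = ≈-refl
  rim-sum (x ∷ v) c = ≈-trans (+-cong (+-cong (zeros (true , true) (λ _ → refl)) (zeros (true , false) (λ _ → refl)))
      (+-cong (main x) (zeros (false , false) (λ _ → refl))))
    (≈-trans (+-cong (+-identityˡ 0#) (+-identityʳ _)) (+-identityˡ _))
    where
    n : ℕ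
    n = length v
    ivK-0 : ∀ b → ivK b 0# ≈ 0#
    ivK-0 true = ≈-refl
    ivK-0 false = ≈-refl
    zeros : ∀ y → (∀ g → allmid (y ∷ g) ≡ false) → ΣW n (λ g → ivK (adm false (x ∷ v) (y ∷ g)) (ivK (allmid (y ∷ g)) c)) ≈ 0#
    zeros y e = ≈-trans (ΣW-cong n λ g _ → ≈-trans (ivK-cong (adm false (x ∷ v) (y ∷ g)) λ _ → reflexive (≡.cong (λ b → ivK b c) (e g))) (ivK-0 _)) (ΣW-0 n)
    step : ∀ g → ivK (not (hd false g) ∧ adm false v g) (ivK (allmid g) c) ≈ ivK (adm false v g) (ivK (allmid g) c)
    step [] = ≈-refl
    step ((true , _) ∷ g) = ≈-sym (ivK-0 _)
    step ((false , _) ∷ g) = ≈-refl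
    main : ∀ x → ΣW n (λ g → ivK (leq x (false , true) ∧ (not (hd false g) ∧ adm false v g)) (ivK (allmid g) c)) ≈ ivK (nohub (x ∷ v)) c
    main (true , _) = ΣW-0 n
    main (false , true) = ≈-trans (ΣW-cong n λ g _ → step g) (rim-sum v c)
    main (false , false) = ≈-trans (ΣW-cong n λ g _ → step g) (rim-sum v c)

  -- A flat consisting of the whole rim is not covered by the arcs: wheelP 0 = 0 and its polynomial is 1.
  klWord : List Bits → Carrier
  klWord w = if allmid w then 1# else arcsP 0 w

  cloc : List Bits → Bool
  cloc w = loc (hd false w) w

  wordTerm : List Bits → List Bits → Carrier
  wordTerm a g = ivK (cloc g ∧ sub a g) (pow (crk# a ∸ crk# g) * klWord g)

  pow-+ : ∀ m n → pow (m ℕ.+ n) ≈ pow m * pow n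
  pow-+ zero n = ≈-sym (*-identityˡ _)
  pow-+ (suc m) n = ≈-trans (*-congˡ (pow-+ m n)) (≈-sym (*-assoc _ _ _))

  arcsP-allmid : ∀ c g → allmid g ≡ true → arcsP c g ≡ wheelP c
  arcsP-allmid c [] _ = refl
  arcsP-allmid c ((false , true) ∷ g) e = arcsP-allmid c g e

  module _ (wheelP-0 : wheelP 0 ≈ 0#) where

    -- `cyclic` weighs by merged ends and gives the full rim the value `wheelP 0`, which is 0. The
    -- factor in front restores the extra corank when `a` itself is the full rim; the last term is
    -- the actual contribution of the full rim as an upper flat.
    word-total : ∀ a → ΣW (length a) (wordTerm a) ≈ pow (#ᵇ (allmid a)) * cyclic a + ivK (nohub a) (pow (crk# a ∸ 1))
    word-total a = ≈-trans (ΣW-cong n λ g _ → term g) (≈-trans (ΣW-+ n _ _) (+-cong (ΣW-* n _ _) (rim-sum a _)))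
      where
      n : ℕ
      n = length a
      term : ∀ g → wordTerm a g ≈ pow (#ᵇ (allmid a)) * cyclic-term a g + ivK (adm false a g) (ivK (allmid g) (pow (crk# a ∸ 1)))
      term g = ≈-trans (reflexive (≡.cong (λ b → ivK b (pow (crk# a ∸ crk# g) * klWord g)) (≡.sym (adm-loc (hd false g) a g))))
          (cases (allmid g) refl (adm (hd false g) a g) refl)
        where
        cases : ∀ m → allmid g ≡ m → ∀ b → adm (hd false g) a g ≡ b → ivK b (pow (crk# a ∸ crk# g) * klWord g)
          ≈ pow (#ᵇ (allmid a)) * ivK b (pow (merged a g) * arcsP 0 g) + ivK (adm false a g) (ivK (allmid g) (pow (crk# a ∸ 1)))
        cases true am b e = begin
          ivK b (pow (crk# a ∸ crk# g) * klWord g)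
            ≈⟨ ivK-cong b (λ _ → ≈-trans (*-cong (reflexive (≡.cong (λ k → pow (crk# a ∸ k)) (crk-allmid g am)))
                 (reflexive (≡.cong (λ c → if c then 1# else arcsP 0 g) am))) (*-identityʳ _)) ⟩
          ivK b (pow (crk# a ∸ 1)) ≈⟨ +-identityˡ _ ⟨
          0# + ivK b (pow (crk# a ∸ 1))
            ≈⟨ +-cong (≈-sym (≈-trans (*-congˡ (≈-trans (ivK-cong b (λ _ → ≈-trans (*-congˡ (≈-trans (reflexive (arcsP-allmid 0 g am)) wheelP-0)) (zeroʳ _))) (zero-iv b))) (zeroʳ _)))
                 (reflexive (≡.cong₂ ivK (≡.trans (≡.sym e) (≡.cong (λ s → adm s a g) (hd-allmid g am))) (≡.cong (λ c → ivK c (pow (crk# a ∸ 1))) (≡.sym am)))) ⟩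
          pow (#ᵇ (allmid a)) * ivK b (pow (merged a g) * arcsP 0 g) + ivK (adm false a g) (ivK (allmid g) (pow (crk# a ∸ 1))) ∎
          where
          zero-iv : ∀ b → ivK b 0# ≈ 0#
          zero-iv true = ≈-refl
          zero-iv false = ≈-refl
        cases false am b e = begin
          ivK b (pow (crk# a ∸ crk# g) * klWord g)
            ≈⟨ ivK-cong b (λ { refl → ≈-trans (*-cong (≈-trans (reflexive (≡.cong pow (exponent e))) (pow-+ (#ᵇ (allmid a)) (merged a g)))
                 (reflexive (≡.cong (λ c → if c then 1# else arcsP 0 g) am))) (*-assoc _ _ _) }) ⟩
          ivK b (pow (#ᵇ (allmid a)) * (pow (merged a g) * arcsP 0 g)) ≈⟨ ivK-* b _ _ ⟩
          pow (#ᵇ (allmid a)) * ivK b (pow (merged a g) * arcsP 0 g) ≈⟨ +-identityʳ _ ⟨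
          pow (#ᵇ (allmid a)) * ivK b (pow (merged a g) * arcsP 0 g) + 0#
            ≈⟨ +-congˡ (≈-sym (≈-trans (reflexive (≡.cong (λ c → ivK (adm false a g) (ivK c (pow (crk# a ∸ 1)))) am)) (zero-iv (adm false a g)))) ⟩
          pow (#ᵇ (allmid a)) * ivK b (pow (merged a g) * arcsP 0 g) + ivK (adm false a g) (ivK (allmid g) (pow (crk# a ∸ 1))) ∎
          where
          zero-iv : ∀ b → ivK b 0# ≈ 0#
          zero-iv true = ≈-refl
          zero-iv false = ≈-refl
          exponent : adm (hd false g) a g ≡ true → crk# a ∸ crk# g ≡ #ᵇ (allmid a) ℕ.+ merged a g
          exponent e = ≡.trans (≡.cong₂ _∸_ (≡.cong (ℕ._+ #ᵇ (allmid a)) (≡.sym (ends-merged a g (proj₂ (∧-true {loc (hd false g) g} (≡.trans (≡.sym (adm-loc (hd false g) a g)) e))))))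
              (≡.trans (≡.cong (λ c → ends# g ℕ.+ #ᵇ c) am) (ℕP.+-identityʳ (ends# g))))
            (arith (merged a g) (ends# g) (#ᵇ (allmid a)))
            where
            arith : ∀ x y z → (x ℕ.+ y ℕ.+ z) ∸ y ≡ z ℕ.+ x
            arith x y z = ≡.trans (≡.cong (_∸ y) (≡.trans (≡.cong (ℕ._+ z) (ℕP.+-comm x y)) (≡.trans (ℕP.+-assoc y x z) (≡.cong (y ℕ.+_) (ℕP.+-comm x z)))))
              (ℕP.m+n∸m≡n y (z ℕ.+ x))

    cyclic-nohub : ∀ y w → nohub (y ∷ w) ≡ true → cyclic (y ∷ w) ≈
      FanScan.scanH (replicate (ends# (y ∷ w)) end) + scanStart (replicate (ends# (y ∷ w)) end) 0
    cyclic-nohub y w e = ≈-trans (cyclic-split y w) (+-cong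
      (≈-trans (cyclic-H y w (nohub-good true (y ∷ w) e)) (reflexive (proj₁ (FanScan.scan-nohub (y ∷ w) e))))
      (≈-trans (start-N (y ∷ w) (nohub-good false (y ∷ w) e) 0) (reflexive (start-nohub (y ∷ w) e 0))))

    word-nohub : ∀ y w k → nohub (y ∷ w) ≡ true → ends# (y ∷ w) ≡ suc k → ΣW (length (y ∷ w)) (wordTerm (y ∷ w)) ≈
      FanScan.scanH (replicate (suc k) end) + scanStart (replicate (suc k) end) 0 + pow k
    word-nohub y w k e k-eq = ≈-trans (word-total a) (+-cong
        (≈-trans (*-congʳ (reflexive (≡.cong (λ b → pow (#ᵇ b)) am))) (≈-trans (*-identityˡ _) (≈-trans (cyclic-nohub y w e)
          (reflexive (≡.cong (λ n → FanScan.scanH (replicate n end) + scanStart (replicate n end) 0) k-eq)))))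
        (reflexive (≡.cong₂ (λ b n → ivK b (pow (n ∸ 1))) e (≡.trans (≡.cong (λ b → ends# a ℕ.+ #ᵇ b) am) (≡.trans (ℕP.+-identityʳ _) k-eq)))))
      where
      a : List Bits
      a = y ∷ w
      am : allmid a ≡ false
      am = nohub-ends a k-eq

    module Graded-words (wheelP-1 : wheelP 1 ≈ 0#)
      (Q : ℕ → Carrier → Set) (Q-cong : ∀ {n p q} → p ≈ q → Q n p → Q n q) (Q-one : Q 0 1#)
      (Q-mul : ∀ {m n p q} → Q m p → Q n q → Q (m ℕ.+ n) (p * q))
      (Q-arc : ∀ b → Q b (FanScan.scanH (replicate b end) + FanScan.scanN (replicate b end) 0))
      (Q-1+t : Q 1 (t + 1#))
      (Q-wheel : ∀ k → Q (2 ℕ.+ k) (FanScan.scanH (replicate (2 ℕ.+ k) end) + scanStart (replicate (2 ℕ.+ k) end) 0 + pow (suc k)))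
      where

      open Graded-product Q Q-cong Q-one Q-mul Q-arc

      private
        sum : List Bits → Carrier
        sum a = ΣW (length a) (wordTerm a)

      -- Rotating the cycle to a hub leaves a linear word read after a hub, which factors into arcs.
      word-some : ∀ v b w → cloc (v ++ (true , b) ∷ w) ≡ true → Q (crk# (v ++ (true , b) ∷ w)) (sum (v ++ (true , b) ∷ w))
      word-some v b w loc-a = ≡.subst (λ n → Q n (sum a)) (≡.sym crk-eq) (Q-cong (≈-sym sum-eq) (total-graded (factor (letters (w ++ v)))))
        where
        a w′ : List Bits
        w′ = (true , b) ∷ w
        a = v ++ w′
        am : allmid a ≡ false
        am with allmid a in e
        ... | false = refl
        ... | true = ⊥-elim (true≢false (≡.trans (≡.sym (allmid-nohub a e)) (nohub-some v b w)))
        ends-hub : ∀ b → ends# ((true , b) ∷ w) ≡ ends# w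
        ends-hub true = refl
        ends-hub false = refl
        crk-eq : crk# a ≡ ends-of (letters (w ++ v))
        crk-eq = ≡.trans (≡.cong (λ b → ends# a ℕ.+ #ᵇ b) am) (≡.trans (ℕP.+-identityʳ _) (≡.trans (ends-++ v w′)
          (≡.trans (≡.trans (≡.cong (ends# v ℕ.+_) (ends-hub b)) (ℕP.+-comm (ends# v) (ends# w))) (≡.trans (≡.sym (ends-++ w v)) (≡.sym (ends-letters (w ++ v)))))))
        rotated : loc true (w′ ++ v) ≡ true
        rotated = ≡.trans (loc-++ true w′ v) (≡.trans (BP.∧-comm (loc (hd true v) w′) (loc true v))
          (≡.trans (≡.cong (λ s → loc true v ∧ loc s w′) (≡.sym (hd-++ false v w′))) (≡.trans (≡.sym (loc-++ (hd false a) v w′)) loc-a)))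
        sum-eq : sum a ≈ FanScan.scanH (letters (w ++ v)) + FanScan.scanN (letters (w ++ v)) 0
        sum-eq = ≈-trans (word-total a) (≈-trans (+-cong
            (≈-trans (*-congʳ (reflexive (≡.cong (λ b → pow (#ᵇ b)) am))) (≈-trans (*-identityˡ _)
              (≈-trans (cyclic-rotate v b w) (cyclic-hub b (w ++ v) (loc-good true (w′ ++ v) rotated)))))
            (reflexive (≡.cong (λ b → ivK b (pow (crk# a ∸ 1))) (nohub-some v b w))))
          (+-identityʳ _))

      word-none : ∀ y w → nohub (y ∷ w) ≡ true → Q (crk# (y ∷ w)) (sum (y ∷ w))
      word-none y w nh = cases (ends# (y ∷ w)) refl
        where
        a : List Bits
        a = y ∷ w
        crk-suc : ∀ {k} → ends# a ≡ suc k → crk# a ≡ suc k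
        crk-suc e = ≡.trans (≡.cong₂ (λ n b → n ℕ.+ #ᵇ b) e (nohub-ends a e)) (ℕP.+-identityʳ _)
        rim-only : allmid a ≡ true → ends# a ≡ 0 → sum a ≈ t + 1#
        rim-only am e = ≈-trans (word-total a) (+-cong
          (≈-trans (*-cong (≈-trans (reflexive (≡.cong (λ b → pow (#ᵇ b)) am)) (*-identityʳ t))
            (≈-trans (cyclic-nohub y w nh) (≈-trans (reflexive (≡.cong (λ n → FanScan.scanH (replicate n end) + scanStart (replicate n end) 0) e))
              (≈-trans (+-congˡ wheelP-0) (+-identityʳ 1#))))) (*-identityʳ t))
          (reflexive (≡.cong₂ (λ b n → ivK b (pow (n ∸ 1))) nh (crk-allmid a am))))
        one-block : FanScan.scanH (end ∷ []) + scanStart (end ∷ []) 0 + 1# ≈ t + 1#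
        one-block = +-congʳ (≈-trans (+-cong (≈-trans (*-congˡ (+-identityʳ 1#)) (*-identityʳ t))
          (≈-trans (+-cong (≈-trans (+-identityˡ _) wheelP-1) (≈-trans (*-congˡ wheelP-0) (zeroʳ t))) (+-identityˡ 0#))) (+-identityʳ t))
        cases : ∀ b → ends# a ≡ b → Q (crk# a) (sum a)
        -- The first two cases are the full rim and the rim with one edge missing. Both have corank
        -- 1 and sum `1 + t`; the wheel series takes over from two blocks on.
        cases zero e = let am = nohub-allmid a nh e in ≡.subst (λ n → Q n (sum a)) (≡.sym (crk-allmid a am)) (Q-cong (≈-sym (rim-only am e)) Q-1+t)
        cases (suc zero) e = ≡.subst (λ n → Q n (sum a)) (≡.sym (crk-suc e)) (Q-cong (≈-sym (≈-trans (word-nohub y w 0 nh e) one-block)) Q-1+t)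
        cases (suc (suc k)) e = ≡.subst (λ n → Q n (sum a)) (≡.sym (crk-suc e)) (Q-cong (≈-sym (word-nohub y w (suc k) nh e)) (Q-wheel k))

      word-graded : ∀ a → a ≢ [] → cloc a ≡ true → Q (crk# a) (sum a)
      word-graded a a≢[] cl with hubs? a
      ... | some v b w = word-some v b w cl
      word-graded [] a≢[] cl | none nh = ⊥-elim (a≢[] refl)
      word-graded (y ∷ w) a≢[] cl | none nh = word-none y w nh

  klWord-one-block : wheelP 1 ≈ 0# → ∀ w → nohub w ≡ true → ends# w ≡ 1 → klWord w ≈ 0#
  klWord-one-block wheelP-1 w nh e = ≈-trans (reflexive (≡.cong (λ b → if b then 1# else arcsP 0 w) (nohub-ends w e)))
    (≈-trans (reflexive (≡.trans (arcsP-nohub 0 w nh) (≡.cong wheelP e))) wheelP-1)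
    where
    arcsP-nohub : ∀ c w → nohub w ≡ true → arcsP c w ≡ wheelP (c ℕ.+ ends# w)
    arcsP-nohub c [] _ = ≡.cong wheelP (≡.sym (ℕP.+-identityʳ c))
    arcsP-nohub c ((false , true) ∷ w) e = arcsP-nohub c w e
    arcsP-nohub c ((false , false) ∷ w) e = ≡.trans (arcsP-nohub (suc c) w e) (≡.cong wheelP (≡.sym (ℕP.+-suc c (ends# w))))

  module Degrees (Dg : ℕ → Carrier → Set) (Dg-cong : ∀ {n p q} → p ≈ q → Dg n p → Dg n q)
    (Dg-mul : ∀ {m n p q} → Dg m p → Dg n q → Dg (m ℕ.+ n) (p * q))
    (Dg-one : Dg 1 1#) (Dg-fan : ∀ k → Dg k (fan k)) (Dg-wheel : ∀ k → Dg (suc k) (wheelP (suc k)))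
    where

    linK-degree : ∀ j k w → Dg (k ℕ.+ (j ℕ.+ ends# w)) (linK (λ k → fan (k ℕ.+ j)) k w)
    linK-degree j k [] = ≡.subst (λ n → Dg n (fan (k ℕ.+ j))) (≡.cong (k ℕ.+_) (≡.sym (ℕP.+-identityʳ j))) (Dg-fan (k ℕ.+ j))
    linK-degree j k ((true , true) ∷ w) = Dg-mul (Dg-fan k) (linK-degree j 0 w)
    linK-degree j k ((true , false) ∷ w) = Dg-mul (Dg-fan k) (linK-degree j 0 w)
    linK-degree j k ((false , true) ∷ w) = linK-degree j k w
    linK-degree j k ((false , false) ∷ w) = ≡.subst (λ n → Dg n (linK (λ k → fan (k ℕ.+ j)) (suc k) w))
      (≡.trans (≡.sym (ℕP.+-suc k (j ℕ.+ ends# w))) (≡.cong (k ℕ.+_) (≡.sym (ℕP.+-suc j (ends# w))))) (linK-degree j (suc k) w)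

    -- At `c = 0` the hypothesis excludes the full rim, where `arcsP` is `wheelP 0`, which is 0 and
    -- not the 1 required in corank 0.
    arcsP-degree : ∀ c w {d} → c ℕ.+ ends# w ≡ suc d ⊎ nohub w ≡ false → Dg (c ℕ.+ ends# w) (arcsP c w)
    arcsP-degree zero [] (inj₁ ())
    arcsP-degree (suc c) [] _ = ≡.subst (λ n → Dg n (wheelP (suc c))) (≡.sym (ℕP.+-identityʳ (suc c))) (Dg-wheel c)
    arcsP-degree c ((true , true) ∷ w) _ = linK-degree c 0 w
    arcsP-degree c ((true , false) ∷ w) _ = linK-degree c 0 w
    arcsP-degree c ((false , true) ∷ w) h = arcsP-degree c w h
    arcsP-degree c ((false , false) ∷ w) h = ≡.subst (λ n → Dg n (arcsP (suc c) w)) (≡.sym (ℕP.+-suc c (ends# w)))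
      (arcsP-degree (suc c) w {c ℕ.+ ends# w} (inj₁ refl))

    klWord-degree : ∀ w → Dg (crk# w) (klWord w)
    klWord-degree w with allmid w in am
    ... | true = ≡.subst (λ n → Dg (n ℕ.+ 1) 1#) (≡.sym (ends-allmid w am)) Dg-one
    ... | false = ≡.subst (λ n → Dg n (arcsP 0 w)) (≡.sym (ℕP.+-identityʳ (ends# w))) (arcsP-degree 0 w {ℕ.pred (ends# w)} (case (nohub w) refl (ends# w) refl))
      where
      case : ∀ b → nohub w ≡ b → ∀ e → ends# w ≡ e → ends# w ≡ suc (ℕ.pred (ends# w)) ⊎ nohub w ≡ false
      case false nh _ _ = inj₂ nh
      case true nh zero e = ⊥-elim (true≢false (≡.trans (≡.sym (nohub-allmid w nh e)) am))
      case true nh (suc e) eq = inj₁ (≡.trans eq (≡.cong (λ k → suc (ℕ.pred k)) (≡.sym eq)))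

-- Connectivity and rank in graphs

count : ℕ → (ℕ → Bool) → ℕ
count zero p = 0
count (suc N) p = #ᵇ (p 0) ℕ.+ count N (p ∘ suc)

count-filter : ∀ N (p : ℕ → Bool) (h : ℕ → ℕ) → length (filterᵇ p (applyUpTo h N)) ≡ count N (p ∘ h)
count-filter zero p h = refl
count-filter (suc N) p h with p (h 0)
... | true = ≡.cong suc (count-filter N p (h ∘ suc))
... | false = count-filter N p (h ∘ suc)

#ᵇ-mono : ∀ {a b} → (a ≡ true → b ≡ true) → #ᵇ a ≤ #ᵇ b
#ᵇ-mono {true} f rewrite f refl = s≤s z≤n
#ᵇ-mono {false} f = z≤n

count-mono : ∀ N {p q} → (∀ y → y < N → p y ≡ true → q y ≡ true) → count N p ≤ count N q
count-mono zero f = z≤n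
count-mono (suc N) f = ℕP.+-mono-≤ (#ᵇ-mono (f 0 (s≤s z≤n))) (count-mono N λ y y<N → f (suc y) (s≤s y<N))

count-strict : ∀ N {p q} → (∀ y → y < N → p y ≡ true → q y ≡ true) →
  ∀ z → z < N → p z ≡ false → q z ≡ true → count N p < count N q
count-strict (suc N) f zero _ pz qz rewrite pz | qz = s≤s (count-mono N λ y y<N → f (suc y) (s≤s y<N))
count-strict (suc N) f (suc z) (s≤s z<N) pz qz =
  ℕP.+-mono-≤-< (#ᵇ-mono (f 0 (s≤s z≤n))) (count-strict N (λ y y<N → f (suc y) (s≤s y<N)) z z<N pz qz)

count-≤ : ∀ N p → count N p ≤ N
count-≤ zero p = z≤n
count-≤ (suc N) p with p 0
... | true = s≤s (count-≤ N (p ∘ suc))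
... | false = ℕP.m≤n⇒m≤1+n (count-≤ N (p ∘ suc))

count-cong : ∀ N {p q} → (∀ y → y < N → p y ≡ q y) → count N p ≡ count N q
count-cong zero e = refl
count-cong (suc N) e = ≡.cong₂ ℕ._+_ (≡.cong #ᵇ (e 0 (s≤s z≤n))) (count-cong N λ y y<N → e (suc y) (s≤s y<N))

any-upTo : ∀ N (p : ℕ → Bool) (h : ℕ → ℕ) → any p (applyUpTo h N) ≡ true → Σ ℕ λ y → y < N × p (h y) ≡ true
any-upTo (suc N) p h e with ∪-true {p (h 0)} e
... | inj₁ t = 0 , s≤s z≤n , t
... | inj₂ t with any-upTo N p (h ∘ suc) t
...   | y , y<N , py = suc y , s≤s y<N , py

any-upTo′ : ∀ N (p : ℕ → Bool) (h : ℕ → ℕ) y → y < N → p (h y) ≡ true → any p (applyUpTo h N) ≡ true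
any-upTo′ (suc N) p h zero _ e = ∪-l e
any-upTo′ (suc N) p h (suc y) (s≤s y<N) e = ∪-r {p (h 0)} (any-upTo′ N p (h ∘ suc) y y<N e)

search : ∀ N (p q : ℕ → Bool) → (∀ y → y < N → p y ≡ true → q y ≡ true) ⊎ Σ ℕ (λ y → y < N × p y ≡ true × q y ≡ false)
search zero p q = inj₁ λ _ ()
search (suc N) p q with search N (p ∘ suc) (q ∘ suc)
... | inj₂ (y , y<N , py , qy) = inj₂ (suc y , s≤s y<N , py , qy)
... | inj₁ f with p 0 in p0 | q 0 in q0
...   | true | false = inj₂ (0 , s≤s z≤n , p0 , q0)
...   | true | true = inj₁ λ { zero _ _ → q0 ; (suc y) (s≤s y<N) → f y y<N }
...   | false | _ = inj₁ λ { zero _ e → ⊥-elim (true≢false (≡.trans (≡.sym e) p0)) ; (suc y) (s≤s y<N) → f y y<N }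

module Connectivity (Γ : Graph) (ends<V : ∀ e → proj₁ (ends Γ e) < V Γ × proj₂ (ends Γ e) < V Γ) where

  n-V : ℕ
  n-V = V Γ

  src tgt : Fin (E Γ) → ℕ
  src e = proj₁ (ends Γ e)
  tgt e = proj₂ (ends Γ e)

  data Step (A : Subset (E Γ)) : ℕ → ℕ → Set where
    fwd : ∀ e → A e ≡ true → Step A (src e) (tgt e)
    bwd : ∀ e → A e ≡ true → Step A (tgt e) (src e)

  -- Paths are extended at their far end, matching the recursion of `reach`.
  data Conn (A : Subset (E Γ)) (x : ℕ) : ℕ → Set where
    stop : Conn A x x
    _▹_  : ∀ {y z} → Conn A x y → Step A y z → Conn A x z

  step-sym : ∀ {A x y} → Step A x y → Step A y x
  step-sym (fwd e p) = bwd e p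
  step-sym (bwd e p) = fwd e p

  conn-trans : ∀ {A x y z} → Conn A x y → Conn A y z → Conn A x z
  conn-trans c stop = c
  conn-trans c (d ▹ s) = conn-trans c d ▹ s

  conn-sym : ∀ {A x y} → Conn A x y → Conn A y x
  conn-sym stop = stop
  conn-sym (c ▹ s) = conn-trans (stop ▹ step-sym s) (conn-sym c)

  conn-bind : ∀ {A B} → (∀ {x y} → Step A x y → Conn B x y) → ∀ {x y} → Conn A x y → Conn B x y
  conn-bind f stop = stop
  conn-bind f (c ▹ s) = conn-trans (conn-bind f c) (f s)

  conn-mono : ∀ {A B} → (∀ i → A i ≡ true → B i ≡ true) → ∀ {x y} → Conn A x y → Conn B x y
  conn-mono A⊆B = conn-bind λ { (fwd e p) → stop ▹ fwd e (A⊆B e p) ; (bwd e p) → stop ▹ bwd e (A⊆B e p) }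

  invariant : ∀ {A} (L : ℕ → ℕ) → (∀ e → A e ≡ true → L (src e) ≡ L (tgt e)) → ∀ {x y} → Conn A x y → L x ≡ L y
  invariant L f stop = refl
  invariant L f (c ▹ fwd e p) = ≡.trans (invariant L f c) (f e p)
  invariant L f (c ▹ bwd e p) = ≡.trans (invariant L f c) (≡.sym (f e p))

  conn-V : ∀ {A x y} → x < n-V → Conn A x y → y < n-V
  conn-V x<V stop = x<V
  conn-V x<V (c ▹ fwd e p) = proj₂ (ends<V e)
  conn-V x<V (c ▹ bwd e p) = proj₁ (ends<V e)

  module _ (A : Subset (E Γ)) (x : ℕ) where

    R : ℕ → ℕ → Bool
    R k y = reach Γ A k x y

    R-suc : ∀ k y → R k y ≡ true → R (suc k) y ≡ true
    R-suc k y = ∪-l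

    R-step : ∀ k {y z} → R k y ≡ true → Step A y z → R (suc k) z ≡ true
    R-step k {y} {z} r (fwd e p) = ∪-r {R k z} (any-true′ e (∧-true′ p (∪-l (∧-true′ r (≡ᵇ-refl (tgt e))))))
    R-step k {y} {z} r (bwd e p) = ∪-r {R k z} (any-true′ e (∧-true′ p (∪-r {R k (src e) ∧ (tgt e ≡ᵇ src e)} (∧-true′ r (≡ᵇ-refl (src e))))))

    R-inv : ∀ k {z} → R (suc k) z ≡ true → R k z ≡ true ⊎ Σ ℕ λ y → R k y ≡ true × Step A y z
    R-inv k {z} r with ∪-true {R k z} r
    ... | inj₁ t = inj₁ t
    ... | inj₂ t with any-true t
    ...   | e , q with ∧-true {A e} q
    ...     | p , o with ∪-true {R k (src e) ∧ (tgt e ≡ᵇ z)} o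
    ...       | inj₁ f with ∧-true {R k (src e)} f
    ...         | rk , eq with ≡ᵇ-true (tgt e) z eq
    ...           | refl = inj₂ (src e , rk , fwd e p)
    R-inv k {z} r | inj₂ t | e , q | p , o | inj₂ f with ∧-true {R k (tgt e)} f
    ...         | rk , eq with ≡ᵇ-true (src e) z eq
    ...           | refl = inj₂ (tgt e , rk , bwd e p)

    sound : ∀ k {y} → R k y ≡ true → Conn A x y
    sound zero {y} r with ≡ᵇ-true x y r
    ... | refl = stop
    sound (suc k) r with R-inv k r
    ... | inj₁ t = sound k t
    ... | inj₂ (y , t , s) = sound k t ▹ s

    Stable : ℕ → Set
    Stable k = ∀ y → R (suc k) y ≡ true → R k y ≡ true

    stable-suc : ∀ k → Stable k → Stable (suc k)
    stable-suc k st z r with R-inv (suc k) r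
    ... | inj₁ t = t
    ... | inj₂ (y , t , s) = R-step k (st y t) s

    -- Until it is stable, the set of reached vertices gains at least one vertex per step. It cannot
    -- exceed the number of vertices, which is why depth `V` suffices in `reach`.
    stable-or-grows : x < n-V → ∀ k → Stable k ⊎ k < count n-V (R k)
    stable-or-grows x<V zero = inj₂ (ℕP.≤-<-trans z≤n (count-strict n-V {λ _ → false} {R 0} (λ _ _ ()) x x<V refl (≡ᵇ-refl x)))
    stable-or-grows x<V (suc k) with stable-or-grows x<V k
    ... | inj₁ st = inj₁ (stable-suc k st)
    ... | inj₂ k<c with search n-V (R (suc k)) (R k)
    ...   | inj₁ f = inj₁ (stable-suc k λ y r → f y (conn-V x<V (sound (suc k) r)) r)
    ...   | inj₂ (y , y<V , new , old) = inj₂ (ℕP.≤-<-trans k<c (count-strict n-V (λ z _ → R-suc k z) y y<V old new))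

    complete : x < n-V → ∀ {y} → Conn A x y → R n-V y ≡ true
    complete x<V = go
      where
      stable : Stable n-V
      stable with stable-or-grows x<V n-V
      ... | inj₁ st = st
      ... | inj₂ lt = ⊥-elim (ℕP.<-irrefl refl (ℕP.<-≤-trans lt (count-≤ n-V (R n-V))))
      start : ∀ k → R k x ≡ true
      start zero = ≡ᵇ-refl x
      start (suc k) = R-suc k x (start k)
      go : ∀ {y} → Conn A x y → R n-V y ≡ true
      go stop = start n-V
      go (c ▹ s) = stable _ (R-step n-V (go c) s)

  isMin : Subset (E Γ) → ℕ → Bool
  isMin A x = not (any (λ y → (y <ᵇ x) ∧ reach Γ A n-V x y) (upTo n-V))

  min-true : ∀ {A x} → x < n-V → isMin A x ≡ true → ∀ y → y < x → ¬ Conn A x y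
  min-true {A} {x} x<V t y y<x c = true≢false (≡.trans
    (≡.sym (any-upTo′ n-V (λ y → (y <ᵇ x) ∧ reach Γ A n-V x y) (λ a → a) y (ℕP.<-trans y<x x<V) (∧-true′ (<ᵇ-true′ y<x) (complete A x x<V c))))
    (not-true t))

  min-true′ : ∀ {A x} → (∀ y → y < x → ¬ Conn A x y) → isMin A x ≡ true
  min-true′ {A} {x} f = not-true′ λ t → case (any-upTo n-V _ (λ a → a) t)
    where
    case : Σ ℕ (λ y → y < n-V × (y <ᵇ x) ∧ reach Γ A n-V x y ≡ true) → ⊥
    case (y , _ , b) = f y (<ᵇ-true y x (proj₁ (∧-true b))) (sound A x n-V (proj₂ (∧-true {y <ᵇ x} b)))

  min-false : ∀ {A x} → isMin A x ≡ false → Σ ℕ λ y → y < x × Conn A x y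
  min-false {A} {x} e with any (λ y → (y <ᵇ x) ∧ reach Γ A n-V x y) (upTo n-V) in eq
  ... | true with any-upTo n-V _ (λ a → a) eq
  ...   | y , _ , b = y , <ᵇ-true y x (proj₁ (∧-true b)) , sound A x n-V (proj₂ (∧-true {y <ᵇ x} b))

  comps : Subset (E Γ) → ℕ
  comps A = count n-V (isMin A)

  components-count : ∀ A → components Γ A ≡ comps A
  components-count A = count-filter n-V (isMin A) (λ a → a)

  rank : Subset (E Γ) → ℕ
  rank = rk (graphicMat Γ)

  rank-comps : ∀ A → rank A ≡ n-V ∸ comps A
  rank-comps A = ≡.cong (n-V ∸_) (components-count A)

  comps-conn : ∀ {A B} → (∀ {x y} → Conn A x y → Conn B x y) → comps B ≤ comps A
  comps-conn f = count-mono n-V λ x x<V b → min-true′ λ y y<x c → min-true x<V b y y<x (f c)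

  rank-conn : ∀ {A B} → (∀ {x y} → Conn A x y → Conn B x y) → rank A ≤ rank B
  rank-conn {A} {B} f rewrite rank-comps A | rank-comps B = ℕP.∸-monoʳ-≤ n-V (comps-conn f)

  rank-mono : ∀ {A B} → (∀ i → A i ≡ true → B i ≡ true) → rank A ≤ rank B
  rank-mono A⊆B = rank-conn (conn-mono A⊆B)

  rank-ext : Ext rank
  rank-ext e = ℕP.≤-antisym (rank-mono λ i → ≡.trans (≡.sym (e i))) (rank-mono λ i → ≡.trans (e i))

  Closed : Subset (E Γ) → Set
  Closed F = ∀ e → Conn F (src e) (tgt e) → F e ≡ true

  cl : Subset (E Γ) → Subset (E Γ)
  cl A e = reach Γ A n-V (src e) (tgt e)

  cl-sound : ∀ {A x y} → Conn (cl A) x y → Conn A x y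
  cl-sound {A} = conn-bind λ { (fwd e p) → sound A _ n-V p ; (bwd e p) → conn-sym (sound A _ n-V p) }

  ⊆-cl : ∀ {A} e → A e ≡ true → cl A e ≡ true
  ⊆-cl {A} e p = complete A (src e) (proj₁ (ends<V e)) (stop ▹ fwd e p)

  cl-closed : ∀ A → Closed (cl A)
  cl-closed A e c = complete A (src e) (proj₁ (ends<V e)) (cl-sound c)

  cl-rank : ∀ A → rank (cl A) ≡ rank A
  cl-rank A = ℕP.≤-antisym (rank-conn cl-sound) (rank-mono ⊆-cl)

  cl-least : ∀ {A F} → Closed F → (∀ i → A i ≡ true → F i ≡ true) → ∀ i → cl A i ≡ true → F i ≡ true
  cl-least {A} cF A⊆F i p = cF i (conn-mono A⊆F (sound A _ n-V p))

  private
    graphic : Mat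
    graphic = graphicMat Γ

  -- An edge between vertices already connected by `F` changes neither the components nor the rank,
  -- so a flat cannot omit it.
  flat→closed : ∀ {F} → isFlat graphic F ≡ true → Closed F
  flat→closed {F} fl e c with F e in Fe
  ... | true = refl
  ... | false = ⊥-elim (Criterion.flat-true (E Γ) rank rank-ext rank-mono (λ _ _ → ℤ.+ 0) (λ _ _ → refl) fl e Fe
      (ℕP.≤-antisym (rank-conn (conn-bind λ { (fwd i p) → edge i (∪-true {F i} p) ; (bwd i p) → conn-sym (edge i (∪-true {F i} p)) })) (rank-mono λ i → ∪-l)))
    where
    edge : ∀ i → F i ≡ true ⊎ single e i ≡ true → Conn F (src i) (tgt i)
    edge i (inj₁ t) = stop ▹ fwd i t
    edge i (inj₂ t) with single-true e i t
    ... | refl = c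

  class-min : ∀ F x → x < n-V → Σ ℕ λ y → y ≤ x × Conn F x y × isMin F y ≡ true
  class-min F x = go (suc x) x ℕP.≤-refl
    where
    go : ∀ k x → x < k → x < n-V → Σ ℕ λ y → y ≤ x × Conn F x y × isMin F y ≡ true
    go (suc k) x (s≤s x≤k) x<V with isMin F x in eq
    ... | true = x , ℕP.≤-refl , stop , eq
    ... | false with min-false {F} {x} eq
    ...   | y , y<x , c with go k y (ℕP.<-≤-trans y<x x≤k) (ℕP.<-trans y<x x<V)
    ...     | z , z≤y , d , m = z , ℕP.≤-trans z≤y (ℕP.<⇒≤ y<x) , conn-trans c d , m

  -- An edge outside `F` joins two different classes. The larger of their two least vertices is then
  -- no longer least in its class, so the number of components drops and the rank rises.
  closed→flat : ∀ {F} → Closed F → isFlat graphic F ≡ true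
  closed→flat {F} cF = ∧-true′ (⊆-true′ {A = F} {λ _ → true} λ _ _ → refl) (all-true′ λ e → ⇒-true′ λ out →
      not-true′ λ eq → separates e (not-true out) (≡ᵇ-true _ _ eq))
    where
    separates : ∀ e → F e ≡ false → rank (F ∪ single e) ≢ rank F
    separates e Fe eq = ℕP.<-irrefl (≡.sym (≡.trans (≡.sym (rank-comps (F ∪ single e))) (≡.trans eq (rank-comps F))))
        (ℕP.∸-monoʳ-< (strict (class-min F (src e) (proj₁ (ends<V e))) (class-min F (tgt e) (proj₂ (ends<V e)))) (count-≤ n-V (isMin F)))
      where
      F′ : Subset (E Γ)
      F′ = F ∪ single e
      up : ∀ {x y} → Conn F x y → Conn F′ x y
      up = conn-mono λ i → ∪-l
      new : Conn F′ (src e) (tgt e)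
      new = stop ▹ fwd e (∪-r {F e} (single-self e))
      fewer : ∀ x → x < n-V → isMin F′ x ≡ true → isMin F x ≡ true
      fewer x x<V b = min-true′ λ y y<x c → min-true x<V b y y<x (up c)
      lose : ∀ a b → a < b → b < n-V → isMin F b ≡ true → Conn F′ b a → comps F′ < comps F
      lose a b a<b b<V mb c = count-strict n-V fewer b b<V (≢true λ t → min-true b<V t a a<b c) mb
      strict : Σ ℕ (λ y → y ≤ src e × Conn F (src e) y × isMin F y ≡ true) →
               Σ ℕ (λ y → y ≤ tgt e × Conn F (tgt e) y × isMin F y ≡ true) → comps F′ < comps F
      strict (a , a≤ , ca , ma) (b , b≤ , cb , mb) with ℕP.<-cmp a b
      ... | tri< a<b _ _ = lose a b a<b (ℕP.≤-<-trans b≤ (proj₂ (ends<V e))) mb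
              (conn-trans (conn-sym (up cb)) (conn-trans (conn-sym new) (up ca)))
      ... | tri> _ _ b<a = lose b a b<a (ℕP.≤-<-trans a≤ (proj₁ (ends<V e))) ma
              (conn-trans (conn-sym (up ca)) (conn-trans new (up cb)))
      ... | tri≈ _ refl _ = ⊥-elim (true≢false (≡.trans (≡.sym (cF e (conn-trans ca (conn-sym cb)))) Fe))

-- The flats of the wheel

wordN : ℕ → (ℕ → Bool) → (ℕ → Bool) → List Bits
wordN zero s r = []
wordN (suc n) s r = (s 0 , r 0) ∷ wordN n (s ∘ suc) (r ∘ suc)

length-wordN : ∀ n s r → length (wordN n s r) ≡ n
length-wordN zero s r = refl
length-wordN (suc n) s r = ≡.cong suc (length-wordN n _ _)

wordN-cong : ∀ n {s s′ r r′} → (∀ i → i < n → s i ≡ s′ i) → (∀ i → i < n → r i ≡ r′ i) → wordN n s r ≡ wordN n s′ r′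
wordN-cong zero _ _ = refl
wordN-cong (suc n) e e′ = ≡.cong₂ _∷_ (≡.cong₂ _,_ (e 0 (s≤s z≤n)) (e′ 0 (s≤s z≤n)))
  (wordN-cong n (λ i i<n → e (suc i) (s≤s i<n)) (λ i i<n → e′ (suc i) (s≤s i<n)))

hd-wordN : ∀ n s r → hd (s n) (wordN n s r) ≡ s 0
hd-wordN zero s r = refl
hd-wordN (suc n) s r = refl

loc-wordN : ∀ n s r → (∀ i → i < n → ok3 (s i , r i) (s (suc i)) ≡ true) → loc (s n) (wordN n s r) ≡ true
loc-wordN zero s r f = refl
loc-wordN (suc n) s r f = ∧-true′ (≡.trans (≡.cong (ok3 (s 0 , r 0)) (hd-wordN n (s ∘ suc) (r ∘ suc))) (f 0 (s≤s z≤n)))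
  (loc-wordN n (s ∘ suc) (r ∘ suc) (λ i i<n → f (suc i) (s≤s i<n)))

loc-wordN′ : ∀ n s r → loc (s n) (wordN n s r) ≡ true → ∀ i → i < n → ok3 (s i , r i) (s (suc i)) ≡ true
loc-wordN′ (suc n) s r e zero _ = ≡.trans (≡.cong (ok3 (s 0 , r 0)) (≡.sym (hd-wordN n (s ∘ suc) (r ∘ suc)))) (proj₁ (∧-true e))
loc-wordN′ (suc n) s r e (suc i) (s≤s i<n) =
  loc-wordN′ n (s ∘ suc) (r ∘ suc) (proj₂ (∧-true {ok3 (s 0 , r 0) (hd (s (suc n)) (wordN n (s ∘ suc) (r ∘ suc)))} e)) i i<n

cuts# : List Bits → ℕ
cuts# [] = 0
cuts# ((_ , r) ∷ w) = #ᵇ (not r) ℕ.+ cuts# w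

cuts-wordN : ∀ n s r → cuts# (wordN n s r) ≡ count n (not ∘ r)
cuts-wordN zero s r = refl
cuts-wordN (suc n) s r = ≡.cong (#ᵇ (not (r 0)) ℕ.+_) (cuts-wordN n _ _)

-- In a local word the spoke bit is constant along rim edges that are present.
no-cuts-hd : ∀ σ w → loc σ w ≡ true → cuts# w ≡ 0 → hd σ w ≡ σ
no-cuts-hd σ [] _ _ = refl
no-cuts-hd σ ((true , true) ∷ w) e z = ≡.trans (≡.sym (proj₁ (∧-true e))) (no-cuts-hd σ w (proj₂ (∧-true {hd σ w} e)) z)
no-cuts-hd σ ((false , true) ∷ w) e z = ≡.trans (≡.sym (not-true (proj₁ (∧-true {not (hd σ w)} e)))) (no-cuts-hd σ w (proj₂ (∧-true {not (hd σ w)} e)) z)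

no-cuts-allmid : ∀ w → loc false w ≡ true → cuts# w ≡ 0 → allmid w ≡ true
no-cuts-allmid [] _ _ = refl
no-cuts-allmid ((true , true) ∷ w) e z = ⊥-elim (true≢false (≡.trans (≡.sym (proj₁ (∧-true e))) (no-cuts-hd false w (proj₂ (∧-true {hd false w} e)) z)))
no-cuts-allmid ((false , true) ∷ w) e z = no-cuts-allmid w (proj₂ (∧-true {not (hd false w)} e)) z

one-cut : ∀ w → loc false w ≡ true → hd false w ≡ false → cuts# w ≡ 1 → nohub w ≡ true × ends# w ≡ 1
one-cut ((false , true) ∷ w) e _ c = one-cut w (proj₂ (∧-true {not (hd false w)} e)) (not-true (proj₁ (∧-true {not (hd false w)} e))) c
one-cut ((false , false) ∷ w) e _ c = allmid-nohub w am , ≡.cong suc (ends-allmid w am)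
  where
  am : allmid w ≡ true
  am = no-cuts-allmid w e (ℕP.suc-injective c)

-- The remaining rim edges carry the hub to both sides of the only gap, and the triangle there would
-- contain two spokes without the rim edge.
one-cut-hub : ∀ w → loc true w ≡ true → hd true w ≡ true → cuts# w ≢ 1
one-cut-hub ((true , true) ∷ w) e _ c = one-cut-hub w (proj₂ (∧-true {hd true w} e)) (proj₁ (∧-true e)) c
one-cut-hub ((true , false) ∷ w) e _ c = true≢false (≡.trans (≡.sym (no-cuts-hd true w (proj₂ (∧-true {not (hd true w)} e)) (ℕP.suc-injective c)))
  (not-true (proj₁ (∧-true {not (hd true w)} e))))

one-cut-cyclic : ∀ w → loc (hd false w) w ≡ true → cuts# w ≡ 1 → nohub w ≡ true × ends# w ≡ 1
one-cut-cyclic ((true , r) ∷ w) e c = ⊥-elim (one-cut-hub ((true , r) ∷ w) e refl c)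
one-cut-cyclic ((false , r) ∷ w) e c = one-cut ((false , r) ∷ w) e refl c

-- The number of blocks, counted by their first vertices; p tells whether the rim edge before w is missing.
mins# : Bool → List Bits → ℕ
mins# p [] = 0
mins# p ((s , r) ∷ w) = #ᵇ (not s ∧ (p ∧ not (cuts# ((s , r) ∷ w) ≡ᵇ 0))) ℕ.+ mins# (not r) w

-- Blocks are counted by last vertices on the left and by first vertices on the right. The
-- correction is a block that entered `w` from before and ends in it; a block with no missing edge
-- left to end it is counted on neither side.
ends-mins : ∀ σ w p → loc σ w ≡ true → ends# w ≡ mins# p w ℕ.+ #ᵇ (not p ∧ (not (hd true w) ∧ not (cuts# w ≡ᵇ 0)))
ends-mins σ [] true e = refl
ends-mins σ [] false e = refl
ends-mins σ ((true , true) ∷ w) p e = ≡.trans (ends-mins σ w false (proj₂ (∧-true {hd σ w} e)))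
    (≡.trans (≡.cong (λ n → mins# false w ℕ.+ n) (next-hub w (proj₁ (∧-true e)))) (≡.cong (mins# false w ℕ.+_) (≡.cong #ᵇ (≡.sym (BP.∧-zeroʳ (not p))))))
  where
  next-hub : ∀ w → hd σ w ≡ true → #ᵇ (not (hd true w) ∧ not (cuts# w ≡ᵇ 0)) ≡ 0
  next-hub [] _ = refl
  next-hub ((true , _) ∷ _) _ = refl
ends-mins σ ((true , false) ∷ w) p e = ≡.trans (ends-mins σ w true (proj₂ (∧-true {not (hd σ w)} e)))
  (≡.cong (λ b → mins# true w ℕ.+ #ᵇ b) (≡.sym (BP.∧-zeroʳ (not p))))
ends-mins σ ((false , true) ∷ w) p e = ≡.trans (ends-mins σ w false (proj₂ (∧-true {not (hd σ w)} e)))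
    (≡.trans (≡.cong (λ n → mins# false w ℕ.+ n) (next w (not-true (proj₁ (∧-true {not (hd σ w)} e))))) (split p (cuts# w ≡ᵇ 0) (mins# false w)))
  where
  next : ∀ w → hd σ w ≡ false → #ᵇ (not (hd true w) ∧ not (cuts# w ≡ᵇ 0)) ≡ #ᵇ (not (cuts# w ≡ᵇ 0))
  next [] _ = refl
  next ((false , _) ∷ _) _ = refl
  split : ∀ p b m → m ℕ.+ #ᵇ (not b) ≡ #ᵇ (p ∧ not b) ℕ.+ m ℕ.+ #ᵇ (not p ∧ not b)
  split true b m = ≡.trans (ℕP.+-comm m _) (≡.sym (ℕP.+-identityʳ _))
  split false b m = refl
ends-mins σ ((false , false) ∷ w) p e = ≡.trans (≡.cong suc (≡.trans (ends-mins σ w true e) (ℕP.+-identityʳ _))) (split p (mins# true w))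
  where
  split : ∀ p m → suc m ≡ #ᵇ (p ∧ true) ℕ.+ m ℕ.+ #ᵇ (not p ∧ true)
  split true m = ≡.cong suc (≡.sym (ℕP.+-identityʳ m))
  split false m = ℕP.+-comm 1 m

minAt : ℕ → Bool → (ℕ → Bool) → (ℕ → Bool) → ℕ → Bool
minAt m p s r zero = not (s 0) ∧ (p ∧ not (count m (not ∘ r) ≡ᵇ 0))
minAt zero p s r (suc i) = false
minAt (suc m) p s r (suc i) = minAt m (not (r 0)) (s ∘ suc) (r ∘ suc) i

count-minAt : ∀ m p s r → count m (minAt m p s r) ≡ mins# p (wordN m s r)
count-minAt zero p s r = refl
count-minAt (suc m) p s r = ≡.cong₂ ℕ._+_
  (≡.cong (λ c → #ᵇ (not (s 0) ∧ (p ∧ not (c ≡ᵇ 0)))) (≡.sym (cuts-wordN (suc m) s r))) (count-minAt m (not (r 0)) (s ∘ suc) (r ∘ suc))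

-- Replaces the condition on the suffix, that a missing edge is still to come, by a comparison of a
-- prefix count with the total, as in `firstIn`.
minAt-suc : ∀ m p s r i → suc i < m → minAt m p s r (suc i) ≡
  not (s (suc i)) ∧ (not (r i) ∧ not (count (suc i) (not ∘ r) ≡ᵇ count m (not ∘ r)))
minAt-suc (suc m) p s r zero (s≤s lt) = ≡.cong (λ b → not (s 1) ∧ (not (r 0) ∧ not b)) (cancel (not (r 0)) (count m (not ∘ r ∘ suc)))
  where
  cancel : ∀ b k → (k ≡ᵇ 0) ≡ (#ᵇ b ℕ.+ 0 ≡ᵇ #ᵇ b ℕ.+ k)
  cancel true zero = refl
  cancel true (suc k) = refl
  cancel false zero = refl
  cancel false (suc k) = refl
minAt-suc (suc m) p s r (suc i) (s≤s lt) = ≡.trans (minAt-suc m (not (r 0)) (s ∘ suc) (r ∘ suc) i lt)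
  (≡.cong (λ b → not (s (suc (suc i))) ∧ (not (r (suc i)) ∧ not b)) (cancel (not (r 0)) _ _))
  where
  cancel : ∀ b k l → (k ≡ᵇ l) ≡ (#ᵇ b ℕ.+ k ≡ᵇ #ᵇ b ℕ.+ l)
  cancel true k l = refl
  cancel false k l = refl

count-snoc : ∀ n p → count (suc n) p ≡ count n p ℕ.+ #ᵇ (p n)
count-snoc zero p = ℕP.+-identityʳ _
count-snoc (suc n) p = ≡.trans (≡.cong (#ᵇ (p 0) ℕ.+_) (count-snoc n (p ∘ suc))) (≡.sym (ℕP.+-assoc (#ᵇ (p 0)) _ _))

count-suc : ∀ n p → count n p ≤ count (suc n) p
count-suc n p = ≡.subst (count n p ≤_) (≡.sym (count-snoc n p)) (ℕP.m≤m+n _ _)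

count-≤′ : ∀ {k n} p → k ≤ n → count k p ≤ count n p
count-≤′ {k} p k≤n = go (ℕP.≤⇒≤′ k≤n)
  where
  go : ∀ {n} → k ℕ.≤′ n → count k p ≤ count n p
  go ℕ.≤′-refl = ℕP.≤-refl
  go {suc n} (ℕ.≤′-step le) = ℕP.≤-trans (go le) (count-suc n p)

nth : ∀ {k} → Subset k → ℕ → Bool
nth {zero} F i = false
nth {suc k} F zero = F zero
nth {suc k} F (suc i) = nth (F ∘ suc) i

nth-toℕ : ∀ {k} (F : Subset k) i → nth F (toℕ i) ≡ F i
nth-toℕ F zero = refl
nth-toℕ F (suc i) = nth-toℕ (F ∘ suc) i

nth-< : ∀ {k} (F : Subset k) {i} (i<k : i < k) → nth F i ≡ F (fromℕ< i<k)
nth-< F {i} i<k = ≡.trans (≡.cong (nth F) (≡.sym (FP.toℕ-fromℕ< i<k))) (nth-toℕ F (fromℕ< i<k))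

≡ᵇ-false : ∀ {a b} → a ≢ b → (a ≡ᵇ b) ≡ false
≡ᵇ-false {a} {b} ne = ≢true λ e → ne (≡ᵇ-true a b e)

module Wheel (N : ℕ) where

  n : ℕ
  n = suc N

  Γ : Graph
  Γ = wheelGen n

  spoke rim : Fin n → Fin (n ℕ.+ n)
  spoke i = i ↑ˡ n
  rim i = n ↑ʳ i

  ends-spoke : ∀ i → ends Γ (spoke i) ≡ (0 , suc (toℕ i))
  ends-spoke i rewrite FP.splitAt-↑ˡ n i n = refl

  ends-rim : ∀ i → ends Γ (rim i) ≡ (suc (toℕ i) , rimNext n (toℕ i))
  ends-rim i rewrite FP.splitAt-↑ʳ n n i = refl

  data Edge : Fin (n ℕ.+ n) → Set where
    spoke′ : ∀ i → Edge (spoke i)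
    rim′ : ∀ i → Edge (rim i)

  edge : ∀ e → Edge e
  edge e with splitAt n e in eq
  ... | inj₁ i = ≡.subst Edge (FP.splitAt⁻¹-↑ˡ eq) (spoke′ i)
  ... | inj₂ i = ≡.subst Edge (FP.splitAt⁻¹-↑ʳ eq) (rim′ i)

  -- Rim vertices are numbered from 0 here, cyclically: index n is index 0 again.
  vert : ℕ → ℕ
  vert i = if i ≡ᵇ n then 1 else suc i

  vert-< : ∀ {i} → i < n → vert i ≡ suc i
  vert-< {i} i<n = ≡.cong (λ b → if b then 1 else suc i) (≡ᵇ-false (ℕP.<⇒≢ i<n))

  vert-n : vert n ≡ 1
  vert-n = ≡.cong (λ b → if b then 1 else suc n) (≡ᵇ-refl n)

  vert-bound : ∀ {i} → i ≤ n → vert i < suc n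
  vert-bound {i} i≤n with i ≡ᵇ n in eq
  ... | true = s≤s (s≤s z≤n)
  ... | false = s≤s (ℕP.≤∧≢⇒< i≤n λ { refl → true≢false (≡.trans (≡.sym (≡ᵇ-refl n)) eq) })

  ends<V : ∀ e → proj₁ (ends Γ e) < suc n × proj₂ (ends Γ e) < suc n
  ends<V e with edge e
  ... | spoke′ i rewrite ends-spoke i = s≤s z≤n , s≤s (FP.toℕ<n i)
  ... | rim′ i rewrite ends-rim i = s≤s (FP.toℕ<n i) , vert-bound {suc (toℕ i)} (FP.toℕ<n i)

  open Connectivity Γ ends<V

  -- Index `n` repeats index 0 for the spokes, so that the triangle rule at `i` and `i + 1` covers
  -- the closing rim edge too.
  spokes rims : Subset (n ℕ.+ n) → ℕ → Bool
  spokes F i = if i ≡ᵇ n then F (spoke zero) else nth (F ∘ spoke) i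
  rims F = nth (F ∘ rim)

  word : Subset (n ℕ.+ n) → List Bits
  word F = wordN n (spokes F) (rims F)

  module _ (F : Subset (n ℕ.+ n)) where

    s r : ℕ → Bool
    s = spokes F
    r = rims F

    s-< : ∀ {i} (i<n : i < n) → s i ≡ F (spoke (fromℕ< i<n))
    s-< {i} i<n = ≡.trans (≡.cong (λ b → if b then F (spoke zero) else nth (F ∘ spoke) i) (≡ᵇ-false (ℕP.<⇒≢ i<n))) (nth-< (F ∘ spoke) i<n)

    s-n : s n ≡ s 0
    s-n = ≡.cong (λ b → if b then F (spoke zero) else nth (F ∘ spoke) n) (≡ᵇ-refl n)

    r-< : ∀ {i} (i<n : i < n) → r i ≡ F (rim (fromℕ< i<n))
    r-< i<n = nth-< (F ∘ rim) i<n

    cloc-word : loc (hd false (word F)) (word F) ≡ loc (s n) (word F)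
    cloc-word = ≡.cong (λ b → loc b (word F)) (≡.sym s-n)

    spoke-src : ∀ {i} (i<n : i < n) → src (spoke (fromℕ< i<n)) ≡ 0
    spoke-src i<n = ≡.cong proj₁ (ends-spoke (fromℕ< i<n))
    spoke-tgt : ∀ {i} (i<n : i < n) → tgt (spoke (fromℕ< i<n)) ≡ vert i
    spoke-tgt i<n = ≡.trans (≡.cong proj₂ (ends-spoke (fromℕ< i<n))) (≡.trans (≡.cong suc (FP.toℕ-fromℕ< i<n)) (≡.sym (vert-< i<n)))
    rim-src : ∀ {i} (i<n : i < n) → src (rim (fromℕ< i<n)) ≡ vert i
    rim-src i<n = ≡.trans (≡.cong proj₁ (ends-rim (fromℕ< i<n))) (≡.trans (≡.cong suc (FP.toℕ-fromℕ< i<n)) (≡.sym (vert-< i<n)))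
    rim-tgt : ∀ {i} (i<n : i < n) → tgt (rim (fromℕ< i<n)) ≡ vert (suc i)
    rim-tgt i<n = ≡.trans (≡.cong proj₂ (ends-rim (fromℕ< i<n))) (≡.cong (rimNext n) (FP.toℕ-fromℕ< i<n))

    conn-spoke : ∀ {i} → i ≤ n → s i ≡ true → Conn F 0 (vert i)
    conn-spoke {i} i≤n e with ℕP.m≤n⇒m<n∨m≡n i≤n
    ... | inj₁ i<n = ≡.subst₂ (Conn F) (spoke-src i<n) (spoke-tgt i<n) (stop ▹ fwd _ (≡.trans (≡.sym (s-< i<n)) e))
    ... | inj₂ refl = ≡.subst₂ (Conn F) (spoke-src 0<n) (≡.trans (spoke-tgt 0<n) (≡.trans (vert-< 0<n) (≡.sym vert-n)))
        (stop ▹ fwd _ (≡.trans (≡.sym (s-< 0<n)) (≡.trans (≡.sym s-n) e)))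
      where
      0<n : 0 < n
      0<n = s≤s z≤n

    conn-rim : ∀ {j} → j < n → r j ≡ true → Conn F (vert j) (vert (suc j))
    conn-rim j<n e = ≡.subst₂ (Conn F) (rim-src j<n) (rim-tgt j<n) (stop ▹ fwd _ (≡.trans (≡.sym (r-< j<n)) e))

    closed-spoke : Closed F → ∀ {i} → i ≤ n → Conn F 0 (vert i) → s i ≡ true
    closed-spoke cF {i} i≤n c with ℕP.m≤n⇒m<n∨m≡n i≤n
    ... | inj₁ i<n = ≡.trans (s-< i<n) (cF _ (≡.subst₂ (Conn F) (≡.sym (spoke-src i<n)) (≡.sym (spoke-tgt i<n)) c))
    ... | inj₂ refl = ≡.trans s-n (≡.trans (s-< (s≤s z≤n)) (cF _ (≡.subst₂ (Conn F) (≡.sym (spoke-src {0} (s≤s z≤n)))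
        (≡.trans vert-n (≡.trans (≡.sym (vert-< {0} (s≤s z≤n))) (≡.sym (spoke-tgt {0} (s≤s z≤n))))) c)))

    closed-rim : Closed F → ∀ {j} → j < n → Conn F (vert j) (vert (suc j)) → r j ≡ true
    closed-rim cF j<n c = ≡.trans (r-< j<n) (cF _ (≡.subst₂ (Conn F) (≡.sym (rim-src j<n)) (≡.sym (rim-tgt j<n)) c))

    closed→local : Closed F → loc (s n) (word F) ≡ true
    closed→local cF = loc-wordN n s r λ i i<n → cases i i<n (s i) refl (r i) refl
      where
      cases : ∀ i → i < n → ∀ a → s i ≡ a → ∀ b → r i ≡ b → ok3 (a , b) (s (suc i)) ≡ true
      cases i i<n true sa true rb = closed-spoke cF i<n (conn-trans (conn-spoke (ℕP.<⇒≤ i<n) sa) (conn-rim i<n rb))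
      cases i i<n true sa false rb = not-true′ λ e → true≢false (≡.trans (≡.sym (closed-rim cF i<n
        (conn-trans (conn-sym (conn-spoke (ℕP.<⇒≤ i<n) sa)) (conn-spoke i<n e)))) rb)
      cases i i<n false sa true rb = not-true′ λ e → true≢false (≡.trans (≡.sym (closed-spoke cF (ℕP.<⇒≤ i<n)
        (conn-trans (conn-spoke i<n e) (conn-sym (conn-rim i<n rb))))) sa)
      cases i i<n false sa false rb = refl

    module Local (lc : loc (s n) (word F) ≡ true) where

      rule : ∀ i → i < n → ok3 (s i , r i) (s (suc i)) ≡ true
      rule = loc-wordN′ n s r lc

      κ : ℕ → ℕ
      κ i = count i (not ∘ r)

      c : ℕ
      c = κ n

      κ-cut : ∀ i → r i ≡ false → κ (suc i) ≡ suc (κ i)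
      κ-cut i e = ≡.trans (count-snoc i (not ∘ r)) (≡.trans (≡.cong (λ b → κ i ℕ.+ #ᵇ (not b)) e) (ℕP.+-comm (κ i) 1))

      κ-no-cut : ∀ i → r i ≡ true → κ (suc i) ≡ κ i
      κ-no-cut i e = ≡.trans (count-snoc i (not ∘ r)) (≡.trans (≡.cong (λ b → κ i ℕ.+ #ᵇ (not b)) e) (ℕP.+-identityʳ (κ i)))

      wrap : ℕ → ℕ
      wrap k = if k ≡ᵇ c then 0 else k

      wrap-< : ∀ k → k < c → wrap k ≡ k
      wrap-< k k<c = ≡.cong (λ b → if b then 0 else k) (≡ᵇ-false (ℕP.<⇒≢ k<c))

      -- A component invariant: 0 at a hub, otherwise one more than the number of missing rim edges
      -- passed. Having passed all `c` of them counts as having passed none, since the last block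
      -- runs on into the first.
      label : ℕ → ℕ
      label i = if s i then 0 else suc (wrap (κ i))

      label-hub : ∀ i → s i ≡ true → label i ≡ 0
      label-hub i e = ≡.cong (λ b → if b then 0 else suc (wrap (κ i))) e

      label-rim : ∀ i → s i ≡ false → label i ≡ suc (wrap (κ i))
      label-rim i e = ≡.cong (λ b → if b then 0 else suc (wrap (κ i))) e

      label-n : label n ≡ label 0
      label-n = ≡.cong₂ (λ b k → if b then 0 else suc k) s-n (≡.trans wrap-c (≡.sym wrap-0))
        where
        wrap-c : wrap c ≡ 0
        wrap-c = ≡.cong (λ b → if b then 0 else c) (≡ᵇ-refl c)
        wrap-0 : wrap 0 ≡ 0
        wrap-0 with 0 ≡ᵇ c
        ... | true = refl
        ... | false = refl

      L : ℕ → ℕ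
      L zero = 0
      L (suc i) = label i

      L-vert : ∀ {i} → i ≤ n → L (vert i) ≡ label i
      L-vert {i} i≤n with ℕP.m≤n⇒m<n∨m≡n i≤n
      ... | inj₁ i<n = ≡.cong L (vert-< i<n)
      ... | inj₂ refl = ≡.trans (≡.cong L vert-n) (≡.sym label-n)

      label-step : ∀ {j} → j < n → r j ≡ true → label j ≡ label (suc j)
      label-step {j} j<n e = ≡.cong₂ (λ b k → if b then 0 else suc (wrap k)) (same (s j) refl) (≡.sym (κ-no-cut j e))
        where
        same : ∀ b → s j ≡ b → s j ≡ s (suc j)
        same true sj = ≡.trans sj (≡.sym (≡.trans (≡.cong (λ p → ok3 p (s (suc j))) (≡.cong₂ _,_ (≡.sym sj) (≡.sym e))) (rule j j<n)))
        same false sj = ≡.trans sj (≡.sym (not-true (≡.trans (≡.cong (λ p → ok3 p (s (suc j))) (≡.cong₂ _,_ (≡.sym sj) (≡.sym e))) (rule j j<n))))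

      conn-label : ∀ {x y} → Conn F x y → L x ≡ L y
      conn-label = invariant L λ e Fe → inv e (edge e) Fe
        where
        inv : ∀ e → Edge e → F e ≡ true → L (src e) ≡ L (tgt e)
        inv _ (spoke′ i) Fe rewrite ends-spoke i = ≡.sym (label-hub (toℕ i) (≡.trans (s-< (FP.toℕ<n i)) (≡.trans (≡.cong (F ∘ spoke) (FP.fromℕ<-toℕ i (FP.toℕ<n i))) Fe)))
        inv _ (rim′ i) Fe rewrite ends-rim i = ≡.trans (label-step (FP.toℕ<n i) (≡.trans (nth-toℕ (F ∘ rim) i) Fe)) (≡.sym (L-vert {suc (toℕ i)} (FP.toℕ<n i)))

      -- Across a missing edge a hub must face a non-hub, where the labels differ, or both sides are
      -- non-hubs and the count rises by one modulo `c`, which changes it unless `c = 1`.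
      separated-rim : ∀ {j} → j < n → r j ≡ false → label j ≡ label (suc j) → c ≡ 1
      separated-rim {j} j<n rj e = cases (s j) refl (s (suc j)) refl
        where
        rule-j : ∀ {b} → s j ≡ b → ok3 (b , false) (s (suc j)) ≡ true
        rule-j sj = ≡.trans (≡.cong (λ p → ok3 p (s (suc j))) (≡.cong₂ _,_ (≡.sym sj) (≡.sym rj))) (rule j j<n)
        κj<c : suc (κ j) ≤ c
        κj<c = ≡.subst (_≤ c) (κ-cut j rj) (count-≤′ (not ∘ r) j<n)
        cases : ∀ a → s j ≡ a → ∀ b → s (suc j) ≡ b → c ≡ 1
        cases true sj true sj′ = ⊥-elim (true≢false (≡.trans (≡.sym (rule-j sj)) (≡.cong not sj′)))
        cases true sj false sj′ = ⊥-elim (ℕP.0≢1+n (≡.trans (≡.sym (label-hub j sj)) (≡.trans e (label-rim (suc j) sj′))))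
        cases false sj true sj′ = ⊥-elim (ℕP.0≢1+n (≡.trans (≡.sym (label-hub (suc j) sj′)) (≡.trans (≡.sym e) (label-rim j sj))))
        cases false sj false sj′ with ℕP.m≤n⇒m<n∨m≡n κj<c
        ... | inj₁ lt = ⊥-elim (ℕP.1+n≢n (≡.sym (≡.trans (≡.sym (wrap-< (κ j) κj<c)) (≡.trans wraps (≡.trans (≡.cong wrap (κ-cut j rj)) (wrap-< (suc (κ j)) lt))))))
          where
          wraps : wrap (κ j) ≡ wrap (κ (suc j))
          wraps = ℕP.suc-injective (≡.trans (≡.sym (label-rim j sj)) (≡.trans e (label-rim (suc j) sj′)))
        ... | inj₂ eq = ≡.trans (≡.sym eq) (≡.cong suc (≡.trans (≡.sym (wrap-< (κ j) κj<c)) (≡.trans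
              (ℕP.suc-injective (≡.trans (≡.sym (label-rim j sj)) (≡.trans e (label-rim (suc j) sj′))))
              (≡.trans (≡.cong wrap (≡.trans (κ-cut j rj) eq)) (≡.cong (λ b → if b then 0 else c) (≡ᵇ-refl c))))))

      -- The excluded word is the rim with one edge missing, whose ends are connected the long way
      -- round.
      local→closed : ¬ (nohub (word F) ≡ true × ends# (word F) ≡ 1) → Closed F
      local→closed not-one e c-e = out e (edge e) c-e
        where
        out : ∀ e → Edge e → Conn F (src e) (tgt e) → F e ≡ true
        out _ (spoke′ i) cn rewrite ends-spoke i = ≡.trans (≡.sym (≡.trans (s-< (FP.toℕ<n i)) (≡.cong (F ∘ spoke) (FP.fromℕ<-toℕ i (FP.toℕ<n i))))) (at-hub (s (toℕ i)) refl)
          where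
          at-hub : ∀ b → s (toℕ i) ≡ b → s (toℕ i) ≡ true
          at-hub true e = e
          at-hub false e = ⊥-elim (ℕP.0≢1+n (≡.trans (conn-label cn) (label-rim (toℕ i) e)))
        out _ (rim′ i) cn rewrite ends-rim i = ≡.trans (≡.sym (nth-toℕ (F ∘ rim) i)) (present (r (toℕ i)) refl)
          where
          present : ∀ b → r (toℕ i) ≡ b → r (toℕ i) ≡ true
          present true e = e
          present false e = ⊥-elim (not-one (one-cut-cyclic (word F) (≡.trans cloc-word lc) (≡.trans (cuts-wordN n s r)
            (separated-rim (FP.toℕ<n i) e (≡.trans (conn-label cn) (L-vert {suc (toℕ i)} (FP.toℕ<n i)))))))

      -- Behind the last missing edge the rim leads without a gap to index `n`, which is vertex 1
      -- again. A block starting there is not new, which explains the last condition in `firstIn`.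
      conn-end : ∀ d i → d ℕ.+ i ≡ n → κ i ≡ c → Conn F (vert i) (vert n)
      conn-end zero i refl _ = stop
      conn-end (suc d) i e κ-eq = conn-trans (conn-rim i<n (present (r i) refl))
          (conn-end d (suc i) (≡.trans (ℕP.+-suc d i) e) (ℕP.≤-antisym (count-≤′ (not ∘ r) i<n) (≡.subst (_≤ κ (suc i)) κ-eq (count-suc i (not ∘ r)))))
        where
        i<n : i < n
        i<n = ≡.subst (i <_) e (s≤s (ℕP.m≤n+m i d))
        present : ∀ b → r i ≡ b → r i ≡ true
        present true p = p
        present false p = ⊥-elim (ℕP.<-irrefl κ-eq (≡.subst (_≤ c) (κ-cut i p) (count-≤′ (not ∘ r) i<n)))

      firstIn : ℕ → Bool
      firstIn zero = not (s 0)
      firstIn (suc i) = not (s (suc i)) ∧ (not (r i) ∧ not (κ (suc i) ≡ᵇ c))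

      isMin-word : ∀ i → i < n → isMin F (suc i) ≡ firstIn i
      isMin-word i i<n = bool-iff (to i i<n) (from i i<n)
        where
        hub-free : ∀ i → i < n → isMin F (suc i) ≡ true → not (s i) ≡ true
        hub-free i i<n m = not-true′ λ e → min-true (s≤s i<n) m 0 (s≤s z≤n) (conn-sym (≡.subst (Conn F 0) (vert-< i<n) (conn-spoke (ℕP.<⇒≤ i<n) e)))
        to : ∀ i → i < n → isMin F (suc i) ≡ true → firstIn i ≡ true
        to zero i<n m = hub-free 0 i<n m
        to (suc i) i<n m = ∧-true′ (hub-free (suc i) i<n m) (∧-true′
          (not-true′ λ e → min-true (s≤s i<n) m (suc i) ℕP.≤-refl
            (conn-sym (≡.subst₂ (Conn F) (vert-< (ℕP.<-trans ℕP.≤-refl i<n)) (vert-< i<n) (conn-rim (ℕP.<-trans ℕP.≤-refl i<n) e))))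
          (not-true′ λ e → min-true (s≤s i<n) m 1 (s≤s (s≤s z≤n))
            (≡.subst₂ (Conn F) (vert-< i<n) vert-n (conn-end (n ∸ suc i) (suc i) (ℕP.m∸n+n≡m (ℕP.<⇒≤ i<n)) (≡ᵇ-true _ _ e)))))
        from : ∀ i → i < n → firstIn i ≡ true → isMin F (suc i) ≡ true
        from zero i<n f = min-true′ λ { zero _ cn → ℕP.0≢1+n (≡.sym (≡.trans (≡.sym (label-rim 0 (not-true f))) (conn-label cn))) ; (suc y) (s≤s ()) _ }
        from (suc i) i<n f = min-true′ λ y y< cn → apart y y< (≡.trans (≡.sym lab) (conn-label cn))
          where
          si : s (suc i) ≡ false
          si = not-true (proj₁ (∧-true f))
          ri : r i ≡ false
          ri = not-true (proj₁ (∧-true (proj₂ (∧-true {not (s (suc i))} f))))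
          κ≢c : (κ (suc i) ≡ᵇ c) ≡ false
          κ≢c = not-true (proj₂ (∧-true {not (r i)} (proj₂ (∧-true {not (s (suc i))} f))))
          κ<c : κ (suc i) < c
          κ<c = ℕP.≤∧≢⇒< (count-≤′ (not ∘ r) (ℕP.<⇒≤ i<n)) λ e → true≢false (≡.trans (≡.sym (≡.trans (≡.cong (κ (suc i) ≡ᵇ_) (≡.sym e)) (≡ᵇ-refl (κ (suc i))))) κ≢c)
          lab : label (suc i) ≡ suc (κ (suc i))
          lab = ≡.trans (label-rim (suc i) si) (≡.cong suc (wrap-< (κ (suc i)) κ<c))
          apart : ∀ y → y < suc (suc i) → suc (κ (suc i)) ≡ L y → ⊥
          apart (suc k) (s≤s (s≤s k≤i)) e = at (s k) refl
            where
            κk : κ k < κ (suc i)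
            κk = ≡.subst (κ k <_) (≡.sym (κ-cut i ri)) (s≤s (count-≤′ (not ∘ r) k≤i))
            at : ∀ b → s k ≡ b → ⊥
            at true sk = ℕP.1+n≢0 (≡.trans e (label-hub k sk))
            at false sk = ℕP.<-irrefl (≡.sym (ℕP.suc-injective (≡.trans e (≡.trans (label-rim k sk) (≡.cong suc (wrap-< (κ k) (ℕP.<-trans κk κ<c))))))) κk

      -- `firstIn` and `minAt` can differ only at index 0, and do so exactly when no rim edge is
      -- missing and the first vertex has no spoke. That is the `allmid` summand of `crk#`.
      count-first : count n firstIn ≡ crk# (word F)
      count-first = ≡.trans (≡.cong₂ ℕ._+_ head tail-eq) (≡.trans (rearrange (#ᵇ (s0 ∧ not b)) (#ᵇ (s0 ∧ b)) (count N (minAt n true s r ∘ suc)))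
          (≡.cong₂ ℕ._+_ (≡.trans (count-minAt n true s r) (≡.sym (≡.trans (ends-mins (s n) (word F) true lc) (ℕP.+-identityʳ _)))) (≡.cong #ᵇ all-mid)))
        where
        s0 b : Bool
        s0 = not (s 0)
        b = c ≡ᵇ 0
        head : #ᵇ (firstIn 0) ≡ #ᵇ (s0 ∧ not b) ℕ.+ #ᵇ (s0 ∧ b)
        head = split s0 b
          where
          split : ∀ a b → #ᵇ a ≡ #ᵇ (a ∧ not b) ℕ.+ #ᵇ (a ∧ b)
          split true true = refl
          split true false = refl
          split false _ = refl
        tail-eq : count N (firstIn ∘ suc) ≡ count N (minAt n true s r ∘ suc)
        tail-eq = count-cong N λ i i<N → ≡.sym (minAt-suc n true s r i (s≤s i<N))
        rearrange : ∀ x y z → x ℕ.+ y ℕ.+ z ≡ x ℕ.+ z ℕ.+ y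
        rearrange x y z = ≡.trans (ℕP.+-assoc x y z) (≡.trans (≡.cong (x ℕ.+_) (ℕP.+-comm y z)) (≡.sym (ℕP.+-assoc x z y)))
        all-mid : s0 ∧ b ≡ allmid (word F)
        all-mid = bool-iff
          (λ e → no-cuts-allmid (word F) (≡.subst (λ σ → loc σ (word F) ≡ true) (≡.trans s-n (not-true (proj₁ (∧-true e)))) lc)
            (≡.trans (cuts-wordN n s r) (≡ᵇ-true c 0 (proj₂ (∧-true {s0} e)))))
          (λ e → ∧-true′ (≡.cong not (hd-allmid (word F) e)) (≡.cong (_≡ᵇ 0) (≡.trans (≡.sym (cuts-wordN n s r)) (allmid-cuts (word F) e))))
          where
          allmid-cuts : ∀ w → allmid w ≡ true → cuts# w ≡ 0
          allmid-cuts [] _ = refl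
          allmid-cuts ((false , true) ∷ w) e = allmid-cuts w e

      -- The centre is vertex 0, hence least in its component: it adds one to the number of
      -- components and cancels the extra vertex.
      rank-word : rank F ≡ n ∸ crk# (word F)
      rank-word = ≡.trans (rank-comps F) (≡.cong₂ (λ a k → suc n ∸ (a ℕ.+ k)) (≡.cong #ᵇ (min-true′ {F} {0} λ _ ()))
        (≡.trans (count-cong n isMin-word) count-first))

      crk-≤ : crk# (word F) ≤ n
      crk-≤ = ≡.subst (_≤ n) count-first (count-≤ n firstIn)

-- The fan and wheel series

open KU using (_≈_; _+_; _*_; _-_; -_)

t̂ û one : Ser
t̂ = Su.const tP
û = Su.var
one = Su.const (ℤt.const (+ 1))

û-shift : ∀ f → û * f ≈ Su.shift f
û-shift f = Su.eqv (Su.mul-var f)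

minus-zero : ∀ a → a KT.- KT.0# KT.≈ a
minus-zero a = ℤt.eqv λ n → ℤP.+-identityʳ (a n)

-- Motzkin paths, counted by length (variable) and number of up steps (t).
motzkinStep : Ser → Ser
motzkinStep m n = one n KT.+ Su.shift (λ i → m i KT.+ (t̂ * Su.shift (m * m)) i) n

motzkin : Ser
motzkin = Su.fix motzkinStep

motzkin-fix : motzkin ≈ motzkinStep motzkin
motzkin-fix = Su.fix-eq {motzkinStep} λ n f g p m m<n → KT.+-congˡ {one m} (Su.agree-shift
  (λ i i<n → KT.+-cong (p i i<n) (Su.agree-mul {f = t̂} {t̂} (λ _ _ → KT.refl)
    (λ j j<n → Su.agree-shift (Su.agree-mul p p) j (ℕP.m<n⇒m<1+n j<n)) i i<n)) m m<n)

-- In the recursion each factor `t` comes with two factors of the variable, as an up step with its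
-- down step.
half-motzkin : HalfS motzkin
half-motzkin = Halfs.all-strong {motzkin} {motzkin} λ n ih → let h = step n (λ i i<n → proj₁ (ih i i<n)) in h , h
  where
  step : ∀ n → (∀ i → i < n → Half i (motzkin i)) → Half n (motzkin n)
  step zero _ = resp (KT.sym (Su.at motzkin-fix 0)) (add (const (+ 1)) half-zero)
  step (suc zero) ih = resp (KT.sym (Su.at motzkin-fix 1))
    (add half-zero (add (half-raise 1 (ih 0 (s≤s z≤n))) (resp (KT.sym (KT.zeroʳ _)) half-zero)))
  step (suc (suc n)) ih = resp (KT.sym (Su.at motzkin-fix (suc (suc n))))
    (add half-zero (add (half-raise 1 (ih (suc n) ℕP.≤-refl))
      (resp (KT.sym (Su.mul-const tP _ (suc n)))
        (t· (proj₁ (Halfs.upto-mul {suc n} {0} {0} {motzkin} {motzkin} {motzkin} {motzkin} below below n ℕP.≤-refl))))))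
    where
    below : Halfs.Upto (suc n) 0 motzkin motzkin
    below i i<n = ih i (ℕP.m<n⇒m<1+n i<n) , ih i (ℕP.m<n⇒m<1+n i<n)

x : Ser
x = Su.shift motzkin

motzkin-eq : motzkin ≈ one + û * (motzkin + t̂ * (û * (motzkin * motzkin)))
motzkin-eq = KU.trans motzkin-fix (KU.+-congˡ {one} (KU.trans
  (KU.sym (û-shift (motzkin + t̂ * Su.shift (motzkin * motzkin))))
  (KU.*-congˡ {û} (KU.+-congˡ {motzkin} (KU.*-congˡ {t̂} (KU.sym (û-shift (motzkin * motzkin))))))))

x-eq : x ≈ û * (one + x + t̂ * x * x)
x-eq = KU.trans (KU.sym (û-shift motzkin)) (KU.trans
  (Narayana.from-motzkin Su.series Su.const-hom t̂ û motzkin motzkin-eq)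
  (KU.*-congˡ {û} (KU.+-cong (KU.+-congˡ {one} (û-shift motzkin)) (KU.*-cong (KU.*-congˡ {t̂} (û-shift motzkin)) (û-shift motzkin)))))

-- fan k: the Kazhdan–Lusztig polynomial of the fan with k rim vertices.
fan : Ser
fan = one + x

open Su.Substitution tP

T-congˢ : ∀ {f g} → f ≈ g → T f ≈ T g
T-congˢ p = Su.eqv (T-cong (Su.at p))

T-*ˢ : ∀ f g → T (f * g) ≈ T f * T g
T-*ˢ f g = Su.eqv (T-mul f g)

T-+ˢ : ∀ f g → T (f + g) ≈ T f + T g
T-+ˢ f g = Su.eqv (T-+ f g)

T-constˢ : ∀ c → T (Su.const c) ≈ Su.const c
T-constˢ c = Su.eqv (T-const c)

T-tailˢ : ∀ f → (T f - Su.const (f 0)) * (one - t̂ * û) ≈ û * T (Su.tail f)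
T-tailˢ f = Narayana.subst-tail Su.series Su.const-hom t̂ û (T f - Su.const (f 0)) N (T (Su.tail f)) head
    (KU.trans (Su.eqv (T-tail f)) (KU.+-congˡ {T (Su.tail f)}
      (KU.trans (Su.eqv λ n → KT.sym (Su.mul-const tP (Su.shift N) n)) (KU.*-congˡ {t̂} (KU.sym (û-shift N))))))
  where
  N : Ser
  N = Su.tail (T f)
  head : T f - Su.const (f 0) ≈ û * N
  head = KU.trans (Su.eqv λ { zero → KT.-‿inverseʳ (f 0) ; (suc n) → minus-zero (T f (suc n)) }) (KU.sym (û-shift N))

T-û : ∀ f → T (û * f) * (one - t̂ * û) ≈ û * T f
T-û f = KU.trans (KU.*-congʳ {one - t̂ * û} (KU.trans (T-congˢ (û-shift f)) minus)) (T-tailˢ (Su.shift f))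
  where
  minus : T (Su.shift f) ≈ T (Su.shift f) - Su.const KT.0#
  minus = Su.eqv λ { zero → KT.sym (minus-zero _) ; (suc n) → KT.sym (minus-zero (T (Su.shift f) (suc n))) }

X : Ser
X = T x

X-eq : X * (one - t̂ * û) ≈ û * (one + X + t̂ * X * X)
X-eq = KU.trans (KU.*-congʳ {one - t̂ * û} (T-congˢ x-eq)) (KU.trans (T-û (one + x + t̂ * x * x)) (KU.*-congˡ {û}
  (KU.trans (T-+ˢ (one + x) (t̂ * x * x)) (KU.+-cong (KU.trans (T-+ˢ one x) (KU.+-congʳ {X} (T-constˢ _)))
      (KU.trans (T-*ˢ (t̂ * x) x) (KU.*-congʳ {X} (KU.trans (T-*ˢ t̂ x) (KU.*-congʳ {X} (T-constˢ tP)))))))))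

i v I J Vi : Ser
i = Su.inv (one + x)
v = Su.inv (one - t̂ * x * x)
I = Su.inv (one + X)
J = Su.inv (one + t̂ * X)
Vi = Su.inv (one - t̂ * X * X)

i-eq : (one + x) * i ≈ one
i-eq = Su.mul-inv _ (KT.+-identityʳ _)

v-eq : (one - t̂ * x * x) * v ≈ one
v-eq = Su.mul-inv _ (KT.trans (KT.+-congˡ {KT.1#} (KT.-‿cong (KT.zeroʳ ((t̂ * x) 0)))) (minus-zero KT.1#))

I-eq : (one + X) * I ≈ one
I-eq = Su.mul-inv _ (KT.+-identityʳ _)

J-eq : (one + t̂ * X) * J ≈ one
J-eq = Su.mul-inv _ (KT.trans (KT.+-congˡ {KT.1#} (KT.zeroʳ tP)) (KT.+-identityʳ _))

V-eq : (one - t̂ * X * X) * Vi ≈ one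
V-eq = Su.mul-inv _ (KT.trans (KT.+-congˡ {KT.1#} (KT.-‿cong (KT.zeroʳ ((t̂ * X) 0)))) (minus-zero KT.1#))

inverse-unique : ∀ a b c → a * b ≈ one → a * c ≈ one → b ≈ c
inverse-unique = Narayana.inverse-unique Su.series Su.const-hom

T-i : T i ≈ I
T-i = inverse-unique (one + X) (T i) I
  (KU.trans (KU.*-congʳ {T i} (KU.sym (KU.trans (T-+ˢ one x) (KU.+-congʳ {X} (T-constˢ _)))))
    (KU.trans (KU.sym (T-*ˢ (one + x) i)) (KU.trans (T-congˢ i-eq) (T-constˢ _)))) I-eq

T-txx : T (t̂ * x * x) ≈ t̂ * X * X
T-txx = KU.trans (T-*ˢ (t̂ * x) x) (KU.*-congʳ {X} (KU.trans (T-*ˢ t̂ x) (KU.*-congʳ {X} (T-constˢ tP))))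

T-v : T v ≈ Vi
T-v = inverse-unique (one - t̂ * X * X) (T v) Vi
  (KU.trans (KU.*-congʳ {T v} (KU.sym eq)) (KU.trans (KU.sym (T-*ˢ (one - t̂ * x * x) v)) (KU.trans (T-congˢ v-eq) (T-constˢ _)))) V-eq
  where
  T-neg : ∀ f → T (- f) ≈ - T f
  T-neg f = KU.trans (T-congˢ (Su.eqv λ n → KT.sym (neg-scale (f n))))
    (KU.trans (Su.eqv (T-scale (ℤt.const (ℤ.- + 1)) f)) (Su.eqv λ n → neg-scale (T f n)))
  eq : T (one - t̂ * x * x) ≈ one - t̂ * X * X
  eq = KU.trans (T-+ˢ one (- (t̂ * x * x))) (KU.+-cong (T-constˢ _) (KU.trans (T-neg (t̂ * x * x)) (KU.-‿cong T-txx)))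

-- wheelP k: the Kazhdan–Lusztig polynomial of the wheel with k ≥ 2 spokes; it vanishes for k < 2.
wheelP : Ser
wheelP = x * (x + t̂ * x * x + t̂ * t̂ * x * x * x * x) * i * v

half-x : HalfS x
half-x zero = half-zero , half-zero
half-x (suc n) = let h = half-raise 1 (proj₁ (half-motzkin n)) in h , h

half-txx : HalfS (t̂ * x * x)
half-txx = Halfs.all-cong (KU.sym eq) (KU.sym eq) shifted
  where
  shifted : HalfS (Su.shift (Su.shift (t̂ * (motzkin * motzkin))))
  shifted zero = half-zero , half-zero
  shifted (suc zero) = half-zero , half-zero
  shifted (suc (suc n)) = let h = resp (KT.sym (Su.mul-const tP _ n)) (t· (proj₁ (Halfs.all-mul half-motzkin half-motzkin n))) in h , h
  eq : t̂ * x * x ≈ Su.shift (Su.shift (t̂ * (motzkin * motzkin)))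
  eq = KU.trans (KU.*-cong (KU.*-congˡ {t̂} (KU.sym (û-shift motzkin))) (KU.sym (û-shift motzkin)))
    (KU.trans (SU.solve 3 (λ t u m → t SU.:* (u SU.:* m) SU.:* (u SU.:* m) SU.:= u SU.:* (u SU.:* (t SU.:* (m SU.:* m)))) KU.refl t̂ û motzkin)
    (KU.trans (û-shift _) (Su.eqv λ { zero → KT.refl ; (suc n) → Su.mul-var (t̂ * (motzkin * motzkin)) n })))

-- The index is one better than `half-x` and `half-txx` would give: one factor of the variable is
-- split off from `x`, and this yields the strict inequality `2 deg < corank`.
half-wheelP : ∀ n → Half n (wheelP (suc n))
half-wheelP n = resp (KT.sym (Su.at eq (suc n))) (proj₁ (half-rest n))
  where
  rest : Ser
  rest = motzkin * (x + t̂ * x * x + t̂ * x * x * (t̂ * x * x)) * i * v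
  half-rest : HalfS rest
  half-rest = Halfs.all-mul (Halfs.all-mul (Halfs.all-mul half-motzkin
      (Halfs.all-+ (Halfs.all-+ half-x half-txx) (Halfs.all-mul half-txx half-txx)))
      (Halfs.all-inv (Halfs.all-+ Halfs.all-one half-x)))
      (Halfs.all-inv (Halfs.all-+ Halfs.all-one (Halfs.all-neg half-txx)))
  eq : wheelP ≈ Su.shift rest
  eq = KU.trans (KU.*-congʳ {v} (KU.*-congʳ {i} (KU.*-congʳ (KU.sym (û-shift motzkin)))))
    (KU.trans (SU.solve 6 (λ u t m x i v → u SU.:* m SU.:* (x SU.:+ t SU.:* x SU.:* x SU.:+ t SU.:* t SU.:* x SU.:* x SU.:* x SU.:* x) SU.:* i SU.:* v
        SU.:= u SU.:* (m SU.:* (x SU.:+ t SU.:* x SU.:* x SU.:+ t SU.:* x SU.:* x SU.:* (t SU.:* x SU.:* x)) SU.:* i SU.:* v)) KU.refl û t̂ motzkin x i v)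
    (û-shift rest))

T-wheelP : T wheelP ≈ X * (X + t̂ * X * X + t̂ * t̂ * X * X * X * X) * I * Vi
T-wheelP = KU.trans (T-*ˢ _ v) (KU.*-cong (KU.trans (T-*ˢ _ i) (KU.*-cong (KU.trans (T-*ˢ x _) (KU.*-congˡ {X} sum)) T-i)) T-v)
  where
  sum : T (x + t̂ * x * x + t̂ * t̂ * x * x * x * x) ≈ X + t̂ * X * X + t̂ * t̂ * X * X * X * X
  sum = KU.trans (T-+ˢ (x + t̂ * x * x) _) (KU.+-cong (KU.trans (T-+ˢ x (t̂ * x * x)) (KU.+-congˡ {X} T-txx))
    (KU.trans (T-*ˢ _ x) (KU.*-congʳ {X} (KU.trans (T-*ˢ _ x) (KU.*-congʳ {X} (KU.trans (T-*ˢ _ x) (KU.*-congʳ {X}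
      (KU.trans (T-*ˢ _ x) (KU.*-congʳ {X} (KU.trans (T-*ˢ t̂ t̂) (KU.*-cong (T-constˢ tP) (T-constˢ tP))))))))))))

module N = Narayana.Relations Su.series Su.const-hom t̂ û X I J Vi X-eq I-eq J-eq V-eq

A S Den Num w : Ser
A = N.A
S = N.S
Den = N.Den
Num = N.Num
w = N.w

R M D : Ser
R = Su.inv S
M = Su.inv Den
D = Num * M

-- Palindromicity of the generating series

open Revs using (All; all-mul; all-+; all-neg; all-one; all-inv; all-cong)

rev-û : All û (t̂ * û)
rev-û zero = resp KT.refl (KT.sym (Su.mul-const tP û 0)) (resp KT.refl (KT.sym (KT.zeroʳ tP)) nil)
rev-û (suc zero) = resp KT.refl (KT.sym (Su.mul-const tP û 1)) (t·ʳ (const (+ 1)))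
rev-û (suc (suc n)) = resp KT.refl (KT.trans (KT.sym (KT.zeroʳ tP)) (KT.sym (Su.mul-const tP û (suc (suc n))))) nil

all-sym : ∀ {f g} → All f g → All g f
all-sym p i = rev-sym (p i)

all-sub : ∀ {f f′ g g′} → All f f′ → All g g′ → All (f - g) (f′ - g′)
all-sub {g = g} {g′} p q = all-+ p (all-neg {g} {g′} q)

-- Coefficient `n + 1` of `X` is coefficient `n` of `(1 + X) (1 + t X)`, and the induction
-- hypothesis says that reversal exchanges the two factors.
rev-X : All X (t̂ * X)
rev-X = Revs.all-strong {X} {t̂ * X} step
  where
  X-shift : X ≈ Su.shift w
  X-shift = KU.trans N.X-narayana (û-shift w)
  step : ∀ n → Revs.Upto n 0 X (t̂ * X) → Rev n (X n) ((t̂ * X) n)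
  step zero _ = resp KT.refl (KT.sym (KT.zeroʳ tP)) nil
  step (suc n) ih = resp (KT.sym (Su.at X-shift (suc n)))
      (KT.trans (KT.*-congˡ {tP} (KT.sym (Su.at X-shift (suc n)))) (KT.sym (Su.mul-const tP X (suc n))))
      (t·ʳ (resp KT.refl (Su.at (KU.*-comm (one + t̂ * X) (one + X)) n)
        (Revs.upto-mul {suc n} {0} {0} {one + X} {one + t̂ * X} {one + t̂ * X} {one + X}
          (λ i i<n → add (all-one i) (ih i i<n)) (λ i i<n → add (all-one i) (rev-sym (ih i i<n))) n ℕP.≤-refl)))

rev-w : All w w
rev-w = all-cong {f = w} KU.refl (KU.*-comm (one + t̂ * X) (one + X))
  (all-mul {one + X} {one + t̂ * X} {one + t̂ * X} {one + X} (all-+ all-one rev-X) (all-+ all-one (all-sym rev-X)))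

rev-A : All A A
rev-A = all-cong eq₁ eq₂ (all-sub (all-sub all-one rev-û) (all-sym rev-û))
  where
  eq₁ : one - û - t̂ * û ≈ A
  eq₁ = SU.solve 2 (λ t u → let o = SU.con (+ 1) in o SU.:- u SU.:- t SU.:* u SU.:= o SU.:- (t SU.:+ o) SU.:* u) KU.refl t̂ û
  eq₂ : one - t̂ * û - û ≈ A
  eq₂ = SU.solve 2 (λ t u → let o = SU.con (+ 1) in o SU.:- t SU.:* u SU.:- u SU.:= o SU.:- (t SU.:+ o) SU.:* u) KU.refl t̂ û

rev-tuX : All (t̂ * û * X) (t̂ * û * X)
rev-tuX = all-cong {f = t̂ * û * X} KU.refl eq (all-mul {t̂ * û} {û} (all-sym rev-û) rev-X)
  where
  eq : û * (t̂ * X) ≈ t̂ * û * X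
  eq = SU.solve 3 (λ t u X → u SU.:* (t SU.:* X) SU.:= t SU.:* u SU.:* X) KU.refl t̂ û X

rev-tuu : All (t̂ * û * û) (t̂ * û * û)
rev-tuu = all-cong {f = t̂ * û * û} KU.refl (KU.*-comm û (t̂ * û)) (all-mul {t̂ * û} {û} (all-sym rev-û) rev-û)

rev-S : All S S
rev-S = all-cong eq eq (all-sub rev-A (all-+ rev-tuX rev-tuX))
  where
  eq : A - (t̂ * û * X + t̂ * û * X) ≈ S
  eq = SU.solve 4 (λ t u X A → A SU.:- (t SU.:* u SU.:* X SU.:+ t SU.:* u SU.:* X) SU.:= A SU.:- SU.con (+ 2) SU.:* t SU.:* u SU.:* X) KU.refl t̂ û X A

rev-R : All R R
rev-R = all-inv {S} {S} rev-S

rev-Den : All Den Den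
rev-Den = all-sub {A - t̂ * û * û} {A - t̂ * û * û} (all-sub rev-A rev-tuu) rev-tuX

rev-D : All D D
rev-D = all-mul {Num} {Num} {M} {M} (all-mul {A} {A} rev-A
    (all-cong {û + t̂ * û + t̂ * û * û} KU.refl comm (all-+ (all-+ rev-û (all-sym rev-û)) rev-tuu)))
  (all-inv {Den} {Den} rev-Den)
  where
  comm : t̂ * û + û + t̂ * û * û ≈ û + t̂ * û + t̂ * û * û
  comm = KU.+-congʳ {t̂ * û * û} (KU.+-comm (t̂ * û) û)

rev-wheel : All (R - D - one) (R - D - one)
rev-wheel = all-sub {R - D} {R - D} (all-sub rev-R rev-D) all-one

R-eq : S * R ≈ one
R-eq = Su.mul-inv S (ℤt.eqv λ { zero → refl ; (suc n) → rev-degree (rev-S 0) (suc n) (s≤s z≤n) })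

M-eq : Den * M ≈ one
M-eq = Su.mul-inv Den (ℤt.eqv λ { zero → refl ; (suc n) → rev-degree (rev-Den 0) (suc n) (s≤s z≤n) })

fan₀ : fan 0 KT.≈ KT.1#
fan₀ = KT.+-identityʳ KT.1#

-- Generating series of the scans

coefficients : ∀ {f c g} → f KU.≈ Su.const c KU.+ û KU.* g → f 0 KT.≈ c × (∀ b → f (suc b) KT.≈ g b)
coefficients {f} {c} {g} e =
    KT.trans (Su.at e 0) (KT.trans (KT.+-congˡ {c} (KT.zeroˡ (g 0))) (KT.+-identityʳ c))
  , λ b → KT.trans (Su.at e (suc b)) (KT.trans (KT.+-identityˡ ((û KU.* g) (suc b))) (Su.mul-var g (suc b)))

scan-hub : ∀ {h₀} (h n : Ser) → h KU.≈ Su.const h₀ KU.+ û KU.* (t̂ KU.* (h KU.+ n)) →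
  h 0 KT.≈ h₀ × (∀ b → h (suc b) KT.≈ tP KT.* (h b KT.+ n b))
scan-hub h n e = proj₁ (coefficients e) , λ b → KT.trans (proj₂ (coefficients e) b) (Su.mul-const tP (h KU.+ n) b)

scan-mid : ∀ {c₀} c (h n n′ : Ser) → n KU.≈ Su.const c₀ KU.+ û KU.* (Su.const c KU.* h KU.+ n′ KU.+ t̂ KU.* n) →
  n 0 KT.≈ c₀ × (∀ b → n (suc b) KT.≈ c KT.* h b KT.+ n′ b KT.+ tP KT.* n b)
scan-mid c h n n′ e = proj₁ (coefficients e) , λ b → KT.trans (proj₂ (coefficients e) b)
  (KT.+-cong (KT.+-congʳ {n′ b} (Su.mul-const c h b)) (Su.mul-const tP n b))

drop : ℕ → Ser → Ser
drop zero f = f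
drop (suc k) f = Su.tail (drop k f)

drop-at : ∀ k f n → drop k f n ≡ f (k ℕ.+ n)
drop-at zero f n = refl
drop-at (suc k) f n = ≡.trans (drop-at k f (suc n)) (≡.cong f (ℕP.+-suc k n))

drop-head : ∀ k f → drop k f 0 ≡ f k
drop-head k f = ≡.trans (drop-at k f 0) (≡.cong f (ℕP.+-identityʳ k))

module SA = ScanAlgebra Su.series Su.const-hom

G : Ser
G = Su.inv (one - t̂ * û)

G-eq : (one - t̂ * û) * G ≈ one
G-eq = Su.mul-inv _ (KT.trans (KT.+-congˡ {KT.1#} (KT.-‿cong (KT.zeroʳ tP))) (minus-zero KT.1#))

T-fan : T fan ≈ one + X
T-fan = KU.trans (T-+ˢ one x) (KU.+-congʳ {X} (T-constˢ _))

-- arc k = Σ_{i ≥ 1} fan (k + i) (u / (1 - t u))ⁱ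
arc : ℕ → Ser
arc k = T (drop k fan) - Su.const (drop k fan 0)

arc-eq : ∀ k → arc k * (one - t̂ * û) ≈ û * (Su.const (fan (suc k)) + arc (suc k))
arc-eq k = KU.trans (T-tailˢ (drop k fan)) (KU.*-congˡ {û} (KU.trans
    (SU.solve 2 (λ a b → a SU.:= b SU.:+ (a SU.:- b)) KU.refl (T (drop (suc k) fan)) (Su.const (drop (suc k) fan 0)))
    (KU.+-congʳ {arc (suc k)} (KU.reflexive (≡.cong Su.const (drop-head (suc k) fan))))))

arc-zero : arc 0 ≈ X
arc-zero = KU.trans (KU.+-cong T-fan (KU.-‿cong const-fan₀)) (SU.solve 1 (λ a → SU.con (+ 1) SU.:+ a SU.:- SU.con (+ 1) SU.:= a) KU.refl X)
  where
  const-fan₀ : Su.const (fan 0) ≈ one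
  const-fan₀ = Su.eqv λ { zero → fan₀ ; (suc n) → KT.refl }

hubs : Ser
hubs = one + t̂ * X

const-zero : Su.const KT.0# ≈ KU.0#
const-zero = Su.eqv λ { zero → KT.refl ; (suc n) → KT.refl }

open WordSums ℤt.series ℤt.const-hom tP fan wheelP fan₀

-- The recursions of the scan in the number of blocks are the functional equations of these series,
-- read off coefficientwise.
fan-scan : ∀ b → FanScan.scanH (replicate b end) KT.≈ hubs b × (∀ k → FanScan.scanN (replicate b end) k KT.≈ (hubs * arc k) b)
fan-scan = FanScan.scan-ends hubs (λ k → hubs * arc k) (proj₁ hub-rec) (proj₂ hub-rec) (λ k → proj₁ (mid-rec k)) (λ k → proj₂ (mid-rec k))
  where
  hub-rec : hubs 0 KT.≈ KT.1# × (∀ b → hubs (suc b) KT.≈ tP KT.* (hubs b KT.+ (hubs * arc 0) b))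
  hub-rec = scan-hub hubs (hubs * arc 0) (KU.trans (SA.fan-hub t̂ û X N.X-narayana)
    (KU.+-congˡ {one} (KU.*-congˡ {û} (KU.*-congˡ {t̂} (KU.+-congˡ {hubs} (KU.*-congˡ {hubs} (KU.sym arc-zero)))))))
  mid-rec : ∀ k → (hubs * arc k) 0 KT.≈ KT.0# ×
    (∀ b → (hubs * arc k) (suc b) KT.≈ fan (suc k) KT.* hubs b KT.+ (hubs * arc (suc k)) b KT.+ tP KT.* (hubs * arc k) b)
  mid-rec k = scan-mid (fan (suc k)) hubs (hubs * arc k) (hubs * arc (suc k))
    (KU.trans (SA.fan-mid t̂ û hubs (arc k) (Su.const (fan (suc k))) (arc (suc k)) (arc-eq k))
    (KU.trans (KU.sym (KU.+-identityˡ _)) (KU.+-congʳ (KU.sym const-zero))))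

-- The Z-polynomial of a fan is a Narayana polynomial.
fan-total : ∀ b → FanScan.scanH (replicate b end) KT.+ FanScan.scanN (replicate b end) 0 KT.≈ w b
fan-total b = KT.trans (KT.+-cong (proj₁ (fan-scan b)) (proj₂ (fan-scan b) 0)) (Su.at eq b)
  where
  eq : hubs + hubs * arc 0 ≈ w
  eq = KU.trans (KU.+-congˡ {hubs} (KU.*-congˡ {hubs} arc-zero))
    (SU.solve 2 (λ t X → let o = SU.con (+ 1); h = o SU.:+ t SU.:* X in h SU.:+ h SU.:* X SU.:= (o SU.:+ X) SU.:* h) KU.refl t̂ X)

-- The factor `G`, a geometric series in `t u`, accounts for the trailing ends that are absorbed
-- into the block running past the end of the word.
arcs : ℕ → Ser
arcs m = G * T (drop m fan)

arcs-eq : ∀ m → arcs m ≈ Su.const (fan m) + û * (arcs (suc m) + t̂ * arcs m)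
arcs-eq m = KU.trans (SA.arc-end t̂ û G (T (drop m fan)) (Su.const (drop m fan 0)) (T (drop (suc m) fan)) G-eq (T-tailˢ (drop m fan)))
  (KU.+-congʳ {û * (arcs (suc m) + t̂ * arcs m)} (KU.reflexive (≡.cong Su.const (drop-head m fan))))

wraps : ℕ → Ser
wraps j = hubs * (t̂ * û * arcs j)

wrap-scan : ∀ j b → WrapScan.scanH j (replicate b end) KT.≈ wraps j b ×
  (∀ k → WrapScan.scanN j (replicate b end) k KT.≈ (wraps j * arc k + arcs (k ℕ.+ j)) b)
wrap-scan j = WrapScan.scan-ends j (wraps j) mids (proj₁ hub-rec) (proj₂ hub-rec) (λ k → proj₁ (mid-rec k)) (λ k → proj₂ (mid-rec k))
  where
  mids : ℕ → Ser
  mids k = wraps j * arc k + arcs (k ℕ.+ j)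
  hub-rec : wraps j 0 KT.≈ KT.0# × (∀ b → wraps j (suc b) KT.≈ tP KT.* (wraps j b KT.+ mids 0 b))
  hub-rec = scan-hub (wraps j) (mids 0) (KU.trans (SA.wrap-hub t̂ û X (arcs j) N.X-narayana) (KU.trans
    (KU.*-congˡ {û} (KU.*-congˡ {t̂} (KU.+-congˡ {wraps j} (KU.+-congʳ {arcs j} (KU.*-congˡ {wraps j} (KU.sym arc-zero))))))
    (KU.trans (KU.sym (KU.+-identityˡ _)) (KU.+-congʳ (KU.sym const-zero)))))
  mid-rec : ∀ k → mids k 0 KT.≈ fan (k ℕ.+ j) ×
    (∀ b → mids k (suc b) KT.≈ fan (suc k) KT.* wraps j b KT.+ mids (suc k) b KT.+ tP KT.* mids k b)
  mid-rec k = scan-mid (fan (suc k)) (wraps j) (mids k) (mids (suc k))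
    (SA.wrap-mid t̂ û (wraps j) (arc k) (Su.const (fan (suc k))) (arc (suc k)) (arcs (k ℕ.+ j))
     (Su.const (fan (k ℕ.+ j))) (arcs (suc k ℕ.+ j)) (arc-eq k) (arcs-eq (k ℕ.+ j)))

-- An arc with `m` blocks that runs across the starting point can have any positive number of them
-- before its first hub. Thus it occurs `m` times, or `m - c` times once `c` blocks are closed, and
-- this multiplicity is what `θ` supplies.
euler-fan : ℕ → Ser
euler-fan c = T (Su.θ (drop c fan))

euler-fan-eq : ∀ c → euler-fan c * (one - t̂ * û) ≈ û * (T (drop (suc c) fan) + euler-fan (suc c))
euler-fan-eq c = KU.trans (KU.*-congʳ {one - t̂ * û} minus) (KU.trans (T-tailˢ (Su.θ (drop c fan)))
    (KU.*-congˡ {û} (T-+ˢ (drop (suc c) fan) (Su.θ (drop (suc c) fan)))))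
  where
  minus : euler-fan c ≈ euler-fan c - Su.const KT.0#
  minus = Su.eqv λ { zero → KT.sym (minus-zero (euler-fan c 0)) ; (suc n) → KT.sym (minus-zero (euler-fan c (suc n))) }

-- The first summand collects the upper words without a hub, the second those that have one.
starts : ℕ → Ser
starts c = G * T (drop c wheelP) + hubs * (t̂ * û * (G * euler-fan c))

starts-eq : ∀ c → starts c ≈ Su.const (wheelP c) + û * (wraps (suc c) + starts (suc c) + t̂ * starts c)
starts-eq c = SA.start-mid t̂ û hubs (G * T (drop c wheelP)) (Su.const (wheelP c)) (G * T (drop (suc c) wheelP))
    (euler-fan c) (T (drop (suc c) fan)) (euler-fan (suc c)) G G-eq
    (KU.trans (SA.arc-end t̂ û G (T (drop c wheelP)) (Su.const (drop c wheelP 0)) (T (drop (suc c) wheelP)) G-eq (T-tailˢ (drop c wheelP)))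
      (KU.+-congʳ (KU.reflexive (≡.cong Su.const (drop-head c wheelP)))))
    (euler-fan-eq c)

start-scan : ∀ b c → scanStart (replicate b end) c KT.≈ starts c b
start-scan = start-ends starts wraps (λ c b → proj₁ (wrap-scan c b)) (λ c → proj₁ (coefficients (starts-eq c)))
  (λ c b → KT.trans (proj₂ (coefficients (starts-eq c)) b) (KT.+-congˡ {wraps (suc c) b KT.+ starts (suc c) b} (Su.mul-const tP (starts c) b)))

G-euler : G * euler-fan 0 ≈ X * R
G-euler = SA.euler t̂ û X (euler-fan 0) G S R G-eq KU.refl R-eq eq
  where
  g W : Ser
  g = one + x + t̂ * x * x
  W = T (Su.θ x)
  fan→x : euler-fan 0 ≈ W
  fan→x = T-congˢ (Su.eqv λ { zero → KT.refl ; (suc n) → KT.+-cong (KT.+-identityˡ (x (suc n))) (Su.θ-cong (λ k → KT.+-identityˡ (x (suc k))) n) })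
  θ-one : ∀ c → Su.θ (Su.const c) ≈ KU.0#
  θ-one c = Su.eqv λ { zero → KT.refl ; (suc n) → KT.trans (KT.+-identityˡ _) (zeros n) }
    where
    zeros : ∀ n → Su.θ (λ _ → KT.0#) n KT.≈ KT.0#
    zeros zero = KT.refl
    zeros (suc n) = KT.trans (KT.+-identityˡ _) (zeros n)
  θg : Su.θ g ≈ Su.θ x + (t̂ * Su.θ x * x + t̂ * x * Su.θ x)
  θg = KU.trans (Su.eqv (Su.θ-+ (one + x) (t̂ * x * x))) (KU.+-cong
      (KU.trans (Su.eqv (Su.θ-+ one x)) (KU.trans (KU.+-congʳ {Su.θ x} (θ-one _)) (KU.+-identityˡ (Su.θ x))))
      (KU.trans (Su.eqv (Su.θ-mul (t̂ * x) x)) (KU.+-congʳ {t̂ * x * Su.θ x} (KU.*-congʳ {x} (KU.trans (Su.eqv (Su.θ-mul t̂ x))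
        (KU.trans (KU.+-congʳ {t̂ * Su.θ x} (KU.trans (KU.*-congʳ {x} (θ-one tP)) (KU.zeroˡ x))) (KU.+-identityˡ (t̂ * Su.θ x))))))))
  θx : Su.θ x ≈ x + û * (Su.θ x + (t̂ * Su.θ x * x + t̂ * x * Su.θ x))
  θx = KU.trans (Su.eqv (Su.θ-cong (Su.at (KU.trans x-eq (û-shift g))))) (KU.trans (Su.eqv (Su.θ-shift g))
    (KU.trans (KU.sym (û-shift (g + Su.θ g))) (KU.trans (KU.distribˡ û g (Su.θ g)) (KU.+-cong (KU.sym x-eq) (KU.*-congˡ {û} θg)))))
  q : Ser
  q = Su.θ x + (t̂ * Su.θ x * x + t̂ * x * Su.θ x)
  Tq : T q ≈ W + (t̂ * W * X + t̂ * X * W)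
  Tq = KU.trans (T-+ˢ (Su.θ x) _) (KU.+-congˡ {W} (KU.trans (T-+ˢ (t̂ * Su.θ x * x) (t̂ * x * Su.θ x)) (KU.+-cong
      (KU.trans (T-*ˢ (t̂ * Su.θ x) x) (KU.*-congʳ {X} (KU.trans (T-*ˢ t̂ (Su.θ x)) (KU.*-congʳ {W} (T-constˢ tP)))))
      (KU.trans (T-*ˢ (t̂ * x) (Su.θ x)) (KU.*-congʳ {W} (KU.trans (T-*ˢ t̂ x) (KU.*-congʳ {X} (T-constˢ tP))))))))
  eqW : W * (one - t̂ * û) ≈ X * (one - t̂ * û) + û * (W + (t̂ * W * X + t̂ * X * W))
  eqW = KU.trans (KU.*-congʳ {one - t̂ * û} (KU.trans (T-congˢ θx) (T-+ˢ x (û * q))))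
    (KU.trans (KU.distribʳ (one - t̂ * û) X (T (û * q))) (KU.+-congˡ {X * (one - t̂ * û)} (KU.trans (T-û q) (KU.*-congˡ {û} Tq))))
  V₀ : Ser
  V₀ = euler-fan 0
  eq : V₀ * (one - t̂ * û) ≈ X * (one - t̂ * û) + û * (V₀ + (t̂ * V₀ * X + t̂ * X * V₀))
  eq = KU.trans (KU.*-congʳ {one - t̂ * û} fan→x) (KU.trans eqW (KU.+-congˡ {X * (one - t̂ * û)} (KU.*-congˡ {û}
      (KU.sym (KU.+-cong fan→x (KU.+-cong (KU.*-congʳ {X} (KU.*-congˡ {t̂} fan→x)) (KU.*-congˡ {t̂ * X} fan→x)))))))

G-pow : ∀ n → G n KT.≈ pow n
G-pow n = KT.sym (go n)
  where
  eq : G ≈ one + û * (t̂ * G)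
  eq = SA.unfold t̂ û G one (KU.trans (KU.*-comm G (one - t̂ * û)) G-eq)
  go : ∀ n → pow n KT.≈ G n
  go zero = KT.sym (KT.trans (Su.at eq 0) (KT.trans (KT.+-congˡ {KT.1#} (KT.zeroˡ _)) (KT.+-identityʳ _)))
  go (suc n) = KT.sym (KT.trans (Su.at eq (suc n)) (KT.trans (KT.+-identityˡ _) (KT.trans (Su.mul-var (t̂ * G) (suc n))
    (KT.trans (Su.mul-const tP G n) (KT.*-congˡ {tP} (KT.sym (go n)))))))

-- The flat consisting of the whole rim contributes the last term.
wheel-total : ∀ b → FanScan.scanH (replicate (2 ℕ.+ b) end) KT.+ scanStart (replicate (2 ℕ.+ b) end) 0 KT.+ pow (suc b)
  KT.≈ (R - D - one) (2 ℕ.+ b)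
wheel-total b = KT.trans (KT.+-cong (KT.+-cong (proj₁ (fan-scan n)) (start-scan n 0)) rim)
  (KT.trans (Su.at tot n) (KT.trans (KT.+-congˡ {(R - D - one) n} vanish) (KT.+-identityʳ _)))
  where
  n : ℕ
  n = 2 ℕ.+ b
  tot : hubs + starts 0 + G * (t̂ * û * û) ≈ R - D - one + (one + t̂ * û)
  tot = SA.total t̂ û X G (euler-fan 0) (T wheelP) R D G-eq G-euler
    (KU.trans (KU.+-congʳ {t̂ * û * û} T-wheelP) (N.wheel-eq R R-eq D M M-eq KU.refl))
  rim : pow (suc b) KT.≈ (G * (t̂ * û * û)) n
  rim = KT.sym (KT.trans (Su.at (SU.solve 3 (λ t u G → G SU.:* (t SU.:* u SU.:* u) SU.:= u SU.:* (u SU.:* (t SU.:* G))) KU.refl t̂ û G) n)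
    (KT.trans (Su.mul-var (û * (t̂ * G)) n) (KT.trans (Su.mul-var (t̂ * G) (suc b)) (KT.trans (Su.mul-const tP G b) (KT.*-congˡ {tP} (G-pow b))))))
  vanish : (one + t̂ * û) n KT.≈ KT.0#
  vanish = KT.trans (KT.+-identityˡ _) (KT.trans (Su.mul-const tP û n) (KT.zeroʳ tP))


wheelP₀ : wheelP 0 KT.≈ KT.0#
wheelP₀ = KT.trans (KT.*-congʳ {v 0} (KT.trans (KT.*-congʳ {i 0} (KT.zeroˡ _)) (KT.zeroˡ (i 0)))) (KT.zeroˡ (v 0))

rev-1+t : Rev 1 (tP KT.+ KT.1#) (tP KT.+ KT.1#)
rev-1+t = resp (KT.+-congʳ {KT.1#} (KT.*-identityʳ tP)) (KT.trans (KT.+-congˡ {KT.1#} (KT.*-identityʳ tP)) (KT.+-comm KT.1# tP))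
  (add (t·ˡ (const (+ 1))) (t·ʳ (const (+ 1))))

wheelP₁ : wheelP 1 KT.≈ KT.0#
wheelP₁ = prod₁ (x KU.* ℓ KU.* i) v (prod₀ (x KU.* ℓ) i (KT.zeroˡ (ℓ 0)))
    (prod₁ (x KU.* ℓ) i (KT.zeroˡ (ℓ 0)) (KT.trans (KT.+-cong (KT.zeroˡ (ℓ 1)) (KT.trans (KT.*-congˡ {x 1} ℓ₀) (KT.zeroʳ (x 1)))) (KT.+-identityˡ KT.0#)))
  where
  ℓ : Ser
  ℓ = x KU.+ t̂ KU.* x KU.* x KU.+ t̂ KU.* t̂ KU.* x KU.* x KU.* x KU.* x
  ℓ₀ : ℓ 0 KT.≈ KT.0#
  ℓ₀ = KT.trans (KT.+-cong (KT.trans (KT.+-identityˡ _) (KT.zeroʳ _)) (KT.zeroʳ _)) (KT.+-identityˡ KT.0#)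
  prod₀ : ∀ f g → f 0 KT.≈ KT.0# → (f KU.* g) 0 KT.≈ KT.0#
  prod₀ f g e = KT.trans (KT.*-congʳ {g 0} e) (KT.zeroˡ (g 0))
  prod₁ : ∀ f g → f 0 KT.≈ KT.0# → f 1 KT.≈ KT.0# → (f KU.* g) 1 KT.≈ KT.0#
  prod₁ f g e e′ = KT.trans (KT.+-cong (KT.trans (KT.*-congʳ {g 1} e) (KT.zeroˡ (g 1))) (KT.trans (KT.*-congʳ {g 0} e′) (KT.zeroˡ (g 0)))) (KT.+-identityˡ KT.0#)

module GW = Graded-words wheelP₀ wheelP₁ (λ n p → Rev n p p) (λ e → resp e e) (const (+ 1)) rev-mul
  (λ b → resp (KT.sym (fan-total b)) (KT.sym (fan-total b)) (rev-w b)) rev-1+t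
  (λ k → resp (KT.sym (wheel-total k)) (KT.sym (wheel-total k)) (rev-wheel (2 ℕ.+ k)))

-- Corank 0 demands the polynomial 1; in corank `suc d`, the bound `d / 2` expresses
-- `2 deg < suc d`. A product of two factors of positive corank meets its bound with one to spare.
data Degree : ℕ → Pol → Set where
  deg-0 : ∀ {p} → p KT.≈ KT.1# → Degree 0 p
  deg-half : ∀ {d p} → Half d p → Degree (suc d) p

degree-cong : ∀ {n p q} → p KT.≈ q → Degree n p → Degree n q
degree-cong e (deg-0 h) = deg-0 (KT.trans (KT.sym e) h)
degree-cong e (deg-half h) = deg-half (resp e h)

degree-mul : ∀ {m n p q} → Degree m p → Degree n q → Degree (m ℕ.+ n) (p KT.* q)
degree-mul {p = p} {q} (deg-0 h) k = degree-cong (KT.trans (KT.sym (KT.*-identityˡ q)) (KT.*-congʳ {q} (KT.sym h))) k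
degree-mul {suc m} {p = p} {q} (deg-half h) (deg-0 k) = deg-half (≡.subst (λ d → Half d (p KT.* q)) (≡.sym (ℕP.+-identityʳ m))
  (resp (KT.trans (KT.sym (KT.*-identityʳ p)) (KT.*-congˡ {p} (KT.sym k))) h))
degree-mul {suc m} {suc n} {p} {q} (deg-half h) (deg-half k) =
  deg-half (≡.subst (λ d → Half d (p KT.* q)) (≡.sym (ℕP.+-suc m n)) (half-raise 1 (half-mul h k)))

degree-fan : ∀ k → Degree k (fan k)
degree-fan zero = deg-0 fan₀
degree-fan (suc k) = deg-half (resp (KT.sym (KT.+-identityˡ (motzkin k))) (proj₁ (half-motzkin k)))

degree-wheel : ∀ k → Degree (suc k) (wheelP (suc k))
degree-wheel k = deg-half (half-wheelP k)

module DG = Degrees Degree degree-cong degree-mul (deg-half (const (+ 1))) degree-fan degree-wheel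


-- The Kazhdan-Lusztig polynomials of the wheel

sh-pow : ∀ k p j → sh k p j ≡ (pow k KT.* p) j
sh-pow zero p j = ≡.sym (ℤt.mul-identityˡ p j)
sh-pow (suc k) p j = ≡.sym (≡.trans (ℤt.mul-assoc tP (pow k) p j) (≡.trans (ℤt.mul-var (pow k KT.* p) j) (shifted j)))
  where
  shifted : ∀ j → ℤt.shift (pow k KT.* p) j ≡ sh (suc k) p j
  shifted zero = refl
  shifted (suc j) = ≡.sym (sh-pow k p j)

ivK-at : ∀ b p j → ivK b p j ≡ iv b (p j)
ivK-at true p j = refl
ivK-at false p j = refl

rv-beyond : ∀ c p j → c < j → rv c p j ≡ + 0
rv-beyond zero p (suc j) _ = refl
rv-beyond (suc c) p (suc j) (s≤s lt) = rv-beyond c p j lt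

-- Reversing `t^d p` in degree `d + c` cancels the shift and leaves the reversal of `p` in degree
-- `c`. Applied termwise, it turns palindromicity of a sum into the two-sided form used by the
-- criterion.
rv-sh : ∀ c d p j → j ≤ d ℕ.+ c → rv c p j ≡ sh d p (d ℕ.+ c ∸ j)
rv-sh c d p j j≤ with ℕP.≤-<-connex j c
... | inj₁ j≤c = ≡.trans (low c j j≤c) (≡.trans (≡.sym (shift-back d)) (≡.cong (sh d p) (≡.sym (ℕP.+-∸-assoc d j≤c))))
  where
  low : ∀ c j → j ≤ c → rv c p j ≡ p (c ∸ j)
  low c zero _ = refl
  low (suc c) (suc j) (s≤s le) = low c j le
  shift-back : ∀ d → sh d p (d ℕ.+ (c ∸ j)) ≡ p (c ∸ j)
  shift-back zero = refl
  shift-back (suc d) = shift-back d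
... | inj₂ c<j = ≡.trans (rv-beyond c p j c<j) (≡.sym (below d (d ℕ.+ c ∸ j) k<d))
  where
  below : ∀ d k → k < d → sh d p k ≡ + 0
  below (suc d) zero _ = refl
  below (suc d) (suc k) (s≤s lt) = below d k lt
  k<d : d ℕ.+ c ∸ j < d
  k<d = ≡.subst (d ℕ.+ c ∸ j <_) (ℕP.m+n∸n≡m d c) (ℕP.∸-monoʳ-< c<j j≤)

join : ∀ m {n} → Subset m → Subset n → Subset (m ℕ.+ n)
join zero S R = R
join (suc m) S R zero = S zero
join (suc m) S R (suc i) = join m (S ∘ suc) R i

join-ˡ : ∀ m {n} (S : Subset m) (R : Subset n) i → join m S R (i ↑ˡ n) ≡ S i
join-ˡ (suc m) S R zero = refl
join-ˡ (suc m) S R (suc i) = join-ˡ m (S ∘ suc) R i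

join-ʳ : ∀ m {n} (S : Subset m) (R : Subset n) i → join m S R (m ↑ʳ i) ≡ R i
join-ʳ zero S R i = refl
join-ʳ (suc m) S R i = join-ʳ m (S ∘ suc) R i

Σs-join : ∀ m n (f : Subset (m ℕ.+ n) → ℤ) → Ext f → Σs (m ℕ.+ n) f ≡ Σs m (λ S → Σs n (λ R → f (join m S R)))
Σs-join zero n f fx = ≡.sym (ℤP.+-identityʳ _)
Σs-join (suc m) n f fx = ≡.trans (Σs-suc (m ℕ.+ n) f) (≡.trans
  (Σs-join m n (λ A → f (ext false A) ℤ.+ f (ext true A)) (λ e → ≡.cong₂ ℤ._+_ (fx (ext-cong false e)) (fx (ext-cong true e))))
  (≡.trans (Σs-cong m λ S → ≡.trans (sumL-+ (allSubsets n) _ _) (≡.cong₂ ℤ._+_ (Σs-cong n λ R → fx (ext-join false S R)) (Σs-cong n λ R → fx (ext-join true S R))))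
  (≡.sym (Σs-suc m _))))
  where
  ext-join : ∀ b (S : Subset m) (R : Subset n) → ext b (join m S R) ≗ join (suc m) (ext b S) R
  ext-join b S R zero = refl
  ext-join b S R (suc i) = refl

Σs-words : ∀ n (φ : List Bits → Pol) j → Σs n (λ S → Σs n (λ R → φ (wordN n (nth S) (nth R)) j)) ≡ ΣW n φ j
Σs-words zero φ j = ≡.trans (ℤP.+-identityʳ _) (ℤP.+-identityʳ _)
Σs-words (suc n) φ j = ≡.trans (Σs-suc n _) (≡.trans (Σs-cong n λ S → ≡.cong₂ ℤ._+_
      (≡.trans (Σs-suc n _) (sumL-+ (allSubsets n) _ _)) (≡.trans (Σs-suc n _) (sumL-+ (allSubsets n) _ _)))
  (≡.trans (sumL-+ (allSubsets n) _ _) (≡.trans (≡.cong₂ ℤ._+_ (sumL-+ (allSubsets n) _ _) (sumL-+ (allSubsets n) _ _))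
  (≡.trans (≡.cong₂ ℤ._+_ (≡.cong₂ ℤ._+_ (ih (false , false)) (ih (false , true))) (≡.cong₂ ℤ._+_ (ih (true , false)) (ih (true , true))))
  -- `allSubsets` lists the absence of an element first, `ΣW` its presence, so the four summands
  -- have to be reversed.
  (≡.trans (ℤP.+-comm (ΣW n (λ w → φ ((false , false) ∷ w)) j ℤ.+ ΣW n (λ w → φ ((false , true) ∷ w)) j) _)
    (≡.cong₂ ℤ._+_ (ℤP.+-comm (ΣW n (λ w → φ ((true , false) ∷ w)) j) _) (ℤP.+-comm (ΣW n (λ w → φ ((false , false) ∷ w)) j) _)))))))
  where
  ih : ∀ y → Σs n (λ S → Σs n (λ R → φ (y ∷ wordN n (nth S) (nth R)) j)) ≡ ΣW n (λ w → φ (y ∷ w)) j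
  ih y = Σs-words n (λ w → φ (y ∷ w)) j

nth-cong : ∀ {k} {F G : Subset k} → F ≗ G → ∀ i → nth F i ≡ nth G i
nth-cong {zero} e i = refl
nth-cong {suc k} e zero = e zero
nth-cong {suc k} e (suc i) = nth-cong (e ∘ suc) i

sub-wordN : ∀ n {S S′ R R′ : Subset n} → ((S ⊆ᵇ S′) ∧ (R ⊆ᵇ R′)) ≡ sub (wordN n (nth S) (nth R)) (wordN n (nth S′) (nth R′))
sub-wordN zero = refl
sub-wordN (suc n) {S} {S′} {R} {R′} = ≡.trans (≡.cong₂ _∧_ (⊆-ext S S′) (⊆-ext R R′)) (≡.trans
  (rearrange (not (S zero) ∨ S′ zero) _ (not (R zero) ∨ R′ zero) _)
  (≡.cong (((not (S zero) ∨ S′ zero) ∧ (not (R zero) ∨ R′ zero)) ∧_) (sub-wordN n {S ∘ suc} {S′ ∘ suc} {R ∘ suc} {R′ ∘ suc})))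
  where
  rearrange : ∀ a b c d → (a ∧ b) ∧ (c ∧ d) ≡ (a ∧ c) ∧ (b ∧ d)
  rearrange true b true d = refl
  rearrange true b false d = BP.∧-zeroʳ b
  rearrange false b c d = refl

blank : ∀ k {s r} → (∀ i → i < k → s i ≡ false) → (∀ i → i < k → r i ≡ false) → wordN k s r ≡ replicate k (false , false)
blank zero _ _ = refl
blank (suc k) f g = ≡.cong₂ _∷_ (≡.cong₂ _,_ (f 0 (s≤s z≤n)) (g 0 (s≤s z≤n))) (blank k (λ i i<k → f (suc i) (s≤s i<k)) (λ i i<k → g (suc i) (s≤s i<k)))

ends-blank : ∀ k → ends# (replicate k (false , false)) ≡ k
ends-blank zero = refl
ends-blank (suc k) = ≡.cong suc (ends-blank k)

nohub-blank : ∀ k → nohub (replicate k (false , false)) ≡ true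
nohub-blank zero = refl
nohub-blank (suc k) = nohub-blank k

module WheelKL (N : ℕ) where
  open Wheel N hiding (s; r)
  open Connectivity Γ ends<V

  word-nth : ∀ F → word F ≡ wordN n (nth (F ∘ spoke)) (nth (F ∘ rim))
  word-nth F = wordN-cong n {r = rims F} {r′ = rims F} (λ i i<n → ≡.cong (λ b → if b then F (spoke zero) else nth (F ∘ spoke) i) (≡ᵇ-false (ℕP.<⇒≢ i<n))) (λ _ _ → refl)

  word-ext : ∀ {F G} → F ≗ G → word F ≡ word G
  word-ext {F} {G} e = ≡.trans (word-nth F) (≡.trans (wordN-cong n (λ i _ → nth-cong (e ∘ spoke) i) (λ i _ → nth-cong (e ∘ rim) i)) (≡.sym (word-nth G)))

  P : Subset (n ℕ.+ n) → Pol
  P F = klWord (word F)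

  P-ext : ∀ {F G} → F ≗ G → P F ≗ P G
  P-ext e i = ≡.cong (λ w → klWord w i) (word-ext e)

  open Criterion (n ℕ.+ n) rank rank-ext rank-mono P P-ext

  ⊆-word : ∀ A F → (A ⊆ᵇ F) ≡ sub (word A) (word F)
  ⊆-word A F = ≡.trans (bool-iff
      (λ e → ∧-true′ {(A ∘ spoke) ⊆ᵇ (F ∘ spoke)} (⊆-true′ {A = A ∘ spoke} {F ∘ spoke} λ i → ⊆-true {A = A} e (spoke i)) (⊆-true′ {A = A ∘ rim} {F ∘ rim} λ i → ⊆-true {A = A} e (rim i)))
      (λ e → ⊆-true′ {A = A} {F} λ i → at i (edge i) (∧-true {(A ∘ spoke) ⊆ᵇ (F ∘ spoke)} e)))
    (≡.trans (sub-wordN n {A ∘ spoke} {F ∘ spoke} {A ∘ rim} {F ∘ rim}) (≡.cong₂ sub (≡.sym (word-nth A)) (≡.sym (word-nth F))))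
    where
    at : ∀ i → Edge i → ((A ∘ spoke) ⊆ᵇ (F ∘ spoke)) ≡ true × ((A ∘ rim) ⊆ᵇ (F ∘ rim)) ≡ true → A i ≡ true → F i ≡ true
    at _ (spoke′ i) (e , _) = ⊆-true {A = A ∘ spoke} e i
    at _ (rim′ i) (_ , e) = ⊆-true {A = A ∘ rim} e i

  Local-word : Subset (n ℕ.+ n) → Set
  Local-word F = loc (spokes F n) (word F) ≡ true

  flat→local : ∀ F → flat F ≡ true → Local-word F
  flat→local F fl = closed→local F (flat→closed {F} fl)

  corank : Subset (n ℕ.+ n) → ℕ
  corank F = crk# (word F)

  full-rank : r ≡ n
  full-rank = ≡.trans (Local.rank-word full (closed→local full λ _ _ → refl)) (≡.cong (n ∸_) crk-0)
    where
    hubs-crk : ∀ m s r → (∀ i → i < m → s i ≡ true) → ends# (wordN m s r) ≡ 0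
    hubs-crk zero s r f = refl
    hubs-crk (suc m) s r f = ≡.trans (≡.cong (λ b → ends# ((b , r 0) ∷ wordN m (s ∘ suc) (r ∘ suc))) (f 0 (s≤s z≤n)))
        (≡.trans (skip (r 0)) (hubs-crk m (s ∘ suc) (r ∘ suc) (λ i i<m → f (suc i) (s≤s i<m))))
      where
      skip : ∀ b → ends# ((true , b) ∷ wordN m (s ∘ suc) (r ∘ suc)) ≡ ends# (wordN m (s ∘ suc) (r ∘ suc))
      skip true = refl
      skip false = refl
    crk-0 : crk# (word full) ≡ 0
    crk-0 = ≡.cong (ℕ._+ 0) (hubs-crk n (spokes full) (rims full) (λ i i<n → s-< full i<n))

  rank-∸ : ∀ F A → Local-word F → Local-word A → rank F ∸ rank A ≡ corank A ∸ corank F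
  rank-∸ F A lF lA = ≡.trans (≡.cong₂ _∸_ (Local.rank-word F lF) (Local.rank-word A lA))
    (≡.trans (ℕP.∸-+-assoc n (corank F) (n ∸ corank A)) (≡.trans (≡.cong (n ∸_) (ℕP.+-comm (corank F) (n ∸ corank A)))
    (≡.trans (≡.sym (ℕP.∸-+-assoc n (n ∸ corank A) (corank F))) (≡.cong (_∸ corank F) (ℕP.m∸[m∸n]≡n (Local.crk-≤ A lA))))))

  r-∸ : ∀ F → Local-word F → r ∸ rank F ≡ corank F
  r-∸ F lF = ≡.trans (≡.cong₂ _∸_ full-rank (Local.rank-word F lF)) (ℕP.m∸[m∸n]≡n (Local.crk-≤ F lF))

  -- The only local words that are not flats have a single block and no hub, and there P vanishes.
  not-flat : ∀ F → flat F ≡ false → cloc (word F) ≡ true → ∀ i → P F i ≡ + 0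
  not-flat F nf lc i = cases (bool-cases (nohub (word F))) (ends# (word F) ℕP.≟ 1)
    where
    flat-unless : ¬ (nohub (word F) ≡ true × ends# (word F) ≡ 1) → ⊥
    flat-unless h = true≢false (≡.trans (≡.sym (closed→flat {F} (Local.local→closed F (≡.trans (≡.sym (cloc-word F)) lc) h))) nf)
    cases : nohub (word F) ≡ true ⊎ nohub (word F) ≡ false → Dec (ends# (word F) ≡ 1) → P F i ≡ + 0
    cases (inj₁ nh) (yes e) = ℤt.at (klWord-one-block wheelP₁ (word F) nh e) i
    cases (inj₁ nh) (no ne) = ⊥-elim (flat-unless λ (_ , e) → ne e)
    cases (inj₂ h) _ = ⊥-elim (flat-unless λ (nh , _) → true≢false (≡.trans (≡.sym nh) h))

  term-word : ∀ A F j → Local-word A → iv (flat F ∧ (A ⊆ᵇ F)) (sh (rank F ∸ rank A) (P F) j) ≡ wordTerm (word A) (word F) j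
  term-word A F j lA = cases (bool-cases (flat F))
    where
    cases : flat F ≡ true ⊎ flat F ≡ false → iv (flat F ∧ (A ⊆ᵇ F)) (sh (rank F ∸ rank A) (P F) j) ≡ wordTerm (word A) (word F) j
    cases (inj₁ fl) = ≡.trans (iv-cong (≡.trans (≡.cong (_∧ (A ⊆ᵇ F)) fl) (≡.trans (⊆-word A F) (≡.sym (≡.cong (_∧ sub (word A) (word F)) (≡.trans (cloc-word F) (flat→local F fl))))))
        (λ _ → ≡.trans (≡.cong (λ k → sh k (P F) j) (rank-∸ F A (flat→local F fl) lA)) (sh-pow (corank A ∸ corank F) (P F) j)))
      (≡.sym (ivK-at (cloc (word F) ∧ sub (word A) (word F)) (pow (corank A ∸ corank F) KT.* P F) j))
    cases (inj₂ nf) = ≡.trans (≡.cong (λ b → iv (b ∧ (A ⊆ᵇ F)) (sh (rank F ∸ rank A) (P F) j)) nf) (≡.sym (≡.trans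
        (ivK-at (cloc (word F) ∧ sub (word A) (word F)) (pow (corank A ∸ corank F) KT.* P F) j)
        (≡.trans (iv-cong {cloc (word F) ∧ sub (word A) (word F)} refl (λ e → ≡.trans (ℤt.at (KT.*-congˡ {pow (corank A ∸ corank F)} (ℤt.eqv (not-flat F nf (proj₁ (∧-true e))))) j) (ℤt.at (KT.zeroʳ (pow (corank A ∸ corank F))) j)))
          (iv-0 (cloc (word F) ∧ sub (word A) (word F))))))

  Zsum : Subset (n ℕ.+ n) → Pol
  Zsum A = ΣW n (wordTerm (word A))

  sum-words : ∀ (φ : List Bits → Pol) j → Σs (n ℕ.+ n) (λ F → φ (word F) j) ≡ ΣW n φ j
  sum-words φ j = ≡.trans (Σs-join n n (λ F → φ (word F) j) (λ e → ≡.cong (λ w → φ w j) (word-ext e)))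
    (≡.trans (Σs-cong n λ S → Σs-cong n λ R → ≡.cong (λ w → φ w j) (≡.trans (word-nth (join n S R))
      (wordN-cong n (λ i _ → nth-cong (join-ˡ n S R) i) (λ i _ → nth-cong (join-ʳ n S R) i))))
    (Σs-words n φ j))

  sum-flats : ∀ A → Local-word A → ∀ j → Σs (n ℕ.+ n) (λ F → iv (flat F ∧ (A ⊆ᵇ F)) (sh (rank F ∸ rank A) (P F) j)) ≡ Zsum A j
  sum-flats A lA j = ≡.trans (Σs-cong (n ℕ.+ n) λ F → term-word A F j lA) (sum-words (wordTerm (word A)) j)

  Zsum-rev : ∀ A → Local-word A → Rev (corank A) (Zsum A) (Zsum A)
  Zsum-rev A lA = ≡.subst (λ k → Rev (corank A) (ΣW k (wordTerm (word A))) (ΣW k (wordTerm (word A)))) (length-wordN n (spokes A) (rims A))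
    (GW.word-graded (word A) (λ ()) (≡.trans (cloc-word A) lA))

  -- Up to the corank of `A`, the reversed terms at `j` are the shifted terms at the mirrored
  -- exponent, and `Zsum-rev` mirrors the total back. Beyond it everything vanishes.
  sum-flats-rev : ∀ A → Local-word A → ∀ j → Σs (n ℕ.+ n) (λ F → iv (flat F ∧ (A ⊆ᵇ F)) (rv (r ∸ rank F) (P F) j)) ≡ Zsum A j
  sum-flats-rev A lA j = cases (ℕP.≤-<-connex j (corank A))
   where
   cases : j ≤ corank A ⊎ corank A < j → Σs (n ℕ.+ n) (λ F → iv (flat F ∧ (A ⊆ᵇ F)) (rv (r ∸ rank F) (P F) j)) ≡ Zsum A j
   cases (inj₁ j≤) = ≡.trans (Σs-cong (n ℕ.+ n) term) (≡.trans (sum-flats A lA (corank A ∸ j)) (≡.sym (rev-coeff (Zsum-rev A lA) j (corank A ∸ j) (ℕP.m+[n∸m]≡n j≤))))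
    where
    term : ∀ F → iv (flat F ∧ (A ⊆ᵇ F)) (rv (r ∸ rank F) (P F) j) ≡ iv (flat F ∧ (A ⊆ᵇ F)) (sh (rank F ∸ rank A) (P F) (corank A ∸ j))
    term F = iv-cong {flat F ∧ (A ⊆ᵇ F)} refl λ e → equal (flat→local F (proj₁ (∧-true e))) (⊆-true {A = A} (proj₂ (∧-true {flat F} e)))
      where
      equal : Local-word F → (∀ i → A i ≡ true → F i ≡ true) → rv (r ∸ rank F) (P F) j ≡ sh (rank F ∸ rank A) (P F) (corank A ∸ j)
      equal lF A⊆F = ≡.trans (≡.cong (λ k → rv k (P F) j) (r-∸ F lF)) (≡.trans (rv-sh (corank F) (corank A ∸ corank F) (P F) j (≡.subst (j ≤_) (≡.sym split) j≤))
          (≡.cong₂ (λ d k → sh d (P F) (k ∸ j)) (≡.sym (rank-∸ F A lF lA)) split))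
        where
        F≤A : corank F ≤ corank A
        F≤A = ≡.subst₂ _≤_ (r-∸ F lF) (r-∸ A lA) (ℕP.∸-monoʳ-≤ r (rank-mono {A} {F} A⊆F))
        split : corank A ∸ corank F ℕ.+ corank F ≡ corank A
        split = ℕP.m∸n+n≡m F≤A
   cases (inj₂ lt) = ≡.trans (Σs-cong (n ℕ.+ n) λ F → ≡.trans (iv-cong {flat F ∧ (A ⊆ᵇ F)} refl λ e → beyond F (flat→local F (proj₁ (∧-true e))) (⊆-true {A = A} (proj₂ (∧-true {flat F} e)))) (iv-0 (flat F ∧ (A ⊆ᵇ F))))
      (≡.trans (sumL-0 (allSubsets (n ℕ.+ n))) (≡.sym (rev-degree (Zsum-rev A lA) j lt)))
    where
    beyond : ∀ F → Local-word F → (∀ i → A i ≡ true → F i ≡ true) → rv (r ∸ rank F) (P F) j ≡ + 0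
    beyond F lF A⊆F = rv-beyond (r ∸ rank F) (P F) j (ℕP.≤-<-trans (≡.subst (r ∸ rank F ≤_) (r-∸ A lA) (ℕP.∸-monoʳ-≤ r (rank-mono {A} {F} A⊆F))) lt)

  -- The flats containing `A` are those containing its closure, which has the same rank and a local
  -- word.
  pal : ∀ A j → Σs (n ℕ.+ n) (λ F → iv (flat F ∧ (A ⊆ᵇ F)) (sh (rank F ∸ rank A) (P F) j))
              ≡ Σs (n ℕ.+ n) (λ F → iv (flat F ∧ (A ⊆ᵇ F)) (rv (r ∸ rank F) (P F) j))
  pal A j = ≡.trans (Σs-cong (n ℕ.+ n) λ F → ≡.cong₂ (λ b k → iv b (sh (rank F ∸ k) (P F) j)) (closure F) (≡.sym (cl-rank A)))
    (≡.trans (sum-flats (cl A) (closed→local (cl A) (cl-closed A)) j)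
    (≡.trans (≡.sym (sum-flats-rev (cl A) (closed→local (cl A) (cl-closed A)) j))
    (Σs-cong (n ℕ.+ n) λ F → ≡.cong (λ b → iv b (rv (r ∸ rank F) (P F) j)) (≡.sym (closure F)))))
    where
    closure : ∀ F → flat F ∧ (A ⊆ᵇ F) ≡ flat F ∧ (cl A ⊆ᵇ F)
    closure F = bool-iff
      (λ e → ∧-true′ {flat F} {cl A ⊆ᵇ F} (proj₁ (∧-true {flat F} e)) (⊆-true′ {A = cl A} {F} (cl-least {A} {F} (flat→closed {F} (proj₁ (∧-true {flat F} e))) (⊆-true {A = A} (proj₂ (∧-true {flat F} e))))))
      (λ e → ∧-true′ {flat F} {A ⊆ᵇ F} (proj₁ (∧-true {flat F} e)) (⊆-true′ {A = A} {F} λ i a → ⊆-true {A = cl A} (proj₂ (∧-true {flat F} e)) i (⊆-cl {A} i a)))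

  P-degree : ∀ F → Degree (corank F) (P F)
  P-degree F = DG.klWord-degree (word F)

  P-top : ∀ {F} → flat F ≡ true → r ≤ rank F → ∀ i → P F i ≡ coeff (+ 1 ∷ []) i
  P-top {F} fl r≤ i = at-corank-0 (≡.subst (λ d → Degree d (P F)) (≡.trans (≡.sym (r-∸ F (flat→local F fl))) (ℕP.m≤n⇒m∸n≡0 r≤)) (P-degree F)) i
    where
    at-corank-0 : ∀ {p} → Degree 0 p → ∀ i → p i ≡ coeff (+ 1 ∷ []) i
    at-corank-0 (deg-0 e) zero = ℤt.at e 0
    at-corank-0 (deg-0 e) (suc i) = ℤt.at e (suc i)

  P-deg : ∀ {F} → flat F ≡ true → rank F < r → ∀ i → r ∸ rank F ≤ i ℕ.+ i → P F i ≡ + 0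
  P-deg {F} fl lt i le = vanish (≡.subst (λ d → Degree d (P F)) (≡.sym (r-∸ F (flat→local F fl))) (P-degree F)) le (ℕP.m<n⇒0<n∸m lt)
    where
    vanish : ∀ {d p} → Degree d p → d ≤ i ℕ.+ i → 0 < d → p i ≡ + 0
    vanish (deg-half h) le _ = half-coeff h i le

  open Palindromic pal P-top P-deg

  word-∅ : word ∅ ≡ replicate n (false , false)
  word-∅ = blank n (λ i i<n → s-< ∅ i<n) (λ i i<n → r-< ∅ i<n)

  Z-wheel : ∀ j → coeff (Zgraph Γ) j ≡ Zsum ∅ j
  Z-wheel j = ≡.trans (Zpoly-eq (≡.subst (_≤ suc (n ℕ.+ n)) (≡.sym full-rank) (ℕP.m≤n⇒m≤1+n (ℕP.m≤m+n n n))) j)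
    (≡.trans (Σs-cong (n ℕ.+ n) λ F → ≡.cong₂ (λ b k → iv b (sh (rank F ∸ k) (P F) j))
        (≡.trans (≡.sym (BP.∧-identityʳ (flat F))) (≡.cong (flat F ∧_) (≡.sym (⊆-true′ {A = ∅} {F} λ _ ())))) (≡.sym rank-∅))
    (sum-flats ∅ local-∅ j))
    where
    local-∅ : Local-word ∅
    local-∅ = loc-wordN n (spokes ∅) (rims ∅) λ i i<n → ≡.cong (λ y → ok3 y (spokes ∅ (suc i))) (≡.cong₂ _,_ (s-< ∅ i<n) (r-< ∅ i<n))
    rank-∅ : rank ∅ ≡ 0
    rank-∅ = ≡.trans (Local.rank-word ∅ local-∅) (ℕP.m≤n⇒m∸n≡0 (≡.subst (λ w → n ≤ crk# w) (≡.sym word-∅) (ℕP.≤-trans (ℕP.≤-reflexive (≡.sym (ends-blank n))) (ℕP.m≤m+n _ _))))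

wheel-coeff : ∀ k j → coeff (Zgraph (wheelGen (2 ℕ.+ k))) j ≡ (R KU.- D KU.- one) (2 ℕ.+ k) j
wheel-coeff k j = ≡.trans (WheelKL.Z-wheel (suc k) j) (≡.trans (≡.cong (λ w → ΣW (2 ℕ.+ k) (wordTerm w) j) (WheelKL.word-∅ (suc k)))
  (≡.trans (≡.cong (λ m → ΣW m (wordTerm blanks) j) (≡.sym (LP.length-replicate (2 ℕ.+ k))))
  (ℤt.at (KT.trans (word-nohub wheelP₀ (false , false) (replicate (suc k) (false , false)) (suc k) (nohub-blank (2 ℕ.+ k)) (ends-blank (2 ℕ.+ k))) (wheel-total k)) j)))
  where
  blanks : List Bits
  blanks = replicate (2 ℕ.+ k) (false , false)

-- Comparison with the series of the theorem

sumTo-head : ∀ n f → sumTo (suc n) f ≡ f 0 ℤ.+ sumTo n (f ∘ suc)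
sumTo-head zero f = refl
sumTo-head (suc n) f = ≡.trans (≡.cong (ℤ._+ f (suc (suc n))) (sumTo-head n f)) (ℤP.+-assoc (f 0) _ _)

sumTo-cong : ∀ n {f g} → (∀ i → f i ≡ g i) → sumTo n f ≡ sumTo n g
sumTo-cong zero e = e 0
sumTo-cong (suc n) e = ≡.cong₂ ℤ._+_ (sumTo-cong n e) (e (suc n))

sumTo-mul : ∀ n (p q : Pol) → sumTo n (λ i → p i ℤ.* q (n ∸ i)) ≡ ℤt.mul p q n
sumTo-mul zero p q = refl
sumTo-mul (suc n) p q = ≡.trans (sumTo-head n _) (≡.cong (λ z → p 0 ℤ.* q (suc n) ℤ.+ z) (sumTo-mul n (p ∘ suc) q))

sumTo-series : ∀ n (f g : Ser) i → sumTo n (λ a → ℤt.mul (f a) (g (n ∸ a)) i) ≡ (f KU.* g) n i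
sumTo-series zero f g i = refl
sumTo-series (suc n) f g i = ≡.trans (sumTo-head n _) (≡.cong (λ z → ℤt.mul (f 0) (g (suc n)) i ℤ.+ z) (sumTo-series n (f ∘ suc) g i))

⊗-mul : ∀ f g → (f ⊗ g) KU.≈ f KU.* g
⊗-mul f g = Su.eqv λ n → ℤt.eqv λ i → ≡.trans (sumTo-cong n λ a → sumTo-mul i (f a) (g (n ∸ a))) (sumTo-series n f g i)

infixl 7 _⊗≈_
_⊗≈_ : ∀ {f f′ g g′} → f KU.≈ f′ → g KU.≈ g′ → (f ⊗ g) KU.≈ f′ KU.* g′
_⊗≈_ {f} {f′} {g} {g′} e e′ = KU.trans (⊗-mul f g) (KU.*-cong e e′)

constS-≈ : ∀ c → constS c KU.≈ Su.const (ℤt.const c)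
constS-≈ c = Su.eqv λ { zero → ℤt.eqv (λ { zero → refl ; (suc i) → refl }) ; (suc n) → ℤt.eqv λ _ → refl }

tS-≈ : tS KU.≈ t̂
tS-≈ = Su.eqv λ { zero → ℤt.eqv (λ { zero → refl ; (suc zero) → refl ; (suc (suc i)) → refl }) ; (suc n) → ℤt.eqv λ _ → refl }

uS-≈ : uS KU.≈ û
uS-≈ = Su.eqv λ { zero → ℤt.eqv (λ _ → refl) ; (suc zero) → ℤt.eqv (λ { zero → refl ; (suc i) → refl }) ; (suc (suc n)) → ℤt.eqv λ _ → refl }

Aser-≈ : Aser KU.≈ A
Aser-≈ = KU.+-cong (constS-≈ (+ 1)) (KU.-‿cong (KU.+-cong tS-≈ (constS-≈ (+ 1)) ⊗≈ uS-≈))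

const₂ : Ser
const₂ = Su.const (ℤt.const (+ 2))

Δser-≈ : Δser KU.≈ S KU.* S
Δser-≈ = KU.trans (KU.+-cong (Aser-≈ ⊗≈ Aser-≈) (KU.-‿cong (constS-≈ (+ 4) ⊗≈ tS-≈ ⊗≈ uS-≈ ⊗≈ uS-≈))) (KU.sym N.S²)

Q : Ser
Q = KU.- D

DenSer-≈ : DenSer S KU.≈ A KU.- const₂ KU.* t̂ KU.* û KU.* û KU.+ S
DenSer-≈ = KU.+-congʳ {S} (KU.+-cong Aser-≈ (KU.-‿cong (constS-≈ (+ 2) ⊗≈ tS-≈ ⊗≈ uS-≈ ⊗≈ uS-≈)))

NumSer-≈ : NumSer KU.≈ Su.const (ℤt.const (ℤ.- + 2)) KU.* û KU.* A KU.* (t̂ KU.* (û KU.+ one) KU.+ one)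
NumSer-≈ = constS-≈ (ℤ.- + 2) ⊗≈ uS-≈ ⊗≈ Aser-≈ ⊗≈ KU.+-cong (tS-≈ ⊗≈ KU.+-cong uS-≈ (constS-≈ (+ 1))) (constS-≈ (+ 1))

Q-eq : (Q ⊗ DenSer S) KU.≈ NumSer
Q-eq = KU.trans (KU.refl ⊗≈ DenSer-≈) (KU.trans (N.quotient M M-eq) (KU.sym NumSer-≈))

polySer : ∀ {f g} → Revs.All f g → IsPolySer f
polySer h n = n , λ i n<i → rev-degree (h n) i n<i

S₀ : ∀ i → S 0 i ≡ oneS 0 i
S₀ zero = refl
S₀ (suc i) = rev-degree (rev-S 0) (suc i) (s≤s z≤n)

small : ∀ n i → n < i → (R KU.- D KU.- one) n i ≡ + 0
small n i = rev-degree (rev-wheel n) i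

-- Exponents 0 and 1 of `u` must vanish, and exponent 2 belongs to the triangle, which is not
-- defined through `wheelGen`. These are settled by evaluation, the degree bound `small` leaving
-- finitely many coefficients.
ZWheel-≈ : ∀ n i → ZWheelSer n i ≡ (R KU.- D KU.- one) n i
ZWheel-≈ zero zero = refl
ZWheel-≈ zero (suc i) = ≡.sym (small 0 (suc i) (s≤s z≤n))
ZWheel-≈ (suc zero) zero = refl
ZWheel-≈ (suc zero) (suc zero) = refl
ZWheel-≈ (suc zero) (suc (suc i)) = ≡.sym (small 1 (suc (suc i)) (s≤s (s≤s z≤n)))
ZWheel-≈ (suc (suc zero)) zero = refl
ZWheel-≈ (suc (suc zero)) (suc zero) = refl
ZWheel-≈ (suc (suc zero)) (suc (suc zero)) = refl
ZWheel-≈ (suc (suc zero)) (suc (suc (suc i))) = ≡.sym (small 2 (suc (suc (suc i))) (s≤s (s≤s (s≤s z≤n))))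
ZWheel-≈ (suc (suc (suc k))) i = wheel-coeff (suc k) i

theorem6p6 : Σ Ser λ S → IsPolySer S × (S ⊗ S ≈ˢ Δser) × (∀ i → S 0 i ≡ oneS 0 i) ×
    Σ Ser λ Q → IsPolySer Q × (Q ⊗ DenSer S ≈ˢ NumSer) ×
    Σ Ser λ R → IsPolySer R × (R ⊗ S ≈ˢ oneS) ×
    (ZWheelSer ≈ˢ Q ⊕ R ⊖ oneS)
theorem6p6 = S , polySer rev-S , pointwise (KU.trans (⊗-mul S S) (KU.sym Δser-≈)) , S₀ ,
    Q , polySer (Revs.all-neg rev-D) , pointwise Q-eq ,
    R , polySer rev-R , pointwise (KU.trans (⊗-mul R S) (KU.trans (KU.*-comm R S) (KU.trans R-eq (KU.sym (constS-≈ (+ 1)))))) ,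
    λ n i → ≡.trans (ZWheel-≈ n i) (≡.cong₂ ℤ._-_ (ℤP.+-comm (R n i) (Q n i)) (≡.sym (ℤt.at (Su.at (constS-≈ (+ 1)) n) i)))
  where
  pointwise : ∀ {f g} → f KU.≈ g → f ≈ˢ g
  pointwise e n i = ℤt.at (Su.at e n) i
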